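{- For every $n\ge1$, the number of domino tilings of the Aztec diamond $AD_n$ equals $\det M_H$, where $M_H$ is the hamburger matrix of the digraph $H$ of $AD_n$.
   Context: The Aztec diamond $AD_n$ is the union of the $2n(n+1)$ unit squares in the plane whose vertices are integral points $(x,y)$ with $|x|+|y|\le n+1$. A domino tiling is a tiling by $1\times2$ and $2\times1$ rectangles made of two unit squares. Digraph of $AD_n$: tile $AD_n$ by horizontal dominoes (the natural tiling; each row of even length is cut into horizontal dominoes) and put a vertex at the center of each domino. From every vertex $(x,y)$ in the top half ($y>0$), create directed edges to $(x+2,y)$, $(x+1,y+1)$, $(x+1,y-1)$ whenever there is a vertex there. From every vertex in the bottom half ($y<0$), create directed edges to $(x-2,y)$, $(x-1,y-1)$, $(x-1,y+1)$ whenever there is a vertex there. Label the vertices of the bottom row of the top half $v_1,\dots,v_n$ from west to east, and the vertices of the top row of the bottom half $w_{n+1},\dots,w_{2n}$ from west to east. For each $1\le i\le n$ add directed edges $v_i\to w_{n+i}$ and $w_{n+i}\to v_i$. Let $G_1$ and $G_2$ be the subgraphs on the top-half and bottom-half vertices, respectively. The hamburger matrix of $H$ is the $2n\times2n$ block matrix $M_H=\begin{bmatrix}A&I_n\\-I_n&B\end{bmatrix}$, where $a_{ij}$ is the number of directed paths from $v_i$ to $v_j$ in $G_1$ and $b_{ij}$ is the number of directed paths from $w_{n+i}$ to $w_{n+j}$ in $G_2$ (trivial paths counted, so $a_{ii}=b_{ii}=1$). -}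

module Defs where

open import Data.Bool.Base using (Bool; true)
open import Data.Fin.Base using (Fin; zero; suc; toℕ; punchIn)
open import Data.Fin.Properties using (toℕ<n; _≟_)
open import Data.Integer.Base
  using (ℤ; +_; -[1+_]; ∣_∣; _+_; _-_; _*_; -_; _^_; _≤_; _<_; 0ℤ; 1ℤ; -1ℤ; +-0-rawMonoid)
import Data.Integer.Properties as ℤ
open import Algebra.Definitions.RawMonoid +-0-rawMonoid using (sum)
open import Data.Irrelevant using ([_])
open import Data.List.Base using (List; []; _∷_)
open import Data.List.Membership.Propositional using (_∈_)
open import Data.List.Relation.Unary.All using (All; []; _∷_)
open import Data.Nat.Base as ℕ using (ℕ; zero; suc)
import Data.Nat.Properties as ℕ
open import Data.Product.Base using (_×_; _,_; proj₁; proj₂; ∃; ∃-syntax)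
open import Data.Product using (∃!)
open import Data.Refinement using (Refinement; Refinement-syntax; _,_; value)
open import Data.Sum.Base using (inj₁; inj₂)
open import Data.Vec.Functional using (Vector; _++_)
open import Function.Bundles using (Inverse)
open import Level using (0ℓ)
open import Relation.Binary.Bundles using (Setoid)
open import Relation.Binary.Core using (Rel)
open import Relation.Binary.Construct.Closure.ReflexiveTransitive using (Star)
open import Relation.Binary.PropositionalEquality
open import Relation.Nullary.Decidable using (yes; no)
open import Relation.Nullary.Negation using (¬_)

HasCardinality : Setoid 0ℓ 0ℓ → ℕ → Set
HasCardinality S k = Inverse S (setoid (Fin k))

------------------------------------------------------------------------
-- Matrices

Matrix : Set → ℕ → ℕ → Set
Matrix A m n = Vector (Vector A n) m

-- Laplace expansion along the first row.
det : ∀ {n} → Matrix ℤ n n → ℤ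
det {zero}  M = 1ℤ
det {suc n} M = sum λ j →
  -1ℤ ^ toℕ j * M zero j * det (λ r c → M (suc r) (punchIn j c))

block : ∀ {A m n} → Matrix A m m → Matrix A m n →
        Matrix A n m → Matrix A n n → Matrix A (m ℕ.+ n) (m ℕ.+ n)
block P Q R S = (λ i → P i ++ Q i) ++ (λ i → R i ++ S i)

identity : ∀ n → Matrix ℤ n n
identity n i j with i ≟ j
... | yes _ = 1ℤ
... | no  _ = 0ℤ

------------------------------------------------------------------------
-- The Aztec diamond and its domino tilings

Point : Set
Point = ℤ × ℤ

-- A unit square is represented by its south-west corner.
Square : Set
Square = ℤ × ℤ

corners : Square → List Point
corners (a , b) =
  (a , b) ∷ (a + 1ℤ , b) ∷ (a , b + 1ℤ) ∷ (a + 1ℤ , b + 1ℤ) ∷ []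

AD : ℕ → Square → Set
AD n s = All (λ (x , y) → ∣ x ∣ ℕ.+ ∣ y ∣ ℕ.≤ suc n) (corners s)

-- A domino is represented by its western, respectively southern, square.
data Domino : Set where
  horizontal vertical : Square → Domino

squares : Domino → List Square
squares (horizontal (a , b)) = (a , b) ∷ (a + 1ℤ , b) ∷ []
squares (vertical   (a , b)) = (a , b) ∷ (a , b + 1ℤ) ∷ []

record Tiling (n : ℕ) : Set where
  field
    member : Domino → Bool
    inside : ∀ d → member d ≡ true → All (AD n) (squares d)
    covers : ∀ s → AD n s →
             ∃! _≡_ λ d → member d ≡ true × s ∈ squares d

open Tiling public

-- Tilings are identified when they consist of the same dominoes.
tilings : ℕ → Setoid 0ℓ 0ℓ
tilings n = record
  { Carrier       = Tiling n
  ; _≈_           = λ T U → ∀ d → member T d ≡ member U d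
  ; isEquivalence = record
    { refl  = λ d → refl
    ; sym   = λ p d → sym (p d)
    ; trans = λ p q d → trans (p d) (q d)
    }
  }

------------------------------------------------------------------------
-- The digraph of the Aztec diamond

-- The horizontal dominoes with western square (a , b) obtained by cutting
-- each row of AD n into dominoes from its west end, which is 2k squares
-- further west.
Natural : ℕ → Square → Set
Natural n (a , b) =
  All (AD n) (squares (horizontal (a , b))) ×
  ∃[ k ] AD n (a - + (2 ℕ.* k) , b) × ¬ AD n (a - + (2 ℕ.* k) - 1ℤ , b)

-- The pair (x , j) stands for the point (x , j + 1/2), so that all
-- coordinates are integers; in particular y > 0 means j ≥ 0.
center : Square → ℤ × ℤ
center (a , b) = a + 1ℤ , b

Vertex : ℕ → Set
Vertex n = [ p ∈ ℤ × ℤ ∣ ∃[ s ] Natural n s × center s ≡ p ]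

module _ {n : ℕ} where

  Top Bottom : Vertex n → Set
  Top    s = 0ℤ ≤ proj₂ (value s)
  Bottom s = proj₂ (value s) < 0ℤ

topTargets bottomTargets : ℤ × ℤ → List (ℤ × ℤ)
topTargets (x , j) =
  (x + + 2 , j) ∷ (x + 1ℤ , j + 1ℤ) ∷ (x + 1ℤ , j - 1ℤ) ∷ []
bottomTargets (x , j) =
  (x - + 2 , j) ∷ (x - 1ℤ , j - 1ℤ) ∷ (x - 1ℤ , j + 1ℤ) ∷ []

private

  ∣2i-n∣ : ∀ {m n} → m ℕ.≤ 2 ℕ.* n → ∣ + m - + n ∣ ℕ.≤ n
  ∣2i-n∣ {m} {n} m≤2n rewrite ℤ.m-n≡m⊖n m n with ℕ.≤-total m n
  ... | inj₁ m≤n rewrite ℤ.∣⊖∣-≤ m≤n = ℕ.m∸n≤m n m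
  ... | inj₂ n≤m rewrite ℤ.⊖-≥ n≤m =
    ℕ.m≤n+o⇒m∸n≤o m n (subst (m ℕ.≤_) (cong (n ℕ.+_) (ℕ.+-identityʳ n)) m≤2n)

  shift : ∀ m n → + m - + n + 1ℤ ≡ + suc m - + n
  shift m n = trans (ℤ.+-assoc (+ m) (- + n) 1ℤ)
    (trans (cong (λ k → + m + k) (ℤ.+-comm (- + n) 1ℤ))
    (trans (sym (ℤ.+-assoc (+ m) 1ℤ (- + n)))
           (cong (λ k → + k - + n) (ℕ.+-comm m 1))))

  row-AD : ∀ {n b} m → ∣ b ∣ ℕ.≤ 1 → ∣ b + 1ℤ ∣ ℕ.≤ 1 →
           suc m ℕ.≤ 2 ℕ.* n → AD n (+ m - + n , b)
  row-AD {n} {b} m p q m<2n rewrite shift m n =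
    bound l p ∷ bound r p ∷ bound l q ∷ bound r q ∷ []
    where
    l = ∣2i-n∣ (ℕ.<⇒≤ m<2n)
    r = ∣2i-n∣ m<2n
    bound : ∀ {x y} → x ℕ.≤ n → y ℕ.≤ 1 → x ℕ.+ y ℕ.≤ suc n
    bound {x} {y} x≤n y≤1 =
      subst (x ℕ.+ y ℕ.≤_) (ℕ.+-comm n 1) (ℕ.+-mono-≤ x≤n y≤1)

  module _ {n : ℕ} (i : Fin n) where

    1+2i<2n : suc (suc (2 ℕ.* toℕ i)) ℕ.≤ 2 ℕ.* n
    1+2i<2n = subst (ℕ._≤ 2 ℕ.* n) (ℕ.*-suc 2 (toℕ i)) (ℕ.*-monoʳ-≤ 2 (toℕ<n i))

    a = + (2 ℕ.* toℕ i) - + n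

    west-end : a - + (2 ℕ.* toℕ i) ≡ + 0 - + n
    west-end = trans (cong (_- + (2 ℕ.* toℕ i)) (ℤ.+-comm (+ (2 ℕ.* toℕ i)) (- + n)))
      (trans (ℤ.+-assoc (- + n) (+ (2 ℕ.* toℕ i)) _)
      (trans (cong (λ k → - + n + k) (ℤ.+-inverseʳ (+ (2 ℕ.* toℕ i))))
             (ℤ.+-comm (- + n) 0ℤ)))

    ∣west-end-1∣ : ∣ + 0 - + n - 1ℤ ∣ ≡ suc n
    ∣west-end-1∣ = trans (cong ∣_∣ (trans (cong (_- 1ℤ) (ℤ.+-identityˡ (- + n)))
                                          (sym (ℤ.neg-distrib-+ (+ n) 1ℤ))))
                   (trans (ℤ.∣-i∣≡∣i∣ (+ (n ℕ.+ 1))) (ℕ.+-comm n 1))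

    natural : ∀ {b} → ∣ b ∣ ℕ.≤ 1 → ∣ b + 1ℤ ∣ ℕ.≤ 1 →
              ¬ AD n (+ 0 - + n - 1ℤ , b) → Natural n (a , b)
    natural p q out =
      ( row-AD _ p q (ℕ.<⇒≤ 1+2i<2n)
      ∷ subst (λ x → AD n (x , _)) (sym (shift (2 ℕ.* toℕ i) n))
          (row-AD _ p q 1+2i<2n)
      ∷ [])
      , toℕ i
      , subst (λ x → AD n (x , _)) (sym west-end)
          (row-AD 0 p q (ℕ.≤-trans (ℕ.s≤s ℕ.z≤n) 1+2i<2n))
      , subst (λ x → ¬ AD n (x - 1ℤ , _)) (sym west-end) out

    too-far : ¬ ∣ + 0 - + n - 1ℤ ∣ ℕ.+ 1 ℕ.≤ suc n
    too-far p rewrite ∣west-end-1∣ = ℕ.m+1+n≰m (suc n) p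

    natural-v : Natural n (a , 0ℤ)
    natural-v = natural ℕ.z≤n (ℕ.s≤s ℕ.z≤n) λ { (_ ∷ _ ∷ p ∷ _) → too-far p }

    natural-w : Natural n (a , -1ℤ)
    natural-w = natural (ℕ.s≤s ℕ.z≤n) ℕ.z≤n λ { (p ∷ _) → too-far p }

-- With i counted from 0, v i and w i are the vertices labelled v_{i+1} and
-- w_{n+i+1}; the rows next to the horizontal axis have abscissae
-- -n+1 , -n+3 , … , n-1.
v w : ∀ {n} → Fin n → Vertex n
v {n} i = (+ (2 ℕ.* toℕ i) - + n + 1ℤ , 0ℤ)  , [ _ , natural-v i , refl ]
w {n} i = (+ (2 ℕ.* toℕ i) - + n + 1ℤ , -1ℤ) , [ _ , natural-w i , refl ]

data Edge {n : ℕ} (s t : Vertex n) : Set where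
  top    : Top s    → value t ∈ topTargets    (value s) → Edge s t
  bottom : Bottom s → value t ∈ bottomTargets (value s) → Edge s t
  v→w    : ∀ i → s ≡ v i → t ≡ w i → Edge s t
  w→v    : ∀ i → s ≡ w i → t ≡ v i → Edge s t

G₁ G₂ : ∀ n → Rel (Vertex n) 0ℓ
G₁ n s t = Top s    × Top t    × Edge s t
G₂ n s t = Bottom s × Bottom t × Edge s t

------------------------------------------------------------------------
-- The hamburger matrix

-- Edge proofs between two given vertices of G₁ or G₂ are unique and both
-- digraphs are acyclic, so elements of Star are exactly directed paths.
CountsPaths : ∀ {n} {V : Set} → Rel V 0ℓ → (Fin n → V) → Matrix ℕ n n → Set
CountsPaths G p A =
  ∀ i j → HasCardinality (setoid (Star G (p i) (p j))) (A i j)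

-- A hamburger matrix is determined up to pointwise equality by this
-- predicate, since cardinalities are unique.
IsHamburgerMatrix : ∀ n → Matrix ℤ (n ℕ.+ n) (n ℕ.+ n) → Set
IsHamburgerMatrix n M =
  ∃[ A ] ∃[ B ] CountsPaths (G₁ n) v A × CountsPaths (G₂ n) w B ×
  (∀ i j → M i j ≡ block (λ k l → + A k l) (identity n)
                         (λ k l → - identity n k l) (λ k l → + B k l) i j)

-- Both sides equal 2^(n(n+1)/2).
--
-- Determinant. Paths between vertices on the axis are counted by the large
-- Schröder numbers, with generating function s = 1 + x s + x s², so A is the
-- upper triangular Toeplitz matrix of s and B is its transpose. With the little
-- Schröder series g, s = 2 g - 1, one has
--   (1 + s s′) / (1 - x x′) = 2 g g′ / (1 - 2 x x′ g g′),
-- that is, I + A B = P D Pᵀ with P unitriangular (a reversed Riordan array of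
-- (g , x g)) and D the diagonal matrix of the powers 2^n , … , 2. Row operations
-- turn the hamburger matrix into [ 0  D Pᵀ ; -I  B ].
--
-- Tilings. The diagonals of black squares have n squares, the diagonals of white
-- squares between them n + 1, and two neighbouring diagonals form a path, on which
-- a matching is determined by the set of squares it covers. Between two
-- consecutive black diagonals, a white diagonal with n + 1 squares can be
-- replaced by one with n - 1 squares at the expense of a factor 2. Replacing all
-- n white diagonals leaves AD (n - 1) with the colours exchanged, since the
-- first and last black diagonals become forced; hence the factor 2^n.

module Submission where

-- Expanding the quotient above as a geometric series in `2 x x′ g g′` gives the terms
-- `2^(k+1) (g (x g)^k) (g′ (x′ g′)^k)`: this is the origin of the Riordan array and of the powers
-- in `D`. Series are handled only through the coefficients of their powers. The same table counts
-- paths: those from height `e` to the axis belong to the exponent `e + 1`.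
--
-- The factor 2 of a shortened white diagonal is proved by reading the cells from one end. A partly
-- read pair of zigzag paths carries a state, and the identity for the empty state closes up only
-- together with identities for the states in which one side reaches over the cut.

-- Determinants under row operations, for the expansion along the first row.

module Determinant where

  open import Data.Empty using (⊥-elim)
  open import Data.Fin.Base using (Fin; zero; suc; toℕ; punchIn; _↑ˡ_; _↑ʳ_; splitAt; fromℕ<)
  open import Data.Fin.Properties
    using (toℕ<n; toℕ-fromℕ<; toℕ-injective; punchInᵢ≢i; splitAt-↑ˡ; splitAt-↑ʳ)
  open import Data.Integer.Base using (ℤ; +_; _+_; _*_; -_; _^_; 0ℤ; 1ℤ; -1ℤ)
  open import Data.Integer.Properties
    using (+-*-semiring; +-identityʳ; *-identityˡ; *-identityʳ; *-zeroʳ)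
  open import Data.Integer.Tactic.RingSolver using (solve-∀)
  open import Data.Nat.Base as ℕ using (ℕ; zero; suc; z≤n; s≤s)
  import Data.Nat.Properties as ℕ
  open import Data.Sum.Base using (_⊎_; inj₁; inj₂; [_,_])
  open import Data.Vec.Functional using (Vector; _∷_; _++_; foldr; tail)
  open import Defs using (Matrix; det)
  open import Function.Base using (_∘_)
  open import Relation.Binary.Definitions using (Tri; tri<; tri≈; tri>)
  open import Relation.Binary.PropositionalEquality
  open ≡-Reasoning

  open import Algebra.Properties.Semiring.Sum +-*-semiring
    using (sum; sum-cong-≗; sum-remove; ∑-distrib-+; ∑-comm; sum-replicate-zero; *-distribˡ-sum)

  private
    variable
      m n : ℕ

  sum-zero : {f : Vector ℤ n} → (∀ i → f i ≡ 0ℤ) → sum f ≡ 0ℤ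
  sum-zero {n} f≡0 = trans (sum-cong-≗ f≡0) (sum-replicate-zero n)

  sgn : Fin n → ℤ
  sgn j = -1ℤ ^ toℕ j

  cofactor : Matrix ℤ n (suc n) → Fin (suc n) → ℤ
  cofactor R j = det (λ r → R r ∘ punchIn j)

  det-cong : (M N : Matrix ℤ n n) → (∀ i j → M i j ≡ N i j) → det M ≡ det N
  det-cong {zero}  M N M≗N = refl
  det-cong {suc n} M N M≗N = sum-cong-≗ λ j →
    cong₂ (λ x d → sgn j * x * d) (M≗N zero j) (det-cong _ _ λ r c → M≗N (suc r) (punchIn j c))

  det-combination : (R : Matrix ℤ n (suc n)) (a : Vector ℤ m) (r : Matrix ℤ m (suc n)) →
    det ((λ j → sum λ k → a k * r k j) ∷ R) ≡ sum λ k → a k * det (r k ∷ R)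
  det-combination R a r = begin
    (sum λ j → sgn j * sum (λ k → a k * r k j) * cofactor R j)
      ≡⟨ sum-cong-≗ (λ j → trans (shuffle (sgn j) _ (cofactor R j))
           (*-distribˡ-sum (sgn j * cofactor R j) (λ k → a k * r k j))) ⟩
    (sum λ j → sum λ k → sgn j * cofactor R j * (a k * r k j))
      ≡⟨ ∑-comm (λ j k → sgn j * cofactor R j * (a k * r k j)) ⟩
    (sum λ k → sum λ j → sgn j * cofactor R j * (a k * r k j))
      ≡⟨ sum-cong-≗ (λ k → trans
           (sum-cong-≗ λ j → shuffle′ (sgn j) (cofactor R j) (a k) (r k j))
           (sym (*-distribˡ-sum (a k) (λ j → sgn j * r k j * cofactor R j)))) ⟩
    (sum λ k → a k * det (r k ∷ R)) ∎
    where
    shuffle : ∀ x y z → x * y * z ≡ x * z * y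
    shuffle = solve-∀
    shuffle′ : ∀ x y z w → x * y * (z * w) ≡ z * (x * w * y)
    shuffle′ = solve-∀

  det-+ : (R : Matrix ℤ n (suc n)) (r s : Vector ℤ (suc n)) →
    det ((λ j → r j + s j) ∷ R) ≡ det (r ∷ R) + det (s ∷ R)
  det-+ R r s = trans (sum-cong-≗ λ j → expand (sgn j) (r j) (s j) (cofactor R j))
    (∑-distrib-+ (λ j → sgn j * r j * cofactor R j) (λ j → sgn j * s j * cofactor R j))
    where
    expand : ∀ x y z w → x * (y + z) * w ≡ x * y * w + x * z * w
    expand = solve-∀

  -- Deleting column j and then column k of the rest is the same as deleting
  -- column punchIn j k and then column coPunch j k of the rest.
  coPunch : Fin (suc (suc n)) → Fin (suc n) → Fin (suc n)
  coPunch zero    k       = zero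
  coPunch (suc j) zero    = j
  coPunch {suc n} (suc j) (suc k) = suc (coPunch j k)

  punchIn-coPunch : (j : Fin (suc (suc n))) (k : Fin (suc n)) →
    punchIn (punchIn j k) (coPunch j k) ≡ j
  punchIn-coPunch zero    k       = refl
  punchIn-coPunch (suc j) zero    = refl
  punchIn-coPunch {suc n} (suc j) (suc k) = cong suc (punchIn-coPunch j k)

  punchIn-punchIn : (j : Fin (suc (suc n))) (k : Fin (suc n)) (c : Fin n) →
    punchIn (punchIn j k) (punchIn (coPunch j k) c) ≡ punchIn j (punchIn k c)
  punchIn-punchIn zero    k       c       = refl
  punchIn-punchIn (suc j) zero    c       = refl
  punchIn-punchIn (suc j) (suc k) zero    = refl
  punchIn-punchIn (suc j) (suc k) (suc c) = cong suc (punchIn-punchIn j k c)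

  -- For columns `a < b`, deleting `a` first gives the positions `a` and `b - 1`, deleting `b` first
  -- gives `b` and `a`; the exponents differ by exactly one.
  sgn-coPunch : (j : Fin (suc (suc n))) (k : Fin (suc n)) →
    sgn (punchIn j k) * sgn (coPunch j k) ≡ - (sgn j * sgn k)
  sgn-coPunch zero    k       = lemma (sgn k)
    where
    lemma : ∀ x → -1ℤ * x * 1ℤ ≡ - (1ℤ * x)
    lemma = solve-∀
  sgn-coPunch (suc j) zero    = lemma (sgn j)
    where
    lemma : ∀ x → 1ℤ * x ≡ - (-1ℤ * x * 1ℤ)
    lemma = solve-∀
  sgn-coPunch {suc n} (suc j) (suc k) = begin
    -1ℤ * sgn (punchIn j k) * (-1ℤ * sgn (coPunch j k)) ≡⟨ lemma (sgn (punchIn j k)) _ ⟩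
    sgn (punchIn j k) * sgn (coPunch j k)               ≡⟨ sgn-coPunch j k ⟩
    - (sgn j * sgn k)                                   ≡⟨ cong -_ (lemma (sgn j) (sgn k)) ⟨
    - (-1ℤ * sgn j * (-1ℤ * sgn k))                     ∎
    where
    lemma : ∀ x y → -1ℤ * x * (-1ℤ * y) ≡ x * y
    lemma = solve-∀

  -- The map from `(j , k)` to `(punchIn j k , coPunch j k)` exchanges the members of an ordered
  -- pair of distinct columns, so it permutes the summands. Pairs that begin with column `zero`
  -- trade places with those that end with it; what remains is the same sum with one column fewer.
  sum-coPunch : (T : Fin (suc (suc n)) → Fin (suc n) → ℤ) →
    (sum λ j → sum λ k → T j k) ≡ sum λ j → sum λ k → T (punchIn j k) (coPunch j k)
  sum-coPunch {zero}  T = lemma (T zero zero) (T (suc zero) zero)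
    where
    lemma : ∀ x y → x + 0ℤ + (y + 0ℤ + 0ℤ) ≡ y + 0ℤ + (x + 0ℤ + 0ℤ)
    lemma = solve-∀
  sum-coPunch {suc n} T = begin
    sum (T zero) + (sum λ j → T (suc j) zero + sum (λ k → T (suc j) (suc k)))
      ≡⟨ cong (λ x → sum (T zero) + x)
           (∑-distrib-+ (λ j → T (suc j) zero) (λ j → sum λ k → T (suc j) (suc k))) ⟩
    sum (T zero) + (T₀ + (sum λ j → sum λ k → T (suc j) (suc k)))
      ≡⟨ cong (λ x → sum (T zero) + (T₀ + x)) (sum-coPunch (λ j k → T (suc j) (suc k))) ⟩
    sum (T zero) + (T₀ + (sum λ j → sum λ k → T (suc (punchIn j k)) (suc (coPunch j k))))
      ≡⟨ lemma (sum (T zero)) T₀ _ ⟩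
    T₀ + (sum (T zero) + (sum λ j → sum λ k → T (suc (punchIn j k)) (suc (coPunch j k))))
      ≡⟨ cong (λ x → T₀ + x)
           (∑-distrib-+ (T zero) (λ j → sum λ k → T (suc (punchIn j k)) (suc (coPunch j k)))) ⟨
    T₀ + (sum λ j → T zero j + sum (λ k → T (suc (punchIn j k)) (suc (coPunch j k)))) ∎
    where
    T₀ = sum λ j → T (suc j) zero
    lemma : ∀ x y z → x + (y + z) ≡ y + (x + z)
    lemma = solve-∀

  sum-neg : (f : Vector ℤ n) → sum (λ i → - f i) ≡ - sum f
  sum-neg {zero}  f = refl
  sum-neg {suc n} f = trans (cong (λ x → - f zero + x) (sum-neg (tail f))) (lemma (f zero) _)
    where
    lemma : ∀ x y → - x + - y ≡ - (x + y)
    lemma = solve-∀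

  module _ (r s : Vector ℤ (suc (suc n))) (R : Matrix ℤ n (suc (suc n))) where

    private
      det-R : Fin (suc (suc n)) → Fin (suc n) → ℤ
      det-R j k = det λ i c → R i (punchIn j (punchIn k c))

    det-two-rows : det (r ∷ s ∷ R) ≡
      sum λ j → sum λ k → sgn j * sgn k * (r j * s (punchIn j k) * det-R j k)
    det-two-rows = sum-cong-≗ λ j →
      trans (*-distribˡ-sum (sgn j * r j) (λ k → sgn k * s (punchIn j k) * det-R j k))
            (sum-cong-≗ λ k → lemma (sgn j) (r j) (sgn k) (s (punchIn j k)) (det-R j k))
      where
      lemma : ∀ a b c d e → a * b * (c * d * e) ≡ a * c * (b * d * e)
      lemma = solve-∀

  -- Both determinants are sums over ordered pairs of distinct columns. Exchanging the pair keeps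
  -- the minor, by `punchIn-punchIn`, and reverses the sign, by `sgn-coPunch`.
  det-swap : (r s : Vector ℤ (suc (suc n))) (R : Matrix ℤ n (suc (suc n))) →
    det (s ∷ r ∷ R) ≡ - det (r ∷ s ∷ R)
  det-swap r s R = begin
    det (s ∷ r ∷ R)
      ≡⟨ det-two-rows s r R ⟩
    (sum λ j → sum λ k → T j k)
      ≡⟨ sum-coPunch T ⟩
    (sum λ j → sum λ k → T (punchIn j k) (coPunch j k))
      ≡⟨ sum-cong-≗ (λ j → trans (sum-cong-≗ (λ k → T-swap j k)) (sum-neg (T′ j))) ⟩
    (sum λ j → - sum λ k → T′ j k)
      ≡⟨ sum-neg (λ j → sum (T′ j)) ⟩
    - (sum λ j → sum λ k → T′ j k)
      ≡⟨ cong -_ (det-two-rows r s R) ⟨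
    - det (r ∷ s ∷ R) ∎
    where
    det-R : Fin _ → Fin _ → ℤ
    det-R j k = det λ i c → R i (punchIn j (punchIn k c))
    T T′ : Fin _ → Fin _ → ℤ
    T  j k = sgn j * sgn k * (s j * r (punchIn j k) * det-R j k)
    T′ j k = sgn j * sgn k * (r j * s (punchIn j k) * det-R j k)
    lemma : ∀ x a b c → - x * (a * b * c) ≡ - (x * (b * a * c))
    lemma = solve-∀
    T-swap : ∀ j k → T (punchIn j k) (coPunch j k) ≡ - T′ j k
    T-swap j k = trans
      (cong₂ _*_ (sgn-coPunch j k)
        (cong₂ (λ i d → s (punchIn j k) * r i * d) (punchIn-coPunch j k)
          (det-cong _ _ λ i c → cong (R i) (punchIn-punchIn j k c))))
      (lemma (sgn j * sgn k) (s (punchIn j k)) (r j) (det-R j k))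

  x≡-x⇒x≡0 : ∀ x → x ≡ - x → x ≡ 0ℤ
  x≡-x⇒x≡0 (+ zero) _ = refl

  -- If the copy is the next row, exchanging the two changes the sign and nothing else. Otherwise
  -- the exchange makes the repeated row the second one, and each cofactor of the new first row
  -- begins with a copy of one of its later rows.
  det-repeated-row : (R : Matrix ℤ n (suc n)) (k : Fin n) → det (R k ∷ R) ≡ 0ℤ
  det-repeated-row R zero = x≡-x⇒x≡0 _ (begin
    det (R zero ∷ R)               ≡⟨ det-cong _ _ rows ⟩
    det (R zero ∷ R zero ∷ tail R) ≡⟨ det-swap (R zero) (R zero) (tail R) ⟩
    - det (R zero ∷ R zero ∷ tail R) ≡⟨ cong -_ (det-cong _ _ rows) ⟨
    - det (R zero ∷ R)             ∎)
    where
    rows : ∀ i j → (R zero ∷ R) i j ≡ (R zero ∷ R zero ∷ tail R) i j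
    rows zero          j = refl
    rows (suc zero)    j = refl
    rows (suc (suc i)) j = refl
  det-repeated-row R (suc k) = begin
    det (R (suc k) ∷ R)                   ≡⟨ det-cong _ _ rows ⟩
    det (R (suc k) ∷ R zero ∷ tail R)     ≡⟨ det-swap (R zero) (R (suc k)) (tail R) ⟩
    - det (R zero ∷ R (suc k) ∷ tail R)   ≡⟨ cong -_ (sum-zero λ j →
      trans (cong (λ x → sgn j * R zero j * x)
              (trans (det-cong (λ r → (R (suc k) ∷ tail R) r ∘ punchIn j)
                               ((R (suc k) ∘ punchIn j) ∷ λ r → R (suc r) ∘ punchIn j)
                               (λ { zero c → refl ; (suc i) c → refl }))
                (det-repeated-row (λ i c → R (suc i) (punchIn j c)) k)))
            (*-zeroʳ (sgn j * R zero j))) ⟩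
    - 0ℤ                                  ≡⟨⟩
    0ℤ                                    ∎
    where
    rows : ∀ i j → (R (suc k) ∷ R) i j ≡ (R (suc k) ∷ R zero ∷ tail R) i j
    rows zero          j = refl
    rows (suc zero)    j = refl
    rows (suc (suc i)) j = refl

  -- Choosing the rows through `ρ` lets the same lemma clear a row against either block of a stacked
  -- matrix.
  det-add-combination : (R : Matrix ℤ n (suc n)) (r : Vector ℤ (suc n)) (a : Vector ℤ m)
    (ρ : Fin m → Fin n) → det ((λ j → r j + sum λ k → a k * R (ρ k) j) ∷ R) ≡ det (r ∷ R)
  det-add-combination R r a ρ = begin
    det ((λ j → r j + sum λ k → a k * R (ρ k) j) ∷ R)
      ≡⟨ det-+ R r (λ j → sum λ k → a k * R (ρ k) j) ⟩
    det (r ∷ R) + det ((λ j → sum λ k → a k * R (ρ k) j) ∷ R)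
      ≡⟨ cong (λ x → det (r ∷ R) + x) (det-combination R a (R ∘ ρ)) ⟩
    det (r ∷ R) + (sum λ k → a k * det (R (ρ k) ∷ R))
      ≡⟨ cong (λ x → det (r ∷ R) + x) (sum-zero λ k →
           trans (cong (λ x → a k * x) (det-repeated-row R (ρ k))) (*-zeroʳ (a k))) ⟩
    det (r ∷ R) + 0ℤ
      ≡⟨ +-identityʳ _ ⟩
    det (r ∷ R) ∎

  det-cofactors : (M : Matrix ℤ (suc n) (suc n)) (R : Matrix ℤ n (suc n)) →
    (∀ j → cofactor (tail M) j ≡ cofactor R j) → det M ≡ det (M zero ∷ R)
  det-cofactors M R eq = sum-cong-≗ λ j → cong (λ x → sgn j * M zero j * x) (eq j)

  tail-++ : {A : Set} (t : Vector A (suc m)) (b : Vector A n) (i : Fin (m ℕ.+ n)) →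
    (t ++ b) (suc i) ≡ (tail t ++ b) i
  tail-++ {m} t b i with splitAt m i
  ... | inj₁ _ = refl
  ... | inj₂ _ = refl

  map-++ : {A B : Set} (f : A → B) (t : Vector A m) (b : Vector A n) (i : Fin (m ℕ.+ n)) →
    f ((t ++ b) i) ≡ ((f ∘ t) ++ (f ∘ b)) i
  map-++ {m} f t b i with splitAt m i
  ... | inj₁ _ = refl
  ... | inj₂ _ = refl

  -- As `P` is upper unitriangular, row `i` of `t′` is `t i` plus a combination of rows below it.
  -- The later rows are restored first, inside each cofactor and by induction, because deleting a
  -- column commutes with row operations; then the first row is cleared against rows that are
  -- already restored.
  det-row-operations : (P : Matrix ℤ m m) (Q : Matrix ℤ m n)
    (t t′ : Matrix ℤ m (m ℕ.+ n)) (b : Matrix ℤ n (m ℕ.+ n)) →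
    (∀ i → P i i ≡ 1ℤ) → (∀ {i j} → toℕ j ℕ.< toℕ i → P i j ≡ 0ℤ) →
    (∀ i c → t′ i c ≡ sum (λ k → P i k * t k c) + sum (λ l → Q i l * b l c)) →
    det (t′ ++ b) ≡ det (t ++ b)
  det-row-operations {zero}  P Q t t′ b diag lower eq = refl
  det-row-operations {suc m} {n} P Q t t′ b diag lower eq = begin
    det (t′ ++ b)
      ≡⟨ det-cofactors (t′ ++ b) R cofactors ⟩
    det (t′ zero ∷ R)
      ≡⟨ det-cong (t′ zero ∷ R)
           ((λ c → t zero c + upper c + sum (λ l → Q zero l * R (m ↑ʳ l) c)) ∷ R)
           (λ { zero c → row c ; (suc i) c → refl }) ⟩
    det ((λ c → (t zero c + upper c) + sum (λ l → Q zero l * R (m ↑ʳ l) c)) ∷ R)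
      ≡⟨ det-add-combination R (λ c → t zero c + upper c) (Q zero) (m ↑ʳ_) ⟩
    det ((λ c → t zero c + upper c) ∷ R)
      ≡⟨ det-add-combination R (t zero) (tail (P zero)) (_↑ˡ n) ⟩
    det (t zero ∷ R)
      ≡⟨ det-cong (t zero ∷ R) (t ++ b) (λ { zero c → refl ; (suc i) c → cong (λ r → r c) (sym (tail-++ t b i)) }) ⟩
    det (t ++ b) ∎
    where
    R : Matrix ℤ (m ℕ.+ n) (suc (m ℕ.+ n))
    R = tail t ++ b
    upper : Vector ℤ (suc (m ℕ.+ n))
    upper c = sum λ k → P zero (suc k) * R (k ↑ˡ n) c
    R-upper : ∀ k → R (k ↑ˡ n) ≡ t (suc k)
    R-upper k = cong [ tail t , b ] (splitAt-↑ˡ m k n)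
    R-lower : ∀ l → R (m ↑ʳ l) ≡ b l
    R-lower l = cong [ tail t , b ] (splitAt-↑ʳ m n l)
    row : ∀ c → t′ zero c ≡ t zero c + upper c + sum (λ l → Q zero l * R (m ↑ʳ l) c)
    row c = trans (eq zero c) (cong₂ _+_
      (cong₂ _+_ (trans (cong (_* t zero c) (diag zero)) (*-identityˡ _))
        (sum-cong-≗ λ k → cong (λ r → P zero (suc k) * r c) (sym (R-upper k))))
      (sum-cong-≗ λ l → cong (λ r → Q zero l * r c) (sym (R-lower l))))
    cofactors : ∀ j → cofactor (tail (t′ ++ b)) j ≡ cofactor R j
    cofactors j = begin
      cofactor (tail (t′ ++ b)) j
        ≡⟨ det-cong _ ((del j ∘ tail t′) ++ (del j ∘ b)) (λ i c → cong (λ r → r c)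
             (trans (cong (del j) (tail-++ t′ b i)) (map-++ (del j) (tail t′) b i))) ⟩
      det ((del j ∘ tail t′) ++ (del j ∘ b))
        ≡⟨ det-row-operations (λ i k → P (suc i) (suc k)) (λ i → Q (suc i))
             (del j ∘ tail t) (del j ∘ tail t′) (del j ∘ b)
             (diag ∘ suc) (lower ∘ s≤s) (λ i c → trans (eq (suc i) (punchIn j c))
               -- The row absent from the minor has coefficient `P (suc i) zero = 0`.
               (drop-first (P (suc i)) (λ k → t k (punchIn j c)) _ (lower (s≤s z≤n)))) ⟩
      det ((del j ∘ tail t) ++ (del j ∘ b))
        ≡⟨ det-cong _ ((del j ∘ tail t) ++ (del j ∘ b)) (λ i c → cong (λ r → r c) (map-++ (del j) (tail t) b i)) ⟨
      cofactor R j ∎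
      where
      drop-first : (p x : Vector ℤ (suc m)) (q : ℤ) → p zero ≡ 0ℤ →
        sum (λ k → p k * x k) + q ≡ sum (λ k → p (suc k) * x (suc k)) + q
      drop-first p x q eq = cong (_+ q) (trans
        (cong (λ y → y * x zero + sum (λ k → p (suc k) * x (suc k))) eq)
        (lemma (x zero) (sum λ k → p (suc k) * x (suc k))))
        where
        lemma : ∀ y z → 0ℤ * y + z ≡ z
        lemma = solve-∀
      del : Fin (suc (m ℕ.+ n)) → Vector ℤ (suc (m ℕ.+ n)) → Vector ℤ (m ℕ.+ n)
      del j r = r ∘ punchIn j

  det-monomial-row : (M : Matrix ℤ (suc n) (suc n)) (j : Fin (suc n)) →
    (∀ k → k ≢ j → M zero k ≡ 0ℤ) → det M ≡ sgn j * M zero j * cofactor (tail M) j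
  det-monomial-row M j off = trans (sum-remove {i = j} λ k → sgn k * M zero k * cofactor (tail M) k)
    (trans (cong (λ x → sgn j * M zero j * cofactor (tail M) j + x) (sum-zero λ k →
      trans (cong (λ x → sgn (punchIn j k) * x * cofactor (tail M) (punchIn j k))
              (off (punchIn j k) (punchInᵢ≢i j k)))
            (lemma (sgn (punchIn j k)) (cofactor (tail M) (punchIn j k)))))
      (+-identityʳ _))
    where
    lemma : ∀ x y → x * 0ℤ * y ≡ 0ℤ
    lemma = solve-∀

  toℕ-punchIn-< : (i : Fin (suc n)) (j : Fin n) → toℕ j ℕ.< toℕ i → toℕ (punchIn i j) ≡ toℕ j
  toℕ-punchIn-< (suc i) zero    _         = refl
  toℕ-punchIn-< (suc i) (suc j) (s≤s j<i) = cong suc (toℕ-punchIn-< i j j<i)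

  toℕ-punchIn-≥ : (i : Fin (suc n)) (j : Fin n) → toℕ i ℕ.≤ toℕ j → toℕ (punchIn i j) ≡ suc (toℕ j)
  toℕ-punchIn-≥ zero    j       _         = refl
  toℕ-punchIn-≥ (suc i) (suc j) (s≤s i≤j) = cong suc (toℕ-punchIn-≥ i j i≤j)

  sgn-±1 : ∀ k → (-1ℤ ^ k ≡ 1ℤ) ⊎ (-1ℤ ^ k ≡ -1ℤ)
  sgn-±1 zero = inj₁ refl
  sgn-±1 (suc k) with sgn-±1 k
  ... | inj₁ eq = inj₂ (cong (λ x → -1ℤ * x) eq)
  ... | inj₂ eq = inj₁ (cong (λ x → -1ℤ * x) eq)

  product : Vector ℤ n → ℤ
  product = foldr _*_ 1ℤ

  det-neg-identity : (b : Matrix ℤ n n) →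
    (∀ i j → toℕ j ≡ toℕ i → b i j ≡ -1ℤ) → (∀ i j → toℕ j ≢ toℕ i → b i j ≡ 0ℤ) →
    det b ≡ -1ℤ ^ n
  det-neg-identity {zero}  b diag off = refl
  det-neg-identity {suc n} b diag off = begin
    det b
      ≡⟨ det-monomial-row b zero (λ k k≢0 → off zero k (k≢0 ∘ toℕ-injective)) ⟩
    1ℤ * b zero zero * cofactor (tail b) zero
      ≡⟨ cong₂ (λ x y → 1ℤ * x * y) (diag zero zero refl)
           (det-neg-identity (λ i j → b (suc i) (suc j))
             (λ i j eq → diag (suc i) (suc j) (cong suc eq))
             (λ i j ne → off (suc i) (suc j) (ne ∘ ℕ.suc-injective))) ⟩
    -1ℤ * -1ℤ ^ n ∎

  -- The shape [ 0  L ; -I  * ] with L lower triangular with diagonal d.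
  det-block-triangular : (d : Vector ℤ m) (t : Matrix ℤ m (m ℕ.+ n)) (b : Matrix ℤ n (m ℕ.+ n)) →
    (∀ i c → toℕ c ≡ n ℕ.+ toℕ i → t i c ≡ d i) →
    (∀ i c → toℕ c ℕ.< n → t i c ≡ 0ℤ) →
    (∀ i c → n ℕ.+ toℕ i ℕ.< toℕ c → t i c ≡ 0ℤ) →
    (∀ l c → toℕ c ≡ toℕ l → b l c ≡ -1ℤ) →
    (∀ l c → toℕ c ℕ.< n → toℕ c ≢ toℕ l → b l c ≡ 0ℤ) →
    det (t ++ b) ≡ product (λ i → -1ℤ ^ n * d i) * -1ℤ ^ n
  det-block-triangular {zero}  d t b diag left above b-diag b-off =
    trans (det-neg-identity b b-diag (λ l c → b-off l c (toℕ<n c))) (sym (*-identityˡ _))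
  det-block-triangular {suc m} {n} d t b diag left above b-diag b-off = begin
    det (t ++ b)
      -- The first row meets only column `n`. Deleting that column moves the later ones one place to
      -- the left, so the shape recurs with `m` smaller and the same `n`; this is why the two block
      -- sizes are independent.
      ≡⟨ det-monomial-row (t ++ b) c₀ (λ c c≢c₀ → off c (ℕ.<-cmp (toℕ c) n) c≢c₀) ⟩
    sgn c₀ * t zero c₀ * cofactor (tail (t ++ b)) c₀
      ≡⟨ cong₂ _*_ (cong₂ _*_ (cong (-1ℤ ^_) toℕ-c₀)
           (diag zero c₀ (trans toℕ-c₀ (sym (ℕ.+-identityʳ n)))))
           (trans
             (det-cong _ ((del ∘ tail t) ++ (del ∘ b)) λ i c → cong (λ r → r c)
               (trans (cong del (tail-++ t b i)) (map-++ del (tail t) b i)))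
             (det-block-triangular (tail d) (del ∘ tail t) (del ∘ b)
               (λ i c eq → diag (suc i) (punchIn c₀ c)
                 (trans (right c (subst (n ℕ.≤_) (sym eq) (ℕ.m≤m+n n (toℕ i))))
                   (trans (cong suc eq) (sym (ℕ.+-suc n (toℕ i))))))
               (λ i c c<n → left (suc i) (punchIn c₀ c) (subst (ℕ._< n) (sym (stay c c<n)) c<n))
               (λ i c lt → above (suc i) (punchIn c₀ c)
                 (subst₂ ℕ._<_ (sym (ℕ.+-suc n (toℕ i)))
                   (sym (right c (ℕ.≤-trans (ℕ.m≤m+n n (toℕ i)) (ℕ.<⇒≤ lt)))) (s≤s lt)))
               (λ l c eq → b-diag l (punchIn c₀ c)
                 (trans (stay c (subst (ℕ._< n) (sym eq) (toℕ<n l))) eq))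
               (λ l c c<n ne → b-off l (punchIn c₀ c)
                 (subst (ℕ._< n) (sym (stay c c<n)) c<n)
                 (ne ∘ trans (sym (stay c c<n)))))) ⟩
    -1ℤ ^ n * d zero * (product (λ i → -1ℤ ^ n * d (suc i)) * -1ℤ ^ n)
      ≡⟨ lemma (-1ℤ ^ n * d zero) _ _ ⟩
    product (λ i → -1ℤ ^ n * d i) * -1ℤ ^ n ∎
    where
    lemma : ∀ x y z → x * (y * z) ≡ x * y * z
    lemma = solve-∀
    n<size : n ℕ.< suc (m ℕ.+ n)
    n<size = s≤s (ℕ.m≤n+m n m)
    c₀ : Fin (suc (m ℕ.+ n))
    c₀ = fromℕ< n<size
    toℕ-c₀ : toℕ c₀ ≡ n
    toℕ-c₀ = toℕ-fromℕ< n<size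
    del : Vector ℤ (suc (m ℕ.+ n)) → Vector ℤ (m ℕ.+ n)
    del r = r ∘ punchIn c₀
    stay : ∀ c → toℕ c ℕ.< n → toℕ (punchIn c₀ c) ≡ toℕ c
    stay c c<n = toℕ-punchIn-< c₀ c (subst (toℕ c ℕ.<_) (sym toℕ-c₀) c<n)
    right : ∀ c → n ℕ.≤ toℕ c → toℕ (punchIn c₀ c) ≡ suc (toℕ c)
    right c n≤c = toℕ-punchIn-≥ c₀ c (subst (ℕ._≤ toℕ c) (sym toℕ-c₀) n≤c)
    off : ∀ c → Tri (toℕ c ℕ.< n) (toℕ c ≡ n) (n ℕ.< toℕ c) → c ≢ c₀ → t zero c ≡ 0ℤ
    off c (tri< c<n _ _) _    = left zero c c<n
    off c (tri≈ _ c≡n _) c≢c₀ = ⊥-elim (c≢c₀ (toℕ-injective (trans c≡n (sym toℕ-c₀))))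
    off c (tri> _ _ n<c) _    =
      above zero c (subst (ℕ._< toℕ c) (sym (ℕ.+-identityʳ n)) n<c)

  product-scale : (s : ℤ) (d : Vector ℤ n) → product (λ i → s * d i) ≡ s ^ n * product d
  product-scale {zero}  s d = refl
  product-scale {suc n} s d = trans (cong (λ x → s * d zero * x) (product-scale s (tail d)))
    (lemma s (d zero) (s ^ n) _)
    where
    lemma : ∀ w x y z → w * x * (y * z) ≡ w * y * (x * z)
    lemma = solve-∀

  -- The exponent `n n + n` is even. Instead of parity, the two values of `-1ℤ ^ n` are used: if it
  -- is `-1ℤ`, then so is its own `n`-th power.
  sgn-cancel : ∀ n → (-1ℤ ^ n) ^ n * -1ℤ ^ n ≡ 1ℤ
  sgn-cancel n with sgn-±1 n
  ... | inj₁ eq = trans (cong (λ x → x ^ n * x) eq) (trans (*-identityʳ _) (1^n≡1 n))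
    where
    1^n≡1 : ∀ n → 1ℤ ^ n ≡ 1ℤ
    1^n≡1 zero    = refl
    1^n≡1 (suc n) = trans (*-identityˡ (1ℤ ^ n)) (1^n≡1 n)
  ... | inj₂ eq = trans (cong₂ (λ x y → x ^ n * y) eq eq) (cong (_* -1ℤ) eq)

  det-block-triangular-square : (d : Vector ℤ n) (t b : Matrix ℤ n (n ℕ.+ n)) →
    (∀ i c → toℕ c ≡ n ℕ.+ toℕ i → t i c ≡ d i) →
    (∀ i c → toℕ c ℕ.< n → t i c ≡ 0ℤ) →
    (∀ i c → n ℕ.+ toℕ i ℕ.< toℕ c → t i c ≡ 0ℤ) →
    (∀ l c → toℕ c ≡ toℕ l → b l c ≡ -1ℤ) →
    (∀ l c → toℕ c ℕ.< n → toℕ c ≢ toℕ l → b l c ≡ 0ℤ) →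
    det (t ++ b) ≡ product d
  det-block-triangular-square {n} d t b p q r u v = begin
    det (t ++ b)                              ≡⟨ det-block-triangular d t b p q r u v ⟩
    product (λ i → -1ℤ ^ n * d i) * -1ℤ ^ n   ≡⟨ cong (_* -1ℤ ^ n) (product-scale (-1ℤ ^ n) d) ⟩
    (-1ℤ ^ n) ^ n * product d * -1ℤ ^ n       ≡⟨ lemma ((-1ℤ ^ n) ^ n) (product d) (-1ℤ ^ n) ⟩
    (-1ℤ ^ n) ^ n * -1ℤ ^ n * product d       ≡⟨ cong (_* product d) (sgn-cancel n) ⟩
    1ℤ * product d                            ≡⟨ *-identityˡ _ ⟩
    product d                                 ∎
    where
    lemma : ∀ x y z → x * y * z ≡ x * z * y
    lemma = solve-∀

-- Powers of the Schröder series and the factorization of `I + A B`.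

module SchröderNumbers where

  open import Data.Fin.Base using (toℕ)
  open import Data.Integer.Base using (ℤ; +_; _+_; _*_; -_; _-_; _^_; 0ℤ; 1ℤ)
  open import Data.Integer.Properties using (+-*-semiring; pos-+; *-zeroʳ; +-identityʳ)
  open import Data.Integer.Tactic.RingSolver using (solve-∀)
  open import Data.Nat.Base as ℕ using (ℕ; zero; suc; s≤s)
  open import Relation.Binary.PropositionalEquality
  open ≡-Reasoning

  open import Algebra.Properties.Semiring.Sum +-*-semiring
    using (sum; sum-cong-≗; sum-replicate-zero; *-distribˡ-sum)

  -- S e m is the coefficient of x^m in s^e, where s = 1 + x s + x s².
  S : ℕ → ℕ → ℕ
  S zero    zero    = 1
  S zero    (suc m) = 0
  S (suc e) zero    = S e zero
  S (suc e) (suc m) = S e (suc m) ℕ.+ S (suc e) m ℕ.+ S (suc (suc e)) m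

  -- G e m is the coefficient of x^m in g^e, where g = 1 - x g + 2 x g², so that s = 2 g - 1.
  G : ℕ → ℕ → ℤ
  G zero    zero    = 1ℤ
  G zero    (suc m) = 0ℤ
  G (suc e) zero    = G e zero
  G (suc e) (suc m) = G e (suc m) - G (suc e) m + + 2 * G (suc (suc e)) m

  G-zero : ∀ e → G e 0 ≡ 1ℤ
  G-zero zero    = refl
  G-zero (suc e) = G-zero e

  -- H f e m is the coefficient of x^m in s^f g^e.
  H : ℕ → ℕ → ℕ → ℤ
  H zero    e m = G e m
  H (suc f) e m = + 2 * H f (suc e) m - H f e m

  H-zero : ∀ f e → H f e 0 ≡ 1ℤ
  H-zero zero    e = G-zero e
  H-zero (suc f) e = cong₂ (λ x y → + 2 * x - y) (H-zero f (suc e)) (H-zero f e)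

  -- The equation of `g` multiplied by `s^f g^e`; it passes from `f` to `suc f` because `H (suc f)`
  -- is a linear combination of values of `H f`.
  H-suc-g : ∀ f e m → H f (suc e) (suc m) ≡ H f e (suc m) - H f (suc e) m + + 2 * H f (suc (suc e)) m
  H-suc-g zero    e m = refl
  H-suc-g (suc f) e m = trans
    (cong₂ (λ x y → + 2 * x - y) (H-suc-g f (suc e) m) (H-suc-g f e m))
    (lemma (H f e (suc m)) (H f (suc e) (suc m)) (H f (suc e) m)
           (H f (suc (suc e)) m) (H f (suc (suc (suc e))) m))
    where
    lemma : ∀ h₀ h₁ a b c → + 2 * (h₁ - b + + 2 * c) - (h₀ - a + + 2 * b) ≡
                            + 2 * h₁ - h₀ - (+ 2 * b - a) + + 2 * (+ 2 * c - b)
    lemma = solve-∀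

  -- Under `s = 2 g - 1` the equation of `g` becomes `s = 1 + x s + x s²`, here multiplied by
  -- `s^f g^e`. Hence `H` obeys the recursion that defines `S`.
  H-suc-s : ∀ f e m → H (suc f) e (suc m) ≡ H f e (suc m) + H (suc f) e m + H (suc (suc f)) e m
  H-suc-s f e m = trans (cong (λ x → + 2 * x - H f e (suc m)) (H-suc-g f e m))
    (lemma (H f e (suc m)) (H f e m) (H f (suc e) m) (H f (suc (suc e)) m))
    where
    lemma : ∀ h a b c → + 2 * (h - b + + 2 * c) - h ≡
      h + (+ 2 * b - a) + (+ 2 * (+ 2 * c - b) - (+ 2 * b - a))
    lemma = solve-∀

  S≡H : ∀ e m → + S e m ≡ H e 0 m
  S≡H zero    zero    = refl
  S≡H zero    (suc m) = refl
  S≡H (suc e) zero    = trans (S≡H e zero) (trans (H-zero e 0) (sym (H-zero (suc e) 0)))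
  S≡H (suc e) (suc m) = trans (pos-+ (S e (suc m) ℕ.+ S (suc e) m) _)
    (trans (cong (_+ + S (suc (suc e)) m) (pos-+ (S e (suc m)) _))
    (trans (cong₂ _+_ (cong₂ _+_ (S≡H e (suc m)) (S≡H (suc e) m)) (S≡H (suc (suc e)) m))
           (sym (H-suc-s e 0 m))))

  -- The Riordan arrays of (s , x) and of (g^(e+1) , x g).
  T : ℕ → ℕ → ℕ
  T zero    a       = S 1 a
  T (suc k) zero    = 0
  T (suc k) (suc a) = T k a

  σ : ℕ → ℕ → ℤ
  σ a k = + T k a

  ρ : ℕ → ℕ → ℕ → ℤ
  ρ e a       zero    = G (suc e) a
  ρ e zero    (suc k) = 0ℤ
  ρ e (suc a) (suc k) = ρ (suc e) a k

  ρ-diagonal : ∀ e a → ρ e a a ≡ 1ℤ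
  ρ-diagonal e zero    = G-zero e
  ρ-diagonal e (suc a) = ρ-diagonal (suc e) a

  ρ-above : ∀ e {a k} → a ℕ.< k → ρ e a k ≡ 0ℤ
  ρ-above e {zero}  {suc k} _         = refl
  ρ-above e {suc a} {suc k} (s≤s a<k) = ρ-above (suc e) a<k

  δ : ℕ → ℕ → ℤ
  δ zero    zero    = 1ℤ
  δ zero    (suc b) = 0ℤ
  δ (suc a) zero    = 0ℤ
  δ (suc a) (suc b) = δ a b

  -- The coefficients of (g g')^e (1 + s s') and of (g g')^e (1 + s s') / (1 - x x'),
  -- where f' is f with x' in place of x.
  C : ℕ → ℕ → ℕ → ℤ
  C e a b = + 2 * ((G e a - G (suc e) a) * (G e b - G (suc e) b)) + + 2 * (G (suc e) a * G (suc e) b)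

  R : ℕ → ℕ → ℕ → ℤ
  R e (suc a) (suc b) = C e (suc a) (suc b) + R e a b
  R e a       b       = C e a b

  C-zeroˡ : ∀ e b → C e 0 b ≡ + 2 * (G (suc e) 0 * G (suc e) b)
  C-zeroˡ e b = lemma (G e 0) (G e b) (G (suc e) b)
    where
    lemma : ∀ x y z → + 2 * ((x - x) * (y - z)) + + 2 * (x * z) ≡ + 2 * (x * z)
    lemma = solve-∀

  C-zeroʳ : ∀ e a → C e a 0 ≡ + 2 * (G (suc e) a * G (suc e) 0)
  C-zeroʳ e a = lemma (G e 0) (G e a) (G (suc e) a)
    where
    lemma : ∀ x y z → + 2 * ((y - z) * (x - x)) + + 2 * (z * x) ≡ + 2 * (z * x)
    lemma = solve-∀

  -- The equation of `g` reads `g - 1 = x g s`, so `(1 - g) (1 - g′) = x x′ g g′ s s′`. Inserted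
  -- into `1 + s s′ = 2 (1 - g) (1 - g′) + 2 g g′`, the form in which `C` is written, this yields
  -- `(1 + s s′) (1 - 2 x x′ g g′) = 2 g g′ (1 - x x′)`. The lemma is that equation times `(g
  -- g′)^e`, with the negative terms moved across, at a coefficient of positive degree in both
  -- variables.
  C-suc : ∀ e a b → C e (suc a) (suc b) + + 2 * (G (suc e) a * G (suc e) b) ≡
    + 2 * C (suc e) a b + + 2 * (G (suc e) (suc a) * G (suc e) (suc b))
  C-suc e a b = lemma (G e (suc a)) (G e (suc b)) (G (suc e) a) (G (suc e) b)
                      (G (suc (suc e)) a) (G (suc (suc e)) b)
    where
    lemma : ∀ p q u u′ v v′ →
      + 2 * ((p - (p - u + + 2 * v)) * (q - (q - u′ + + 2 * v′)))
        + + 2 * ((p - u + + 2 * v) * (q - u′ + + 2 * v′)) + + 2 * (u * u′) ≡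
      + 2 * (+ 2 * ((u - v) * (u′ - v′)) + + 2 * (v * v′))
        + + 2 * ((p - u + + 2 * v) * (q - u′ + + 2 * v′))
    lemma = solve-∀

  R-suc-base : ∀ e a b → C e a b ≡ + 2 * (G (suc e) a * G (suc e) b) →
    C e (suc a) (suc b) + C e a b ≡ + 2 * C (suc e) a b + + 2 * (G (suc e) (suc a) * G (suc e) (suc b))
  R-suc-base e a b eq = trans (cong (λ x → C e (suc a) (suc b) + x) eq) (C-suc e a b)

  -- The equation of `C-suc` divided by `1 - x x′`, namely `R e = 2 x x′ R (suc e) + 2 (g g′)^(suc
  -- e)`; the left-hand side is `R e (suc a) (suc b)` unfolded.
  R-suc : ∀ e a b → C e (suc a) (suc b) + R e a b ≡
    + 2 * R (suc e) a b + + 2 * (G (suc e) (suc a) * G (suc e) (suc b))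
  R-suc e zero    b       = R-suc-base e zero b (C-zeroˡ e b)
  R-suc e (suc a) zero    = R-suc-base e (suc a) zero (C-zeroʳ e (suc a))
  R-suc e (suc a) (suc b) = begin
    C₂ + (C e (suc a) (suc b) + R e a b)
      ≡⟨ cong (λ x → C₂ + x) (R-suc e a b) ⟩
    C₂ + (+ 2 * R (suc e) a b + g₁)
      ≡⟨ lemma C₂ (R (suc e) a b) g₁ ⟩
    (C₂ + g₁) + + 2 * R (suc e) a b
      ≡⟨ cong (_+ + 2 * R (suc e) a b) (C-suc e (suc a) (suc b)) ⟩
    (+ 2 * C₁ + g₂) + + 2 * R (suc e) a b
      ≡⟨ lemma′ C₁ g₂ (R (suc e) a b) ⟩
    + 2 * (C₁ + R (suc e) a b) + g₂ ∎
    where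
    C₁ = C (suc e) (suc a) (suc b)
    C₂ = C e (suc (suc a)) (suc (suc b))
    g₁ = + 2 * (G (suc e) (suc a) * G (suc e) (suc b))
    g₂ = + 2 * (G (suc e) (suc (suc a)) * G (suc e) (suc (suc b)))
    lemma : ∀ x y z → x + (+ 2 * y + z) ≡ (x + z) + + 2 * y
    lemma = solve-∀
    lemma′ : ∀ x y z → (+ 2 * x + y) + + 2 * z ≡ + 2 * (x + z) + y
    lemma′ = solve-∀

  sum-zero : ∀ N (f : ℕ → ℤ) → (∀ k → f k ≡ 0ℤ) → sum {N} (λ k → f (toℕ k)) ≡ 0ℤ
  sum-zero N f eq = trans (sum-cong-≗ {N} λ k → eq (toℕ k)) (sum-replicate-zero N)

  -- Splitting off `k = 0` leaves twice the same sum for `suc e`, since both arrays move one step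
  -- down their diagonals; this is the recursion of `R-suc`. Terms with `k > a` vanish, so any
  -- length above `a` gives the same value.
  ρDρ : ∀ e a b {N} → a ℕ.< N →
    sum {N} (λ k → (+ 2) ^ suc (toℕ k) * (ρ e a (toℕ k) * ρ e b (toℕ k))) ≡ R e a b
  ρDρ e zero b {suc N} _ = begin
    + 2 * (G (suc e) 0 * G (suc e) b) + _
      ≡⟨ cong (λ x → + 2 * (G (suc e) 0 * G (suc e) b) + x)
           (sum-zero N _ λ k → lemma ((+ 2) ^ suc (suc k)) (ρ e b (suc k))) ⟩
    + 2 * (G (suc e) 0 * G (suc e) b) + 0ℤ
      ≡⟨ +-identityʳ _ ⟩
    + 2 * (G (suc e) 0 * G (suc e) b)
      ≡⟨ C-zeroˡ e b ⟨
    C e 0 b ∎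
    where
    lemma : ∀ x y → x * (0ℤ * y) ≡ 0ℤ
    lemma = solve-∀
  ρDρ e (suc a) zero {suc N} _ = begin
    + 2 * (G (suc e) (suc a) * G (suc e) 0) + _
      ≡⟨ cong (λ x → + 2 * (G (suc e) (suc a) * G (suc e) 0) + x)
           (sum-zero N _ λ k → lemma ((+ 2) ^ suc (suc k)) (ρ e (suc a) (suc k))) ⟩
    + 2 * (G (suc e) (suc a) * G (suc e) 0) + 0ℤ
      ≡⟨ +-identityʳ _ ⟩
    + 2 * (G (suc e) (suc a) * G (suc e) 0)
      ≡⟨ C-zeroʳ e (suc a) ⟨
    C e (suc a) 0 ∎
    where
    lemma : ∀ x y → x * (y * 0ℤ) ≡ 0ℤ
    lemma = solve-∀
  ρDρ e (suc a) (suc b) {suc N} (s≤s a<N) = begin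
    g + sum {N} (λ k → + 2 * (+ 2) ^ suc (toℕ k) * ρρ (toℕ k))
      ≡⟨ cong (λ x → g + x) (sum-cong-≗ {N} λ k → lemma ((+ 2) ^ suc (toℕ k)) (ρρ (toℕ k))) ⟩
    g + sum {N} (λ k → + 2 * ((+ 2) ^ suc (toℕ k) * ρρ (toℕ k)))
      ≡⟨ cong (λ x → g + x) (*-distribˡ-sum {N} (+ 2) λ k → (+ 2) ^ suc (toℕ k) * ρρ (toℕ k)) ⟨
    g + + 2 * sum {N} (λ k → (+ 2) ^ suc (toℕ k) * ρρ (toℕ k))
      ≡⟨ cong (λ x → g + + 2 * x) (ρDρ (suc e) a b a<N) ⟩
    g + + 2 * R (suc e) a b
      ≡⟨ lemma′ g (R (suc e) a b) ⟩
    + 2 * R (suc e) a b + g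
      ≡⟨ R-suc e a b ⟨
    C e (suc a) (suc b) + R e a b ∎
    where
    g = + 2 * (G (suc e) (suc a) * G (suc e) (suc b))
    ρρ : ℕ → ℤ
    ρρ k = ρ (suc e) a k * ρ (suc e) b k
    lemma : ∀ x y → + 2 * x * y ≡ + 2 * (x * y)
    lemma = solve-∀
    lemma′ : ∀ x y → x + + 2 * y ≡ + 2 * y + x
    lemma′ = solve-∀

  C-S : ∀ a b → C 0 a b ≡ G 0 a * G 0 b + + S 1 a * + S 1 b
  C-S a b = trans (lemma (G 0 a) (G 0 b) (G 1 a) (G 1 b))
    (sym (cong₂ (λ x y → G 0 a * G 0 b + x * y) (S≡H 1 a) (S≡H 1 b)))
    where
    lemma : ∀ p q x y → + 2 * ((p - x) * (q - y)) + + 2 * (x * y) ≡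
                        p * q + (+ 2 * x - p) * (+ 2 * y - q)
    lemma = solve-∀

  -- Division by `1 - x x′` sums along diagonals, and so does the product of a triangular Toeplitz
  -- array with its transpose; `δ` accounts for the summand 1 of `1 + s s′`, whose coefficients are
  -- the products `G 0 a * G 0 b`.
  σσ : ∀ a b {N} → a ℕ.< N → δ a b + sum {N} (λ k → σ a (toℕ k) * σ b (toℕ k)) ≡ R 0 a b
  σσ zero b {suc N} _ = begin
    δ 0 b + (+ S 1 0 * + S 1 b + sum {N} (λ k → 0ℤ * σ b (suc (toℕ k))))
      ≡⟨ cong₂ (λ x y → x + (+ S 1 0 * + S 1 b + y)) (δ≡G b)
           (sum-zero N (λ k → 0ℤ * σ b (suc k)) λ k → refl) ⟩
    G 0 0 * G 0 b + (+ S 1 0 * + S 1 b + 0ℤ)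
      ≡⟨ cong (λ x → G 0 0 * G 0 b + x) (+-identityʳ (+ S 1 0 * + S 1 b)) ⟩
    G 0 0 * G 0 b + + S 1 0 * + S 1 b
      ≡⟨ C-S 0 b ⟨
    C 0 0 b ∎
    where
    δ≡G : ∀ b → δ 0 b ≡ G 0 0 * G 0 b
    δ≡G zero    = refl
    δ≡G (suc b) = refl
  σσ (suc a) zero {suc N} _ = begin
    0ℤ + (+ S 1 (suc a) * + S 1 0 + sum {N} (λ k → σ a (toℕ k) * 0ℤ))
      ≡⟨ cong (λ x → 0ℤ + (+ S 1 (suc a) * + S 1 0 + x))
           (sum-zero N (λ k → σ a k * 0ℤ) λ k → *-zeroʳ (σ a k)) ⟩
    0ℤ + (+ S 1 (suc a) * + S 1 0 + 0ℤ)
      ≡⟨ cong (λ x → 0ℤ + x) (+-identityʳ (+ S 1 (suc a) * + S 1 0)) ⟩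
    0ℤ + + S 1 (suc a) * + S 1 0
      ≡⟨ C-S (suc a) 0 ⟨
    C 0 (suc a) 0 ∎
  σσ (suc a) (suc b) {suc N} (s≤s a<N) = begin
    δ a b + (ss + Σσσ)
      ≡⟨ lemma (δ a b) ss Σσσ ⟩
    (0ℤ + ss) + (δ a b + Σσσ)
      ≡⟨ cong₂ _+_ (sym (C-S (suc a) (suc b))) (σσ a b a<N) ⟩
    C 0 (suc a) (suc b) + R 0 a b ∎
    where
    ss = + S 1 (suc a) * + S 1 (suc b)
    Σσσ = sum {N} (λ k → σ a (toℕ k) * σ b (toℕ k))
    lemma : ∀ x y z → x + (y + z) ≡ (0ℤ + y) + (x + z)
    lemma = solve-∀

  factorization : ∀ a b {N} → a ℕ.< N →
    δ a b + sum {N} (λ k → σ a (toℕ k) * σ b (toℕ k)) ≡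
    sum {N} (λ k → (+ 2) ^ suc (toℕ k) * (ρ 0 a (toℕ k) * ρ 0 b (toℕ k)))
  factorization a b a<N = trans (σσ a b a<N) (sym (ρDρ 0 a b a<N))

-- Evaluation of the hamburger determinant.

module HamburgerDeterminant where

  open import Data.Empty using (⊥-elim)
  open import Data.Fin.Base using (Fin; zero; suc; toℕ; opposite; _↑ˡ_; _↑ʳ_; splitAt; inject₁)
  open import Data.Fin.Permutation using (reverse)
  open import Data.Fin.Properties
    using (_≟_; toℕ<n; toℕ-injective; toℕ-↑ˡ; toℕ-↑ʳ; toℕ-inject₁; toℕ-fromℕ; join-splitAt; opposite-prop; opposite-involutive)
  open import Data.Integer.Base using (ℤ; +_; _+_; _*_; -_; _-_; _^_; 0ℤ; 1ℤ; -1ℤ)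
  open import Data.Integer.Properties
    using (+-*-semiring; pos-*; *-zeroʳ; *-identityʳ; +-identityʳ; +-identityˡ)
  open import Data.Integer.Tactic.RingSolver using (solve-∀)
  open import Data.Nat.Base as ℕ using (ℕ; zero; suc; s≤s)
  import Data.Nat.Properties as ℕ
  open import Data.Product.Base using (∃-syntax; _,_)
  open import Data.Sum.Base using (_⊎_; inj₁; inj₂)
  open import Data.Vec.Functional using (Vector; _++_)
  open import Data.Vec.Functional.Properties using (lookup-++ˡ; lookup-++ʳ)
  open import Defs using (Matrix; det; block; identity)
  open import Function.Base using (_∘_)
  open import Relation.Binary.PropositionalEquality
  open import Relation.Nullary.Decidable using (yes; no)
  open ≡-Reasoning

  open import Algebra.Properties.Semiring.Sum +-*-semiring
    using (sum; sum-cong-≗; sum-permute; sum-remove; *-distribˡ-sum)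
  open Determinant
  open SchröderNumbers using (T; σ; δ; ρ; ρ-diagonal; ρ-above; factorization; S)

  private
    variable
      m n : ℕ

  infix 9 _*′

  -- In `A B` the inner index runs from the larger of `i` and `j` up to `n - 1`, a range cut off by
  -- the size of the matrix. Counted from the far end it starts at 0, so the entry becomes a
  -- coefficient of a series that does not involve `n`.
  _*′ : Fin n → ℕ
  i *′ = toℕ (opposite i)

  *′-complement : (i : Fin n) → toℕ i ℕ.+ i *′ ≡ ℕ.pred n
  *′-complement {suc n} i = trans (cong (toℕ i ℕ.+_) (opposite-prop i)) (ℕ.m+[n∸m]≡n (ℕ.≤-pred (toℕ<n i)))

  *′<n : (i : Fin n) → i *′ ℕ.< n
  *′<n i = toℕ<n (opposite i)

  *′-antitone : {i j : Fin n} → toℕ i ℕ.< toℕ j → j *′ ℕ.< i *′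
  *′-antitone {i = i} {j} i<j = ℕ.+-cancelˡ-< (toℕ i) _ _ (subst (toℕ i ℕ.+ j *′ ℕ.<_)
    (trans (*′-complement j) (sym (*′-complement i))) (ℕ.+-monoˡ-< (j *′) i<j))

  T-below : ∀ {k j} → j ℕ.< k → T k j ≡ 0
  T-below {suc k} {zero}  _         = refl
  T-below {suc k} {suc j} (s≤s j<k) = T-below j<k

  T-shift : ∀ k j → T k (j ℕ.+ k) ≡ S 1 j
  T-shift zero    j = cong (S 1) (ℕ.+-identityʳ j)
  T-shift (suc k) j = trans (cong (T (suc k)) (ℕ.+-suc j k)) (T-shift k j)

  -- The array is Toeplitz: only the difference of the indices matters, and `j - i = i′ - j′`.
  T-reverse : ∀ i j {i′ j′} → i ℕ.+ i′ ≡ j ℕ.+ j′ → T i j ≡ T j′ i′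
  T-reverse zero    j       {j′ = j′} refl = sym (T-shift j′ j)
  T-reverse (suc i) zero    {i′}      refl = sym (T-below (s≤s (ℕ.m≤n+m i′ i)))
  T-reverse (suc i) (suc j) eq             = T-reverse i j (ℕ.suc-injective eq)

  sum-opposite : (f : ℕ → ℤ) → sum {n} (λ i → f (i *′)) ≡ sum {n} (λ i → f (toℕ i))
  sum-opposite {n} f = sym (sum-permute {n} {n} (λ i → f (toℕ i)) reverse)

  identity-diagonal : (i : Fin n) → identity n i i ≡ 1ℤ
  identity-diagonal i with i ≟ i
  ... | yes _  = refl
  ... | no i≢i = ⊥-elim (i≢i refl)

  identity-off : {i j : Fin n} → i ≢ j → identity n i j ≡ 0ℤ
  identity-off {i = i} {j} i≢j with i ≟ j
  ... | yes i≡j = ⊥-elim (i≢j i≡j)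
  ... | no _    = refl

  δ-diagonal : ∀ a → δ a a ≡ 1ℤ
  δ-diagonal zero    = refl
  δ-diagonal (suc a) = δ-diagonal a

  δ-off : ∀ {a b} → a ≢ b → δ a b ≡ 0ℤ
  δ-off {zero}  {zero}  a≢b = ⊥-elim (a≢b refl)
  δ-off {zero}  {suc b} _   = refl
  δ-off {suc a} {zero}  _   = refl
  δ-off {suc a} {suc b} a≢b = δ-off (a≢b ∘ cong suc)

  identity-δ : (i j : Fin n) → identity n i j ≡ δ (i *′) (j *′)
  identity-δ i j with i ≟ j
  ... | yes refl = sym (δ-diagonal (i *′))
  ... | no i≢j   = sym (δ-off λ eq → i≢j (trans (sym (opposite-involutive i))
    (trans (cong opposite (toℕ-injective eq)) (opposite-involutive j))))

  sum-identity : (x : Vector ℤ n) (j : Fin n) → sum (λ l → x l * identity n l j) ≡ x j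
  sum-identity {suc n} x j = begin
    sum (λ l → x l * identity (suc n) l j)
      ≡⟨ sum-remove {i = j} (λ l → x l * identity (suc n) l j) ⟩
    x j * identity (suc n) j j + _
      ≡⟨ cong₂ (λ y z → x j * y + z) (identity-diagonal j) (sum-zero λ l →
           trans (cong (λ y → x (punchIn j l) * y) (identity-off (punchInᵢ≢i j l))) (*-zeroʳ (x (punchIn j l)))) ⟩
    x j * 1ℤ + 0ℤ
      ≡⟨ lemma (x j) ⟩
    x j ∎
    where
    open import Data.Fin.Base using (punchIn)
    open import Data.Fin.Properties using (punchInᵢ≢i)
    lemma : ∀ x → x * 1ℤ + 0ℤ ≡ x
    lemma = solve-∀

  ↑-cases : (c : Fin (m ℕ.+ n)) → (∃[ i ] c ≡ i ↑ˡ n) ⊎ (∃[ j ] c ≡ m ↑ʳ j)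
  ↑-cases {m} {n} c with splitAt m c | join-splitAt m n c
  ... | inj₁ i | eq = inj₁ (i , sym eq)
  ... | inj₂ j | eq = inj₂ (j , sym eq)

  -- `B` is the transpose of `A`. Its indices are reversed because the paths of the bottom half run
  -- from east to west.
  A B : ∀ n → Matrix ℕ n n
  A n i j = T (toℕ i) (toℕ j)
  B n i j = T (i *′) (j *′)

  A-reverse : (i j : Fin n) → A n i j ≡ T (j *′) (i *′)
  A-reverse i j = T-reverse (toℕ i) (toℕ j) (trans (*′-complement i) (sym (*′-complement j)))

  -- 2^(n(n+1)/2)
  power : ℕ → ℕ
  power zero    = 1
  power (suc n) = 2 ℕ.^ suc n ℕ.* power n

  pos-^ : ∀ k → (+ 2) ^ k ≡ + (2 ℕ.^ k)
  pos-^ zero    = refl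
  pos-^ (suc k) = trans (cong (+ 2 *_) (pos-^ k)) (sym (pos-* 2 (2 ℕ.^ k)))

  product-cong : {d e : Vector ℤ n} → d ≗ e → product d ≡ product e
  product-cong {zero}  d≗e = refl
  product-cong {suc n} d≗e = cong₂ _*_ (d≗e zero) (product-cong (d≗e ∘ suc))

  product-power : ∀ n → product {n} (λ i → (+ 2) ^ suc (i *′)) ≡ + power n
  product-power zero    = refl
  product-power (suc n) = begin
    (+ 2) ^ suc (toℕ (opposite {suc n} zero)) * product {n} (λ i → (+ 2) ^ suc (toℕ (inject₁ (opposite i))))
      ≡⟨ cong₂ _*_ (trans (pos-^ (suc (toℕ (opposite {suc n} zero)))) (cong (λ k → + (2 ℕ.^ suc k)) (toℕ-fromℕ n)))
           (product-cong {n} λ i → cong (λ k → (+ 2) ^ suc k) (toℕ-inject₁ (opposite i))) ⟩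
    + (2 ℕ.^ suc n) * product {n} (λ i → (+ 2) ^ suc (i *′))
      ≡⟨ cong (+ (2 ℕ.^ suc n) *_) (product-power n) ⟩
    + (2 ℕ.^ suc n) * + power n
      ≡⟨ pos-* (2 ℕ.^ suc n) (power n) ⟨
    + power (suc n) ∎

  module _ (n : ℕ) where

    hamburger : Matrix ℤ (n ℕ.+ n) (n ℕ.+ n)
    hamburger = block (λ k l → + A n k l) (identity n) (λ k l → - identity n k l) (λ k l → + B n k l)

    -- The upper half of the hamburger matrix is P times the rows [ 0  D Pᵀ ] minus
    -- A times the lower half, where I + A B = P D Pᵀ.
    private
      P L : Matrix ℤ n n
      P i j = ρ 0 (i *′) (j *′)
      L i j = (+ 2) ^ suc (i *′) * P j i
      top reduced bottom : Matrix ℤ n (n ℕ.+ n)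
      top i = (λ j → + A n i j) ++ identity n i
      reduced i = (λ _ → 0ℤ) ++ L i
      bottom i = (λ j → - identity n i j) ++ (λ j → + B n i j)

      lookupˡ : (x y : Vector ℤ n) (j : Fin n) → (x ++ y) (j ↑ˡ n) ≡ x j
      lookupˡ x y = lookup-++ˡ x y

      lookupʳ : (x y : Vector ℤ n) (j : Fin n) → (x ++ y) (n ↑ʳ j) ≡ y j
      lookupʳ x y = lookup-++ʳ x y

      I+AB≡PL : ∀ i j → identity n i j + sum (λ l → + A n i l * + B n l j) ≡ sum (λ k → P i k * L k j)
      I+AB≡PL i j = begin
        identity n i j + sum (λ l → + A n i l * + B n l j)
          ≡⟨ cong₂ _+_ (identity-δ i j)
               -- Reversal turns `A n i l` into `T (l *′) (i *′)`, which puts the summation index in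
               -- the same place in both factors.
               (trans (sum-cong-≗ λ l → cong (λ x → + x * + B n l j) (A-reverse i l))
                      (sum-opposite {n} λ k → σ (i *′) k * σ (j *′) k)) ⟩
        δ (i *′) (j *′) + sum {n} (λ k → σ (i *′) (toℕ k) * σ (j *′) (toℕ k))
          ≡⟨ factorization (i *′) (j *′) (*′<n i) ⟩
        sum {n} (λ k → (+ 2) ^ suc (toℕ k) * (ρ 0 (i *′) (toℕ k) * ρ 0 (j *′) (toℕ k)))
          ≡⟨ sum-opposite {n} (λ k → (+ 2) ^ suc k * (ρ 0 (i *′) k * ρ 0 (j *′) k)) ⟨
        sum (λ k → (+ 2) ^ suc (k *′) * (P i k * P j k))
          ≡⟨ sum-cong-≗ (λ k → lemma ((+ 2) ^ suc (k *′)) (P i k) (P j k)) ⟩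
        sum (λ k → P i k * L k j) ∎
        where
        lemma : ∀ x y z → x * (y * z) ≡ y * (x * z)
        lemma = solve-∀

      row : ∀ i c → top i c ≡ sum (λ k → P i k * reduced k c) + sum (λ l → - + A n i l * bottom l c)
      row i c with ↑-cases {n} {n} c
      ... | inj₁ (j , refl) = begin
        top i (j ↑ˡ n)
          ≡⟨ lookupˡ (λ j → + A n i j) (identity n i) j ⟩
        + A n i j
          ≡⟨ sum-identity (λ l → + A n i l) j ⟨
        sum (λ l → + A n i l * identity n l j)
          ≡⟨ +-identityˡ _ ⟨
        0ℤ + sum (λ l → + A n i l * identity n l j)
          ≡⟨ cong₂ _+_
               (sum-zero λ k → trans (cong (λ x → P i k * x) (lookupˡ (λ _ → 0ℤ) (L k) j)) (*-zeroʳ (P i k)))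
               (sum-cong-≗ λ l → trans
                 (cong (λ x → - + A n i l * x) (lookupˡ (λ j → - identity n l j) (λ j → + B n l j) j))
                 (lemma (+ A n i l) (identity n l j))) ⟨
        sum (λ k → P i k * reduced k (j ↑ˡ n)) + sum (λ l → - + A n i l * bottom l (j ↑ˡ n)) ∎
        where
        lemma : ∀ x y → - x * - y ≡ x * y
        lemma = solve-∀
      ... | inj₂ (j , refl) = begin
        top i (n ↑ʳ j)
          ≡⟨ lookupʳ (λ j → + A n i j) (identity n i) j ⟩
        identity n i j
          ≡⟨ lemma (identity n i j) (sum λ l → + A n i l * + B n l j) ⟩
        (identity n i j + sum (λ l → + A n i l * + B n l j)) + - 1ℤ * sum (λ l → + A n i l * + B n l j)
          ≡⟨ cong₂ _+_ (I+AB≡PL i j) (*-distribˡ-sum (- 1ℤ) (λ l → + A n i l * + B n l j)) ⟩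
        sum (λ k → P i k * L k j) + sum (λ l → - 1ℤ * (+ A n i l * + B n l j))
          ≡⟨ cong₂ _+_
               (sum-cong-≗ λ k → cong (λ x → P i k * x) (lookupʳ (λ _ → 0ℤ) (L k) j))
               (sum-cong-≗ λ l → trans
                 (cong (λ x → - + A n i l * x) (lookupʳ (λ j → - identity n l j) (λ j → + B n l j) j))
                 (lemma′ (+ A n i l) (+ B n l j))) ⟨
        sum (λ k → P i k * reduced k (n ↑ʳ j)) + sum (λ l → - + A n i l * bottom l (n ↑ʳ j)) ∎
        where
        lemma : ∀ x y → x ≡ (x + y) + - 1ℤ * y
        lemma = solve-∀
        lemma′ : ∀ x y → - x * y ≡ - 1ℤ * (x * y)
        lemma′ = solve-∀

      <⇒≢↑ʳ : ∀ {j : Fin n} → toℕ (n ↑ʳ j) ℕ.< n → ∀ {A : Set} → A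
      <⇒≢↑ʳ {j} lt = ⊥-elim (ℕ.m+n≮m n (toℕ j) (subst (ℕ._< n) (toℕ-↑ʳ n j) lt))

      ≤⇒≢↑ˡ : ∀ {j : Fin n} {k} → n ℕ.+ k ℕ.≤ toℕ (j ↑ˡ n) → ∀ {A : Set} → A
      ≤⇒≢↑ˡ {j} {k} le = ⊥-elim (ℕ.<⇒≱ (toℕ<n j)
        (ℕ.≤-trans (ℕ.m≤m+n n k) (subst (n ℕ.+ k ℕ.≤_) (toℕ-↑ˡ j n) le)))

      reduced-diagonal : ∀ i c → toℕ c ≡ n ℕ.+ toℕ i → reduced i c ≡ (+ 2) ^ suc (i *′)
      reduced-diagonal i c eq with ↑-cases {n} {n} c
      ... | inj₁ (j , refl) = ≤⇒≢↑ˡ {j} {toℕ i} (ℕ.≤-reflexive (sym eq))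
      ... | inj₂ (j , refl) with refl ← toℕ-injective (ℕ.+-cancelˡ-≡ n _ _ (trans (sym (toℕ-↑ʳ n j)) eq)) =
        trans (lookupʳ (λ _ → 0ℤ) (L i) i)
          (trans (cong ((+ 2) ^ suc (i *′) *_) (ρ-diagonal 0 (i *′))) (*-identityʳ _))

      reduced-left : ∀ i c → toℕ c ℕ.< n → reduced i c ≡ 0ℤ
      reduced-left i c c<n with ↑-cases {n} {n} c
      ... | inj₁ (j , refl) = lookupˡ (λ _ → 0ℤ) (L i) j
      ... | inj₂ (j , refl) = <⇒≢↑ʳ {j} c<n

      reduced-above : ∀ i c → n ℕ.+ toℕ i ℕ.< toℕ c → reduced i c ≡ 0ℤ
      reduced-above i c lt with ↑-cases {n} {n} c
      ... | inj₁ (j , refl) = ≤⇒≢↑ˡ {j} {toℕ i} (ℕ.<⇒≤ lt)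
      ... | inj₂ (j , refl) = trans (lookupʳ (λ _ → 0ℤ) (L i) j)
        (trans (cong ((+ 2) ^ suc (i *′) *_)
          (ρ-above 0 (*′-antitone {i = i} {j} (ℕ.+-cancelˡ-< n _ _ (subst (n ℕ.+ toℕ i ℕ.<_) (toℕ-↑ʳ n j) lt)))))
          (*-zeroʳ ((+ 2) ^ suc (i *′))))

      bottom-diagonal : ∀ i c → toℕ c ≡ toℕ i → bottom i c ≡ -1ℤ
      bottom-diagonal i c eq with ↑-cases {n} {n} c
      ... | inj₁ (j , refl) with refl ← toℕ-injective (trans (sym (toℕ-↑ˡ j n)) eq) =
        trans (lookupˡ (λ j → - identity n i j) (λ j → + B n i j) i) (cong -_ (identity-diagonal i))
      ... | inj₂ (j , refl) = <⇒≢↑ʳ {j} (subst (ℕ._< n) (sym eq) (toℕ<n i))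

      bottom-off : ∀ i c → toℕ c ℕ.< n → toℕ c ≢ toℕ i → bottom i c ≡ 0ℤ
      bottom-off i c c<n c≢i with ↑-cases {n} {n} c
      ... | inj₁ (j , refl) = trans (lookupˡ (λ j → - identity n i j) (λ j → + B n i j) j)
        (cong -_ (identity-off {i = i} {j} λ i≡j → c≢i (trans (toℕ-↑ˡ j n) (cong toℕ (sym i≡j)))))
      ... | inj₂ (j , refl) = <⇒≢↑ʳ {j} c<n

    det-hamburger : det hamburger ≡ + power n
    det-hamburger = begin
      det (top ++ bottom)
        ≡⟨ det-row-operations P (λ i l → - + A n i l) reduced top bottom
             -- `ρ` is lower triangular; reversing the indices makes `P` upper triangular, as the
             -- row operations require.
             (λ i → ρ-diagonal 0 (i *′)) (λ {i} {j} j<i → ρ-above 0 (*′-antitone {i = j} {i} j<i)) row ⟩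
      det (reduced ++ bottom)
        ≡⟨ det-block-triangular-square (λ i → (+ 2) ^ suc (i *′)) reduced bottom
             reduced-diagonal reduced-left reduced-above bottom-diagonal bottom-off ⟩
      product {n} (λ i → (+ 2) ^ suc (i *′))
        ≡⟨ product-power n ⟩
      + power n ∎

-- Paths in coordinates shared by both halves of the digraph, counted by powers of the Schröder
-- series.

module LatticePaths where

  open import Data.Empty using (⊥-elim)
  open import Data.Fin.Base using (Fin; zero; suc)
  open import Data.Fin.Properties using (+↔⊎)
  open import Data.Nat.Base using (ℕ; zero; suc; _+_; _<_; s≤s)
  open import Data.Nat.Properties
  open import Data.Product.Base using (Σ; ∃-syntax; _×_; _,_; proj₂)
  open import Data.Sum.Base using (_⊎_; inj₁; inj₂)
  open import Data.Sum.Function.Propositional using (_⊎-cong_)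
  open import Function.Bundles using (_↔_; mk↔ₛ′)
  open import Function.Properties.Inverse using (↔-sym; ↔-trans)
  open import Relation.Binary.Construct.Closure.ReflexiveTransitive using (Star; ε; _◅_)
  open import Relation.Binary.PropositionalEquality
  open import Relation.Nullary.Negation using (¬_)
  open SchröderNumbers using (S; T)
  open HamburgerDeterminant using (T-below; T-shift)

  -- In the digraph of AD n the k-th vertex of row h has edges to the vertices
  -- (k + 1 , h), (k , h + 1) and (k + 1 , h - 1), and k + h < n.
  record Walk (n : ℕ) : Set₁ where
    infix 4 _⟶_
    field
      Node         : Set
      _⟶_          : Node → Node → Set
      ⟶-irrelevant : ∀ {s t} (p q : s ⟶ t) → p ≡ q
      At           : Node → ℕ → ℕ → Set
      node         : ∀ k h → k + h < n → ∃[ s ] At s k h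
      At-unique    : ∀ {s t k h} → At s k h → At t k h → s ≡ t
      At-position  : ∀ {s k h k′ h′} → At s k h → At s k′ h′ → k ≡ k′ × h ≡ h′
      step         : ∀ {s t k h} → At s k h → s ⟶ t →
                     At t (suc k) h ⊎ At t k (suc h) ⊎ ∃[ h′ ] (h ≡ suc h′ × At t (suc k) h′)
      level        : ∀ {s t k h} → At s k h → At t (suc k) h → s ⟶ t
      up           : ∀ {s t k h} → At s k h → At t k (suc h) → s ⟶ t
      down         : ∀ {s t k h} → At s k (suc h) → At t (suc k) h → s ⟶ t

  Σ-Fin : ∀ {c} {F : Fin (suc c) → Set} → Σ (Fin (suc c)) F ↔ (F zero ⊎ Σ (Fin c) (λ o → F (suc o)))
  Σ-Fin = mk↔ₛ′
    (λ { (zero , x) → inj₁ x ; (suc o , x) → inj₂ (o , x) })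
    (λ { (inj₁ x) → zero , x ; (inj₂ (o , x)) → suc o , x })
    (λ { (inj₁ x) → refl ; (inj₂ (o , x)) → refl })
    (λ { (zero , x) → refl ; (suc o , x) → refl })

  Σ-Fin0 : {F : Fin 0 → Set} → Σ (Fin 0) F ↔ Fin 0
  Σ-Fin0 = mk↔ₛ′ (λ ()) (λ ()) (λ ()) (λ ())

  infixr 5 _⊕_
  _⊕_ : ∀ {c} {F : Fin (suc c) → Set} {a b} →
    F zero ↔ Fin a → Σ (Fin c) (λ o → F (suc o)) ↔ Fin b → Σ (Fin (suc c)) F ↔ Fin (a + b)
  p ⊕ q = ↔-trans Σ-Fin (↔-trans (p ⊎-cong q) (↔-sym +↔⊎))

  module _ {n : ℕ} (W : Walk n) where

    open Walk W

    private
      variable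
        s t u : Node
        k h j e m : ℕ

    -- The quantity `k + h` never decreases: downward edges keep it, level and upward edges raise it
    -- by one.
    no-path : At s k h → At t j 0 → j < k + h → ¬ Star _⟶_ s t
    no-path {k = k} {h} {j = j} at-s at-t j< ε with At-position at-s at-t
    ... | refl , refl = <-irrefl (sym (+-identityʳ k)) j<
    no-path {k = k} {h} {j = j} at-s at-t j< (x ◅ p) with step at-s x
    ... | inj₁ at-u = no-path at-u at-t (m≤n⇒m≤1+n j<) p
    ... | inj₂ (inj₁ at-u) = no-path at-u at-t (≤-trans j< (+-monoʳ-≤ k (n≤1+n h))) p
    ... | inj₂ (inj₂ (h′ , refl , at-u)) = no-path at-u at-t (subst (j <_) (+-suc k h′) j<) p

    no-loop : At s k 0 → (p : Star _⟶_ s s) → p ≡ ε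
    no-loop at-s ε = refl
    no-loop {k = k} at-s (x ◅ p) with step at-s x
    ... | inj₁ at-u = ⊥-elim (no-path at-u at-s (s≤s (≤-reflexive (sym (+-identityʳ k)))) p)
    ... | inj₂ (inj₁ at-u) = ⊥-elim (no-path at-u at-s (≤-reflexive (+-comm 1 k)) p)
    ... | inj₂ (inj₂ (_ , () , _))

    -- `classify` is given the rest of the path, so an edge after which `t` is out of reach needs no
    -- branch.
    first-step : ∀ {c} (v : Fin c → Node) → s ≢ t →
      (edge : ∀ o → s ⟶ v o) → (∀ {o o′} → v o ≡ v o′ → o ≡ o′) →
      (∀ {u} → s ⟶ u → Star _⟶_ u t → ∃[ o ] u ≡ v o) →
      Star _⟶_ s t ↔ Σ (Fin c) (λ o → Star _⟶_ (v o) t)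
    first-step {s = s} {t} {c} v s≢t edge injective classify = mk↔ₛ′ to from to∘from from∘to
      where
      to : Star _⟶_ s t → Σ (Fin c) (λ o → Star _⟶_ (v o) t)
      to ε       = ⊥-elim (s≢t refl)
      to (x ◅ p) with classify x p
      ... | o , refl = o , p
      from : Σ (Fin c) (λ o → Star _⟶_ (v o) t) → Star _⟶_ s t
      from (o , p) = edge o ◅ p
      to∘from : ∀ y → to (from y) ≡ y
      to∘from (o , p) with classify (edge o) p
      ... | o′ , eq with injective eq
      to∘from (o , p) | _ , refl | refl = refl
      from∘to : ∀ p → from (to p) ≡ p
      from∘to ε       = ⊥-elim (s≢t refl)
      from∘to (x ◅ p) with classify x p
      ... | o , refl = cong (_◅ p) (⟶-irrelevant (edge o) x)

    apart : At s k h → At t j 0 → k + h + suc m ≡ j → s ≢ t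
    apart {k = k} at-s at-t eq refl with At-position at-s at-t
    ... | refl , refl = m≢1+m+n (k + 0) (trans (+-identityʳ k) (trans (sym eq) (+-suc (k + 0) _)))

    -- A path to `(j , 0)` stays within `k + h ≤ j < n`. The slanted side of the half diamond
    -- therefore cuts off no path, and every vertex that the recursion asks for exists.
    room : ∀ k h m → j < n → k + h + m ≡ j → k + h < n
    room k h m j<n refl = ≤-trans (s≤s (m≤m+n (k + h) m)) j<n

    -- The case in which `k + h` may not grow any more, so that the downward edge is the only way
    -- on.
    paths-descend : j < n → At s k (suc e) → At t j 0 → k + suc e + 0 ≡ j →
      (∀ {u} → At u (suc k) e → Star _⟶_ u t ↔ Fin (S (suc e) 0)) →
      Star _⟶_ s t ↔ Fin (S (suc (suc e)) 0)
    paths-descend {j} {s} {k} {e} {t} j<n at-s at-t eq ih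
      with v , at-v ← node (suc k) e (room (suc k) e 0 j<n (trans (cong (_+ 0) (sym (+-suc k e))) eq)) =
      ↔-trans (first-step (λ (_ : Fin 1) → v) s≢t (λ _ → down at-s at-v) (λ { {zero} {zero} _ → refl }) classify)
        (subst (λ c → Σ (Fin 1) (λ _ → Star _⟶_ v t) ↔ Fin c) (+-identityʳ _) (ih at-v ⊕ Σ-Fin0))
      where
      j≡ : j ≡ k + suc e
      j≡ = trans (sym eq) (+-identityʳ _)
      s≢t : s ≢ t
      s≢t refl with At-position at-s at-t
      ... | _ , ()
      classify : ∀ {u} → s ⟶ u → Star _⟶_ u t → ∃[ o ] u ≡ v
      classify x p with step at-s x
      ... | inj₁ at-u = ⊥-elim (no-path at-u at-t (s≤s (≤-reflexive j≡)) p)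
      ... | inj₂ (inj₁ at-u) = ⊥-elim (no-path at-u at-t (≤-reflexive (trans (cong suc j≡) (sym (+-suc k (suc e))))) p)
      ... | inj₂ (inj₂ (_ , refl , at-u)) = zero , At-unique at-u at-v
    paths-from-axis : j < n → At s k 0 → At t j 0 → k + 0 + suc m ≡ j →
      (∀ {u} → At u (suc k) 0 → Star _⟶_ u t ↔ Fin (S 1 m)) →
      (∀ {u} → At u k 1 → Star _⟶_ u t ↔ Fin (S 2 m)) →
      Star _⟶_ s t ↔ Fin (S 1 (suc m))
    paths-from-axis {j} {s} {k} {t} {m} j<n at-s at-t eq ih₁ ih₂
      with v₁ , at-v₁ ← node (suc k) 0 (room (suc k) 0 m j<n (trans (sym (+-suc (k + 0) m)) eq))
         | v₂ , at-v₂ ← node k 1 (room k 1 m j<n (trans (cong (_+ m) (+-suc k 0)) (trans (sym (+-suc (k + 0) m)) eq))) =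
      ↔-trans (first-step v (apart {m = m} at-s at-t eq) edge injective classify)
        (subst (λ c → Σ (Fin 2) (λ o → Star _⟶_ (v o) t) ↔ Fin c) (cong (S 1 m +_) (+-identityʳ _))
          (ih₁ at-v₁ ⊕ ih₂ at-v₂ ⊕ Σ-Fin0))
      where
      v : Fin 2 → Node
      v zero       = v₁
      v (suc zero) = v₂
      edge : ∀ o → s ⟶ v o
      edge zero       = level at-s at-v₁
      edge (suc zero) = up at-s at-v₂
      v₁≢v₂ : v₁ ≢ v₂
      v₁≢v₂ refl with At-position at-v₁ at-v₂
      ... | _ , ()
      injective : ∀ {o o′} → v o ≡ v o′ → o ≡ o′
      injective {zero}     {zero}     _  = refl
      injective {zero}     {suc zero} eq = ⊥-elim (v₁≢v₂ eq)
      injective {suc zero} {zero}     eq = ⊥-elim (v₁≢v₂ (sym eq))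
      injective {suc zero} {suc zero} _  = refl
      classify : ∀ {u} → s ⟶ u → Star _⟶_ u t → ∃[ o ] u ≡ v o
      classify x p with step at-s x
      ... | inj₁ at-u = zero , At-unique at-u at-v₁
      ... | inj₂ (inj₁ at-u) = suc zero , At-unique at-u at-v₂
      ... | inj₂ (inj₂ (_ , () , _))
    paths-from-interior : j < n → At s k (suc e) → At t j 0 → k + suc e + suc m ≡ j →
      (∀ {u} → At u (suc k) e → Star _⟶_ u t ↔ Fin (S (suc e) (suc m))) →
      (∀ {u} → At u (suc k) (suc e) → Star _⟶_ u t ↔ Fin (S (suc (suc e)) m)) →
      (∀ {u} → At u k (suc (suc e)) → Star _⟶_ u t ↔ Fin (S (suc (suc (suc e))) m)) →
      Star _⟶_ s t ↔ Fin (S (suc (suc e)) (suc m))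
    paths-from-interior {j} {s} {k} {e} {t} {m} j<n at-s at-t eq ih₀ ih₁ ih₂
      with v₀ , at-v₀ ← node (suc k) e (room (suc k) e (suc m) j<n (trans (cong (_+ suc m) (sym (+-suc k e))) eq))
         | v₁ , at-v₁ ← node (suc k) (suc e) (room (suc k) (suc e) m j<n (trans (sym (+-suc (k + suc e) m)) eq))
         | v₂ , at-v₂ ← node k (suc (suc e))
             (room k (suc (suc e)) m j<n (trans (cong (_+ m) (+-suc k (suc e))) (trans (sym (+-suc (k + suc e) m)) eq))) =
      ↔-trans (first-step v (apart {m = m} at-s at-t eq) edge injective classify)
        (subst (λ c → Σ (Fin 3) (λ o → Star _⟶_ (v o) t) ↔ Fin c)
          (trans (cong (λ c → S (suc e) (suc m) + (S (suc (suc e)) m + c)) (+-identityʳ _))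
                 (sym (+-assoc (S (suc e) (suc m)) _ _)))
          (ih₀ at-v₀ ⊕ ih₁ at-v₁ ⊕ ih₂ at-v₂ ⊕ Σ-Fin0))
      where
      v : Fin 3 → Node
      v zero             = v₀
      v (suc zero)       = v₁
      v (suc (suc zero)) = v₂
      edge : ∀ o → s ⟶ v o
      edge zero             = down at-s at-v₀
      edge (suc zero)       = level at-s at-v₁
      edge (suc (suc zero)) = up at-s at-v₂
      row : Fin 3 → ℕ
      row zero             = e
      row (suc zero)       = suc e
      row (suc (suc zero)) = suc (suc e)
      column : Fin 3 → ℕ
      column zero             = suc k
      column (suc zero)       = suc k
      column (suc (suc zero)) = k
      at-v : ∀ o → At (v o) (column o) (row o)
      at-v zero             = at-v₀
      at-v (suc zero)       = at-v₁
      at-v (suc (suc zero)) = at-v₂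
      row-injective : ∀ o o′ → row o ≡ row o′ → o ≡ o′
      row-injective zero             zero             _ = refl
      row-injective (suc zero)       (suc zero)       _ = refl
      row-injective (suc (suc zero)) (suc (suc zero)) _ = refl
      row-injective zero             (suc zero)       ()
      row-injective zero             (suc (suc zero)) ()
      row-injective (suc zero)       zero             ()
      row-injective (suc zero)       (suc (suc zero)) ()
      row-injective (suc (suc zero)) zero             ()
      row-injective (suc (suc zero)) (suc zero)       ()
      injective : ∀ {o o′} → v o ≡ v o′ → o ≡ o′
      injective {o} {o′} eq = row-injective o o′
        (proj₂ (At-position (at-v o) (subst (λ u → At u (column o′) (row o′)) (sym eq) (at-v o′))))
      classify : ∀ {u} → s ⟶ u → Star _⟶_ u t → ∃[ o ] u ≡ v o
      classify x p with step at-s x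
      ... | inj₁ at-u = suc zero , At-unique at-u at-v₁
      ... | inj₂ (inj₁ at-u) = suc (suc zero) , At-unique at-u at-v₂
      ... | inj₂ (inj₂ (_ , refl , at-u)) = zero , At-unique at-u at-v₀

    -- Here `m` is what `k + e` has still to gain. The downward, level and upward edges change
    -- `(e , m)` to `(e - 1 , m)`, `(e , m - 1)` and `(e + 1 , m - 1)`, which are the three terms of
    -- the recursion for `S (suc e) m`. On the axis the downward edge is missing, in accordance with
    -- `S 0 (suc m) = 0`.
    paths : ∀ m e → j < n → At s k e → At t j 0 → k + e + m ≡ j → Star _⟶_ s t ↔ Fin (S (suc e) m)
    paths {s = s} {k} {t} zero zero j<n at-s at-t refl
      with refl ← At-unique {s} {t} at-s (subst (λ j → At t j 0) (trans (+-identityʳ (k + 0)) (+-identityʳ k)) at-t) =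
      mk↔ₛ′ (λ _ → zero) (λ _ → ε) (λ { zero → refl }) (λ p → sym (no-loop at-s p))
    paths {k = k} zero (suc e) j<n at-s at-t eq = paths-descend j<n at-s at-t eq
      λ at-u → paths zero e j<n at-u at-t (trans (cong (_+ 0) (sym (+-suc k e))) eq)
    paths {k = k} (suc m) zero j<n at-s at-t eq = paths-from-axis j<n at-s at-t eq
      (λ at-u → paths m 0 j<n at-u at-t (trans (sym (+-suc (k + 0) m)) eq))
      (λ at-u → paths m 1 j<n at-u at-t
        (trans (cong (_+ m) (+-suc k 0)) (trans (sym (+-suc (k + 0) m)) eq)))
    paths {k = k} (suc m) (suc e) j<n at-s at-t eq = paths-from-interior j<n at-s at-t eq
      (λ at-u → paths (suc m) e j<n at-u at-t (trans (cong (_+ suc m) (sym (+-suc k e))) eq))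
      (λ at-u → paths m (suc e) j<n at-u at-t (trans (sym (+-suc (k + suc e) m)) eq))
      (λ at-u → paths m (suc (suc e)) j<n at-u at-t
        (trans (cong (_+ m) (+-suc k (suc e))) (trans (sym (+-suc (k + suc e) m)) eq)))

    paths-along-axis : j < n → At s k 0 → At t j 0 → Star _⟶_ s t ↔ Fin (T k j)
    paths-along-axis {j = j} {k = k} j<n at-s at-t with ≤-<-connex k j
    ... | inj₁ k≤j with m , refl ← m≤n⇒∃[o]m+o≡n k≤j =
      subst (λ c → _ ↔ Fin c) (sym (trans (cong (T k) (+-comm k m)) (T-shift k m)))
        (paths m 0 j<n at-s at-t (cong (_+ m) (+-identityʳ k)))
    ... | inj₂ j<k = subst (λ c → _ ↔ Fin c) (sym (T-below j<k))
      (mk↔ₛ′ (λ p → ⊥-elim (no p)) (λ ()) (λ ()) (λ p → ⊥-elim (no p)))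
      where
      no = no-path at-s at-t (subst (j <_) (sym (+-identityʳ k)) j<k)

-- The two halves of the digraph in these coordinates.

module AztecPaths where

  open import Data.Empty using (⊥-elim)
  open import Data.Fin.Base using (Fin; toℕ)
  open import Data.Fin.Properties using (toℕ<n)
  open import Data.Integer.Base using (ℤ; +_; -[1+_]; ∣_∣; _+_; _-_; _*_; -_; 0ℤ; 1ℤ; -1ℤ; _≤_; _<_; +≤+; -<+; +<+)
  import Data.Integer.Properties as ℤ
  open import Data.Integer.Tactic.RingSolver using (solve-∀)
  open import Data.Irrelevant using ([_])
  open import Data.List.Base using (List; []; _∷_)
  open import Data.List.Membership.Propositional using (_∈_)
  open import Data.List.Membership.Propositional.Properties.WithK using (unique⇒irrelevant)
  open import Data.List.Relation.Unary.All using ([]; _∷_)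
  open import Data.List.Relation.Unary.Any using (here; there)
  open import Data.List.Relation.Unary.AllPairs using ([]; _∷_)
  open import Data.List.Relation.Unary.Unique.Propositional using (Unique)
  open import Data.Nat.Base as ℕ using (ℕ; zero; suc; s≤s; z≤n)
  import Data.Nat.Properties as ℕ
  import Data.Nat.Tactic.RingSolver as ℕ
  open import Data.Product.Base using (_×_; _,_; proj₁; proj₂; ∃-syntax)
  open import Data.Refinement using (value; value-injective; _,_)
  open import Data.Sum.Base using (_⊎_; inj₁; inj₂; [_,_]′)
  open import Defs
  open import Relation.Binary.PropositionalEquality
  open import Relation.Nullary.Negation using (¬_)
  open import Algebra.Properties.AbelianGroup ℤ.+-0-abelianGroup using () renaming (∙-cancelˡ to +-cancelˡ; ∙-cancelʳ to +-cancelʳ)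
  open LatticePaths using (Walk; paths-along-axis)
  open HamburgerDeterminant using (A; B; _*′; *′-complement; *′<n)

  size : ∀ {n} (i : Fin n) → n ≡ suc (toℕ i ℕ.+ i *′)
  size {suc n} i = cong suc (sym (*′-complement i))

  module _ (n : ℕ) where

    ∣m-n∣+h≤n : ∀ m {h} → h ℕ.≤ m → m ℕ.+ h ℕ.≤ n ℕ.+ n → ∣ + m - + n ∣ ℕ.+ h ℕ.≤ n
    ∣m-n∣+h≤n m {h} h≤m m+h≤2n rewrite ℤ.m-n≡m⊖n m n with ℕ.≤-total m n
    ... | inj₁ m≤n rewrite ℤ.∣⊖∣-≤ m≤n =
      ℕ.≤-trans (ℕ.+-monoʳ-≤ (n ℕ.∸ m) h≤m) (ℕ.≤-reflexive (ℕ.m∸n+n≡m m≤n))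
    ... | inj₂ n≤m rewrite ℤ.⊖-≥ n≤m | sym (ℕ.+-∸-comm h n≤m) = ℕ.m≤n+o⇒m∸n≤o (m ℕ.+ h) n m+h≤2n

    shift : ∀ m → + suc m - + n ≡ + m - + n + 1ℤ
    shift m = lemma (+ m) (+ n)
      where
      lemma : ∀ x y → 1ℤ + x - y ≡ x - y + 1ℤ
      lemma = solve-∀

    AD-row : ∀ {h b} m → ∣ b ∣ ℕ.≤ suc h → ∣ b + 1ℤ ∣ ℕ.≤ suc h →
      h ℕ.≤ m → suc m ℕ.+ h ℕ.≤ n ℕ.+ n → AD n (+ m - + n , b)
    AD-row {h} {b} m p q h≤m m<2n = west p ∷ east p ∷ west q ∷ east q ∷ []
      where
      bound : ∀ x {y} → ∣ x ∣ ℕ.+ h ℕ.≤ n → y ℕ.≤ suc h → ∣ x ∣ ℕ.+ y ℕ.≤ suc n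
      bound x {y} le y≤ = ℕ.≤-trans (ℕ.+-monoʳ-≤ ∣ x ∣ y≤)
        (ℕ.≤-trans (ℕ.≤-reflexive (ℕ.+-suc ∣ x ∣ h)) (s≤s le))
      west : ∀ {y} → y ℕ.≤ suc h → ∣ + m - + n ∣ ℕ.+ y ℕ.≤ suc n
      west = bound (+ m - + n) (∣m-n∣+h≤n m h≤m (ℕ.≤-trans (ℕ.n≤1+n _) m<2n))
      east : ∀ {y} → y ℕ.≤ suc h → ∣ + m - + n + 1ℤ ∣ ℕ.+ y ℕ.≤ suc n
      east = bound (+ m - + n + 1ℤ) (subst (λ x → ∣ x ∣ ℕ.+ h ℕ.≤ n) (shift m)
        (∣m-n∣+h≤n (suc m) (ℕ.m≤n⇒m≤1+n h≤m) m<2n))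

    -- The ordinates of the row's corners have absolute value at most `h + 1`, with equality at one
    -- of them by the last hypothesis. So the row consists of the squares with abscissae from
    -- `h - n` to `n - h - 1`, and the next square to the west is outside.
    natural : ∀ h k {b} → h ℕ.+ k ℕ.< n → ∣ b ∣ ℕ.≤ suc h → ∣ b + 1ℤ ∣ ℕ.≤ suc h →
      ∣ b ∣ ≡ suc h ⊎ ∣ b + 1ℤ ∣ ≡ suc h → Natural n (+ (h ℕ.+ 2 ℕ.* k) - + n , b)
    natural h k {b} h+k<n p q r =
      ( AD-row (h ℕ.+ 2 ℕ.* k) p q (ℕ.m≤m+n h _) (ℕ.≤-trans (ℕ.n≤1+n _) m<2n)
      ∷ subst (λ x → AD n (x , b)) (shift (h ℕ.+ 2 ℕ.* k))
          (AD-row (suc (h ℕ.+ 2 ℕ.* k)) p q (ℕ.m≤n⇒m≤1+n (ℕ.m≤m+n h _)) m<2n)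
      ∷ [])
      , k
      , subst (λ x → AD n (x , b)) (sym west-end) (AD-row h p q ℕ.≤-refl h<n)
      , subst (λ x → ¬ AD n (x - 1ℤ , b)) (sym west-end) outside
      where
      m<2n : suc (suc (h ℕ.+ 2 ℕ.* k)) ℕ.+ h ℕ.≤ n ℕ.+ n
      m<2n = subst (ℕ._≤ n ℕ.+ n) (lemma h k) (ℕ.+-mono-≤ h+k<n h+k<n)
        where
        lemma : ∀ h k → suc (h ℕ.+ k) ℕ.+ suc (h ℕ.+ k) ≡ suc (suc (h ℕ.+ 2 ℕ.* k)) ℕ.+ h
        lemma = ℕ.solve-∀
      h<n : suc h ℕ.+ h ℕ.≤ n ℕ.+ n
      h<n = ℕ.+-mono-≤ (ℕ.≤-trans (s≤s (ℕ.m≤m+n h k)) h+k<n) (ℕ.≤-trans (ℕ.m≤m+n h k) (ℕ.<⇒≤ h+k<n))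
      west-end : + (h ℕ.+ 2 ℕ.* k) - + n - + (2 ℕ.* k) ≡ + h - + n
      west-end = lemma (+ h) (+ (2 ℕ.* k)) (+ n)
        where
        lemma : ∀ x y z → x + y - z - y ≡ x - z
        lemma = solve-∀
      h≤n : h ℕ.≤ n
      h≤n = ℕ.≤-trans (ℕ.m≤m+n h k) (ℕ.<⇒≤ h+k<n)
      ∣west∣ : ∣ + h - + n - 1ℤ ∣ ℕ.+ suc h ≡ suc (suc n)
      ∣west∣ = trans (cong (λ x → ∣ x ∣ ℕ.+ suc h) (trans (lemma (+ h) (+ n)) (ℤ.m-n≡m⊖n h (suc n))))
        (trans (cong (ℕ._+ suc h) (ℤ.∣⊖∣-≤ (ℕ.m≤n⇒m≤1+n h≤n)))
        (trans (ℕ.+-suc (suc n ℕ.∸ h) h) (cong suc (ℕ.m∸n+n≡m (ℕ.m≤n⇒m≤1+n h≤n)))))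
        where
        lemma : ∀ x y → x - y - 1ℤ ≡ x - (1ℤ + y)
        lemma = solve-∀
      too-far : ∀ {y} → y ≡ suc h → ¬ ∣ + h - + n - 1ℤ ∣ ℕ.+ y ℕ.≤ suc n
      too-far refl le = ℕ.1+n≰n (subst (ℕ._≤ suc n) ∣west∣ le)
      outside : ¬ AD n (+ h - + n - 1ℤ , b)
      outside (c₁ ∷ _ ∷ c₃ ∷ _) = [ (λ eq → too-far eq c₁) , (λ eq → too-far eq c₃) ]′ r

    -- The abscissa of the center of the domino number `k`, from the west, in row `h`.
    X : ℕ → ℕ → ℤ
    X k h = + (h ℕ.+ 2 ℕ.* k) - + n + 1ℤ

    X-level : ∀ k h → X (suc k) h ≡ X k h + + 2
    X-level k h = trans (cong (λ m → + m - + n + 1ℤ) (lemma h k)) (lemma′ (+ (h ℕ.+ 2 ℕ.* k)) (+ n))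
      where
      lemma : ∀ h k → h ℕ.+ 2 ℕ.* suc k ≡ 2 ℕ.+ (h ℕ.+ 2 ℕ.* k)
      lemma = ℕ.solve-∀
      lemma′ : ∀ x y → + 2 + x - y + 1ℤ ≡ x - y + 1ℤ + + 2
      lemma′ = solve-∀

    X-up : ∀ k h → X k (suc h) ≡ X k h + 1ℤ
    X-up k h = cong (_+ 1ℤ) (shift (h ℕ.+ 2 ℕ.* k))

    X-down : ∀ k h → X (suc k) h ≡ X k (suc h) + 1ℤ
    X-down k h = trans (X-level k h) (trans (lemma (X k h)) (cong (_+ 1ℤ) (sym (X-up k h))))
      where
      lemma : ∀ x → x + + 2 ≡ x + 1ℤ + 1ℤ
      lemma = solve-∀

    X-injective : ∀ k k′ h → X k h ≡ X k′ h → k ≡ k′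
    X-injective k k′ h eq = ℕ.*-cancelˡ-≡ k k′ 2 (ℕ.+-cancelˡ-≡ h _ _
      (ℤ.+-injective (+-cancelʳ (- + n) _ _ (+-cancelʳ 1ℤ _ _ eq))))

    pos-suc : ∀ h → + suc h ≡ + h + 1ℤ
    pos-suc h = cong +_ (ℕ.+-comm 1 h)

    neg-suc : ∀ h → -[1+ suc h ] ≡ -[1+ h ] - 1ℤ
    neg-suc h = cong (λ m → -[1+ suc m ]) (sym (ℕ.+-identityʳ h))

    distinct-targets : ∀ {x x′ x″ y y′ y″ : ℤ} → y ≢ y′ → y ≢ y″ → y′ ≢ y″ →
      Unique ((x , y) ∷ (x′ , y′) ∷ (x″ , y″) ∷ [])
    distinct-targets p q r =
      ((λ eq → p (cong proj₂ eq)) ∷ (λ eq → q (cong proj₂ eq)) ∷ []) ∷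
      ((λ eq → r (cong proj₂ eq)) ∷ []) ∷ [] ∷ []

    i≢i+1+j : ∀ i j → i ≢ i + + suc j
    i≢i+1+j i j eq with () ← +-cancelˡ i 0ℤ (+ suc j) (trans (ℤ.+-identityʳ i) eq)

    i≢i+1 : ∀ i → i ≢ i + 1ℤ
    i≢i+1 i = i≢i+1+j i 0

    i≢i-1 : ∀ i → i ≢ i - 1ℤ
    i≢i-1 i eq = i≢i+1 (i - 1ℤ) (trans (sym eq) (lemma i))
      where
      lemma : ∀ i → i ≡ i - 1ℤ + 1ℤ
      lemma = solve-∀

    i+1≢i-1 : ∀ i → i + 1ℤ ≢ i - 1ℤ
    i+1≢i-1 i eq = i≢i+1+j (i - 1ℤ) 1 (trans (sym eq) (lemma i))
      where
      lemma : ∀ i → i + 1ℤ ≡ i - 1ℤ + + 2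
      lemma = solve-∀

    topTargets-unique : ∀ p → Unique (topTargets p)
    topTargets-unique (x , j) = distinct-targets (i≢i+1 j) (i≢i-1 j) (i+1≢i-1 j)

    bottomTargets-unique : ∀ p → Unique (bottomTargets p)
    bottomTargets-unique (x , j) = distinct-targets (i≢i-1 j) (i≢i+1 j) (λ eq → i+1≢i-1 j (sym eq))

    ¬Top-w : ∀ i → ¬ Top (w {n} i)
    ¬Top-w i ()

    ¬Bottom-v : ∀ i → ¬ Bottom (v {n} i)
    ¬Bottom-v i (+<+ ())

    ¬Top×Bottom : ∀ {s : Vertex n} → Top s → ¬ Bottom s
    ¬Top×Bottom t b = ℤ.<⇒≱ b t

    G₁-target : ∀ {s t} → G₁ n s t → value t ∈ topTargets (value s)
    G₁-target (_  , _  , top _ mem)  = mem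
    G₁-target {s} (ts , _  , bottom b _) = ⊥-elim (¬Top×Bottom {s} ts b)
    G₁-target (_  , tt , v→w i _ refl) = ⊥-elim (¬Top-w i tt)
    G₁-target (ts , _  , w→v i refl _) = ⊥-elim (¬Top-w i ts)

    G₂-target : ∀ {s t} → G₂ n s t → value t ∈ bottomTargets (value s)
    G₂-target (_  , _  , bottom _ mem) = mem
    G₂-target {s} (bs , _  , top t _) = ⊥-elim (¬Top×Bottom {s} t bs)
    G₂-target (bs , _  , v→w i refl _) = ⊥-elim (¬Bottom-v i bs)
    G₂-target (_  , bt , w→v i _ refl) = ⊥-elim (¬Bottom-v i bt)

    -- Only `top` edges stay inside the top half, and the three targets have distinct ordinates, so
    -- membership among them has at most one proof.
    G₁-irrelevant : ∀ {s t} (p q : G₁ n s t) → p ≡ q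
    G₁-irrelevant {s} (ts , tt , top t₁ m₁) (ts′ , tt′ , top t₂ m₂)
      rewrite ℤ.≤-irrelevant ts ts′ | ℤ.≤-irrelevant tt tt′ | ℤ.≤-irrelevant t₁ t₂
            | unique⇒irrelevant (topTargets-unique (value s)) m₁ m₂ = refl
    G₁-irrelevant {s} (ts , _ , bottom b _) _ = ⊥-elim (¬Top×Bottom {s} ts b)
    G₁-irrelevant {s} _ (ts , _ , bottom b _) = ⊥-elim (¬Top×Bottom {s} ts b)
    G₁-irrelevant (_ , tt , v→w i _ refl) _ = ⊥-elim (¬Top-w i tt)
    G₁-irrelevant _ (_ , tt , v→w i _ refl) = ⊥-elim (¬Top-w i tt)
    G₁-irrelevant (ts , _ , w→v i refl _) _ = ⊥-elim (¬Top-w i ts)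
    G₁-irrelevant _ (ts , _ , w→v i refl _) = ⊥-elim (¬Top-w i ts)

    G₂-irrelevant : ∀ {s t} (p q : G₂ n s t) → p ≡ q
    G₂-irrelevant {s} (ts , tt , bottom t₁ m₁) (ts′ , tt′ , bottom t₂ m₂)
      rewrite ℤ.<-irrelevant ts ts′ | ℤ.<-irrelevant tt tt′ | ℤ.<-irrelevant t₁ t₂
            | unique⇒irrelevant (bottomTargets-unique (value s)) m₁ m₂ = refl
    G₂-irrelevant {s} (bs , _ , top t _) _ = ⊥-elim (¬Top×Bottom {s} t bs)
    G₂-irrelevant {s} _ (bs , _ , top t _) = ⊥-elim (¬Top×Bottom {s} t bs)
    G₂-irrelevant (bs , _ , v→w i refl _) _ = ⊥-elim (¬Bottom-v i bs)
    G₂-irrelevant _ (bs , _ , v→w i refl _) = ⊥-elim (¬Bottom-v i bs)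
    G₂-irrelevant (_ , bt , w→v i _ refl) _ = ⊥-elim (¬Bottom-v i bt)
    G₂-irrelevant _ (_ , bt , w→v i _ refl) = ⊥-elim (¬Bottom-v i bt)

    -- The bottom half is the top half after a half turn, hence the negated abscissa: its dominoes
    -- are counted from the east.
    AtTop AtBottom : Vertex n → ℕ → ℕ → Set
    AtTop    s k h = value s ≡ (X k h , + h)
    AtBottom s k h = value s ≡ (- X k h , -[1+ h ])

    Top-At : ∀ {s} k h → AtTop s k h → Top s
    Top-At k h at = subst (λ p → 0ℤ ≤ proj₂ p) (sym at) (+≤+ z≤n)

    Bottom-At : ∀ {s} k h → AtBottom s k h → Bottom s
    Bottom-At k h at = subst (λ p → proj₂ p < 0ℤ) (sym at) -<+

    top-edge : ∀ {s t} k h k′ h′ → AtTop s k h → AtTop t k′ h′ →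
      (X k′ h′ , + h′) ∈ topTargets (X k h , + h) → G₁ n s t
    top-edge {s} {t} k h k′ h′ at-s at-t mem = Top-At {s} k h at-s , Top-At {t} k′ h′ at-t ,
      top (Top-At {s} k h at-s) (subst₂ (λ p q → q ∈ topTargets p) (sym at-s) (sym at-t) mem)

    bottom-edge : ∀ {s t} k h k′ h′ → AtBottom s k h → AtBottom t k′ h′ →
      (- X k′ h′ , -[1+ h′ ]) ∈ bottomTargets (- X k h , -[1+ h ]) → G₂ n s t
    bottom-edge {s} {t} k h k′ h′ at-s at-t mem = Bottom-At {s} k h at-s , Bottom-At {t} k′ h′ at-t ,
      bottom (Bottom-At {s} k h at-s) (subst₂ (λ p q → q ∈ bottomTargets p) (sym at-s) (sym at-t) mem)

    topWalk : Walk n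
    topWalk = record
      { Node         = Vertex n
      ; _⟶_          = G₁ n
      ; ⟶-irrelevant = G₁-irrelevant
      ; At           = AtTop
      ; node         = λ k h k+h<n → (_ , [ _ , natural h k (subst (ℕ._< n) (ℕ.+-comm k h) k+h<n)
                         (ℕ.n≤1+n h) (ℕ.≤-reflexive (ℕ.+-comm h 1)) (inj₂ (ℕ.+-comm h 1)) , refl ]) , refl
      ; At-unique    = λ p q → value-injective (trans p (sym q))
      ; At-position  = λ {s} p q → position {s} p q
      ; step         = step
      ; level        = λ {s} {t} {k} {h} p q → top-edge {s} {t} k h (suc k) h p q (here (cong (_, + h) (X-level k h)))
      ; up           = λ {s} {t} {k} {h} p q → top-edge {s} {t} k h k (suc h) p q (there (here (cong₂ _,_ (X-up k h) (pos-suc h))))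
      ; down         = λ {s} {t} {k} {h} p q → top-edge {s} {t} k (suc h) (suc k) h p q (there (there (here (cong (_, + h) (X-down k h)))))
      }
      where
      position : ∀ {s : Vertex n} {k h k′ h′} → AtTop s k h → AtTop s k′ h′ → k ≡ k′ × h ≡ h′
      position {k = k} {h} {k′} p q with refl ← ℤ.+-injective (trans (sym (cong proj₂ p)) (cong proj₂ q)) =
        X-injective k k′ h (trans (sym (cong proj₁ p)) (cong proj₁ q)) , refl
      step : ∀ {s t k h} → AtTop s k h → G₁ n s t →
        AtTop t (suc k) h ⊎ AtTop t k (suc h) ⊎ ∃[ h′ ] (h ≡ suc h′ × AtTop t (suc k) h′)
      step {s} {t} {k} {h} at-s g with subst (λ p → value t ∈ topTargets p) at-s (G₁-target g)
      ... | here eq                 = inj₁ (trans eq (cong (_, + h) (sym (X-level k h))))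
      ... | there (here eq)         = inj₂ (inj₁ (trans eq (cong₂ _,_ (sym (X-up k h)) (sym (pos-suc h)))))
      -- A downward edge from the axis row would leave the top half.
      step {h = zero} at-s (_ , tt , _) | there (there (here eq)) with () ← subst (λ p → 0ℤ ≤ proj₂ p) eq tt
      step {k = k} {h = suc h} at-s g | there (there (here eq)) =
        inj₂ (inj₂ (h , refl , trans eq (cong (_, + h) (sym (X-down k h)))))

    bottomWalk : Walk n
    bottomWalk = record
      { Node         = Vertex n
      ; _⟶_          = G₂ n
      ; ⟶-irrelevant = G₂-irrelevant
      ; At           = AtBottom
      ; node         = node
      ; At-unique    = λ p q → value-injective (trans p (sym q))
      ; At-position  = λ {s} p q → position {s} p q
      ; step         = step
      ; level        = λ {s} {t} {k} {h} p q → bottom-edge {s} {t} k h (suc k) h p q (here (cong (_, -[1+ h ]) (X-level′ k h)))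
      ; up           = λ {s} {t} {k} {h} p q → bottom-edge {s} {t} k h k (suc h) p q (there (here (cong₂ _,_ (X-up′ k h) (neg-suc h))))
      ; down         = λ {s} {t} {k} {h} p q → bottom-edge {s} {t} k (suc h) (suc k) h p q (there (there (here (cong₂ _,_ (X-down′ k h) refl))))
      }
      where
      neg : ∀ x y → - (x + y) ≡ - x - y
      neg = solve-∀
      X-level′ : ∀ k h → - X (suc k) h ≡ - X k h - + 2
      X-level′ k h = trans (cong -_ (X-level k h)) (neg (X k h) (+ 2))
      X-up′ : ∀ k h → - X k (suc h) ≡ - X k h - 1ℤ
      X-up′ k h = trans (cong -_ (X-up k h)) (neg (X k h) 1ℤ)
      X-down′ : ∀ k h → - X (suc k) h ≡ - X k (suc h) - 1ℤ
      X-down′ k h = trans (cong -_ (X-down k h)) (neg (X k (suc h)) 1ℤ)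
      position : ∀ {s : Vertex n} {k h k′ h′} → AtBottom s k h → AtBottom s k′ h′ → k ≡ k′ × h ≡ h′
      position {k = k} {h} {k′} p q with refl ← ℤ.-[1+-injective (trans (sym (cong proj₂ p)) (cong proj₂ q)) =
        X-injective k k′ h (ℤ.neg-injective (trans (sym (cong proj₁ p)) (cong proj₁ q))) , refl
      node : ∀ k h → k ℕ.+ h ℕ.< n → ∃[ s ] AtBottom s k h
      node k h k+h<n with q , refl ← ℕ.m≤n⇒∃[o]m+o≡n k+h<n =
        -- Domino `k` from the east is domino `q` from the west, where `k + h + q + 1 = n`.
        (_ , [ _ , natural h q (s≤s (ℕ.+-monoˡ-≤ q (ℕ.m≤n+m h k))) ℕ.≤-refl
          (ℕ.≤-trans (ℕ.≤-reflexive (∣-h∣ h)) (ℕ.n≤1+n h)) (inj₁ refl) , refl ]) ,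
        cong (_, -[1+ h ]) (lemma (+ k) (+ h) (+ q))
        where
        ∣-h∣ : ∀ h → ∣ -[1+ h ] + 1ℤ ∣ ≡ h
        ∣-h∣ zero    = refl
        ∣-h∣ (suc h) = refl
        lemma : ∀ k h q → h + (q + (q + 0ℤ)) - (1ℤ + (k + h + q)) + 1ℤ ≡
          - (h + (k + (k + 0ℤ)) - (1ℤ + (k + h + q)) + 1ℤ)
        lemma = solve-∀
      step : ∀ {s t k h} → AtBottom s k h → G₂ n s t →
        AtBottom t (suc k) h ⊎ AtBottom t k (suc h) ⊎ ∃[ h′ ] (h ≡ suc h′ × AtBottom t (suc k) h′)
      step {s} {t} {k} {h} at-s g with subst (λ p → value t ∈ bottomTargets p) at-s (G₂-target g)
      ... | here eq                 = inj₁ (trans eq (cong (_, -[1+ h ]) (sym (X-level′ k h))))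
      ... | there (here eq)         = inj₂ (inj₁ (trans eq (cong₂ _,_ (sym (X-up′ k h)) (sym (neg-suc h)))))
      step {h = zero} at-s (_ , bt , _) | there (there (here eq))
        with +<+ () ← subst (λ p → proj₂ p < 0ℤ) eq bt
      step {k = k} {h = suc h} at-s g | there (there (here eq)) =
        inj₂ (inj₂ (h , refl , trans eq (cong (_, -[1+ h ]) (sym (X-down′ k h)))))

    AtBottom-w : ∀ i → AtBottom (w i) (i *′) 0
    AtBottom-w i = cong (_, -1ℤ) (trans
      (cong (λ m → + (2 ℕ.* toℕ i) - + m + 1ℤ) n≡) (trans (lemma (+ toℕ i) (+ (i *′)))
      (cong (λ m → - (+ (2 ℕ.* i *′) - + m + 1ℤ)) (sym n≡))))
      where
      n≡ : n ≡ suc (toℕ i ℕ.+ i *′)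
      n≡ = size i
      lemma : ∀ x y → x + (x + 0ℤ) - (1ℤ + (x + y)) + 1ℤ ≡ - (y + (y + 0ℤ) - (1ℤ + (x + y)) + 1ℤ)
      lemma = solve-∀

    A-counts : CountsPaths (G₁ n) v (A n)
    A-counts i j = paths-along-axis topWalk {k = toℕ i} (toℕ<n j) refl refl

    B-counts : CountsPaths (G₂ n) w (B n)
    B-counts i j = paths-along-axis bottomWalk {k = i *′} (*′<n j) (AtBottom-w i) (AtBottom-w j)

-- Counting matchings diagonal by diagonal, with a factor 2 for each shortened white diagonal.

module ZigzagCount where

  open import Data.Bool.Base using (Bool; true; false; not; _∧_; _∨_; if_then_else_)
  open import Data.Nat.Base using (ℕ; zero; suc; _+_; _*_; _^_)
  open import Data.Nat.Properties
  open import Data.Nat.Tactic.RingSolver using (solve-∀)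
  open import Data.Vec.Base using (Vec; []; _∷_; map; replicate)
  open import Function.Base using (_∘_)
  open import Relation.Binary.PropositionalEquality
  open ≡-Reasoning
  open HamburgerDeterminant using (power)

  private
    variable
      m n : ℕ

  ⟦_⟧ : Bool → ℕ
  ⟦ b ⟧ = if b then 1 else 0

  ⟦∧⟧ : ∀ a b → ⟦ a ∧ b ⟧ ≡ ⟦ a ⟧ * ⟦ b ⟧
  ⟦∧⟧ true  b = sym (+-identityʳ ⟦ b ⟧)
  ⟦∧⟧ false b = refl

  ∑ : (Vec Bool n → ℕ) → ℕ
  ∑ {zero}  f = f []
  ∑ {suc n} f = ∑ (λ x → f (true ∷ x)) + ∑ (λ x → f (false ∷ x))

  ∑-cong : {f g : Vec Bool n → ℕ} → (∀ x → f x ≡ g x) → ∑ f ≡ ∑ g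
  ∑-cong {zero}  f≗g = f≗g []
  ∑-cong {suc n} f≗g = cong₂ _+_ (∑-cong λ x → f≗g (true ∷ x)) (∑-cong λ x → f≗g (false ∷ x))

  ∑-*ˡ : ∀ k (f : Vec Bool n → ℕ) → ∑ (λ x → k * f x) ≡ k * ∑ f
  ∑-*ˡ {zero}  k f = refl
  ∑-*ˡ {suc n} k f = trans (cong₂ _+_ (∑-*ˡ k (f ∘ (true ∷_))) (∑-*ˡ k (f ∘ (false ∷_))))
    (sym (*-distribˡ-+ k (∑ (f ∘ (true ∷_))) (∑ (f ∘ (false ∷_)))))

  ∑-*ʳ : ∀ k (f : Vec Bool n → ℕ) → ∑ (λ x → f x * k) ≡ ∑ f * k
  ∑-*ʳ k f = trans (∑-cong λ x → *-comm (f x) k) (trans (∑-*ˡ k f) (*-comm k (∑ f)))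

  ∑-+ : (f g : Vec Bool n → ℕ) → ∑ (λ x → f x + g x) ≡ ∑ f + ∑ g
  ∑-+ {zero}  f g = refl
  ∑-+ {suc n} f g = trans
    (cong₂ _+_ (∑-+ (f ∘ (true ∷_)) (g ∘ (true ∷_))) (∑-+ (f ∘ (false ∷_)) (g ∘ (false ∷_))))
    (lemma (∑ (f ∘ (true ∷_))) (∑ (g ∘ (true ∷_))) (∑ (f ∘ (false ∷_))) (∑ (g ∘ (false ∷_))))
    where
    lemma : ∀ a b c d → (a + b) + (c + d) ≡ (a + c) + (b + d)
    lemma = solve-∀

  ∑-comm : (f : Vec Bool m → Vec Bool n → ℕ) → ∑ (λ x → ∑ (f x)) ≡ ∑ (λ y → ∑ (λ x → f x y))
  ∑-comm {zero}  f = refl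
  ∑-comm {suc m} f = trans (cong₂ _+_ (∑-comm λ x → f (true ∷ x)) (∑-comm λ x → f (false ∷ x)))
    (sym (∑-+ (λ y → ∑ λ x → f (true ∷ x) y) (λ y → ∑ λ x → f (false ∷ x) y)))

  ∑-not : (f : Vec Bool n → ℕ) → ∑ (λ x → f (map not x)) ≡ ∑ f
  ∑-not {zero}  f = refl
  ∑-not {suc n} f = trans (cong₂ _+_ (∑-not (f ∘ (false ∷_))) (∑-not (f ∘ (true ∷_))))
    (+-comm (∑ (f ∘ (false ∷_))) (∑ (f ∘ (true ∷_))))

  map-not-replicate : ∀ n b → map not (replicate n b) ≡ replicate n (not b)
  map-not-replicate zero    b = refl
  map-not-replicate (suc n) b = cong (not b ∷_) (map-not-replicate n b)

  none : Vec Bool n → Bool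
  none []      = true
  none (b ∷ x) = not b ∧ none x

  ∑-zero : ∀ n → ∑ {n} (λ _ → 0) ≡ 0
  ∑-zero zero    = refl
  ∑-zero (suc n) = cong₂ _+_ (∑-zero n) (∑-zero n)

  ∑-none : (f : Vec Bool n → ℕ) → ∑ (λ x → ⟦ none x ⟧ * f x) ≡ f (replicate n false)
  ∑-none {zero}  f = +-identityʳ (f [])
  ∑-none {suc n} f = cong₂ _+_ (∑-zero n) (∑-none (λ x → f (false ∷ x)))

  -- A path w₀ b₀ w₁ b₁ … wₙ has at most one matching covering exactly the
  -- vertices b selected by x and the vertices w selected by u; zig false x u
  -- tells whether it exists, and p tells whether w₀ is matched from the left.
  ok carry : Bool → Bool → Bool → Bool
  ok true  b u = u
  ok false b u = not u ∨ b
  carry p b u = b ∧ not (u ∧ not p)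

  zig : Bool → Vec Bool n → Vec Bool (suc n) → Bool
  zig p     (b ∷ x) (u ∷ U)  = ok p b u ∧ zig (carry p b u) x U
  zig true  []      (u ∷ []) = u
  zig false []      (u ∷ []) = not u

  zig-none : (x : Vec Bool n) → zig false x (replicate (suc n) false) ≡ none x
  zig-none []          = refl
  zig-none (false ∷ x) = zig-none x
  zig-none (true ∷ x)  = zig-carry x
    where
    zig-carry : (x : Vec Bool n) → zig true x (replicate (suc n) false) ≡ false
    zig-carry []      = refl
    zig-carry (b ∷ x) = refl

  -- The matchings of the part between two consecutive black diagonals, with x
  -- and y the squares matched towards each other: wide when the white diagonal
  -- between them is the longer one, narrow when it is replaced by a shorter one,
  -- which has to match the squares left over by x and y.
  wide : Bool → Bool → Vec Bool n → Vec Bool n → ℕ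
  wide p q x y = ∑ λ U → ⟦ zig p x U ⟧ * ⟦ zig q y (map not U) ⟧

  narrow : Bool → Bool → Vec Bool (suc n) → Vec Bool (suc n) → ℕ
  narrow p q x y = ∑ λ c → ⟦ zig p c (map not x) ⟧ * ⟦ zig q (map not c) (map not y) ⟧

  private
    pull : ∀ {n} a b (z w : Vec Bool n → Bool) →
      ∑ (λ U → ⟦ a ∧ z U ⟧ * ⟦ b ∧ w U ⟧) ≡ ⟦ a ⟧ * ⟦ b ⟧ * ∑ (λ U → ⟦ z U ⟧ * ⟦ w U ⟧)
    pull a b z w = trans
      (∑-cong λ U → trans (cong₂ _*_ (⟦∧⟧ a (z U)) (⟦∧⟧ b (w U))) (lemma ⟦ a ⟧ ⟦ z U ⟧ ⟦ b ⟧ ⟦ w U ⟧))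
      (∑-*ˡ (⟦ a ⟧ * ⟦ b ⟧) (λ U → ⟦ z U ⟧ * ⟦ w U ⟧))
      where
      lemma : ∀ a b c d → a * b * (c * d) ≡ a * c * (b * d)
      lemma = solve-∀

  -- The two terms are the two sides from which the first white square can be covered; the carries
  -- form the state in which the remaining cells are entered.
  wide-∷ : ∀ p q a b (x y : Vec Bool n) → wide p q (a ∷ x) (b ∷ y) ≡
    ⟦ ok p a true ⟧ * ⟦ ok q b false ⟧ * wide (carry p a true) (carry q b false) x y +
    ⟦ ok p a false ⟧ * ⟦ ok q b true ⟧ * wide (carry p a false) (carry q b true) x y
  wide-∷ p q a b x y = cong₂ _+_
    (pull (ok p a true) (ok q b false) (zig (carry p a true) x) (zig (carry q b false) y ∘ map not))
    (pull (ok p a false) (ok q b true) (zig (carry p a false) x) (zig (carry q b true) y ∘ map not))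

  narrow-∷ : ∀ p q a b (x y : Vec Bool (suc n)) → narrow p q (a ∷ x) (b ∷ y) ≡
    ⟦ ok p true (not a) ⟧ * ⟦ ok q false (not b) ⟧ * narrow (carry p true (not a)) (carry q false (not b)) x y +
    ⟦ ok p false (not a) ⟧ * ⟦ ok q true (not b) ⟧ * narrow (carry p false (not a)) (carry q true (not b)) x y
  narrow-∷ p q a b x y = cong₂ _+_
    (pull (ok p true (not a)) (ok q false (not b))
      (λ c → zig (carry p true (not a)) c (map not x)) (λ c → zig (carry q false (not b)) (map not c) (map not y)))
    (pull (ok p false (not a)) (ok q true (not b))
      (λ c → zig (carry p false (not a)) c (map not x)) (λ c → zig (carry q true (not b)) (map not c) (map not y)))

  -- The first white square would be covered from both sides.
  wide-true-true : (x y : Vec Bool n) → wide true true x y ≡ 0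
  wide-true-true []      []      = refl
  wide-true-true (a ∷ x) (b ∷ y) = wide-∷ true true a b x y

  private

    -- The recursion steps, for w p q = wide p q x y and g p q = narrow p q x y.
    module Step (w g : Bool → Bool → ℕ)
      (w₀₀ : w false false ≡ 2 * g false false)
      (w₁₀ : w true false ≡ g true false + g false true)
      (w₀₁ : w false true ≡ g true false + g false true)
      (w₁₁ : w true true ≡ 0) where

      next-wide next-narrow : Bool → Bool → Bool → Bool → ℕ
      next-wide p q a b =
        ⟦ ok p a true ⟧ * ⟦ ok q b false ⟧ * w (carry p a true) (carry q b false) +
        ⟦ ok p a false ⟧ * ⟦ ok q b true ⟧ * w (carry p a false) (carry q b true)
      next-narrow p q a b =
        ⟦ ok p true (not a) ⟧ * ⟦ ok q false (not b) ⟧ * g (carry p true (not a)) (carry q false (not b)) +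
        ⟦ ok p false (not a) ⟧ * ⟦ ok q true (not b) ⟧ * g (carry p false (not a)) (carry q true (not b))

      step₀₀ : ∀ a b → next-wide false false a b ≡ 2 * next-narrow false false a b
      step₀₀ false false = refl
      step₀₀ false true  rewrite w₀₀ = lemma (g false false)
        where
        lemma : ∀ g → 0 + 1 * 1 * (2 * g) ≡ 2 * (1 * 1 * g + 0)
        lemma = solve-∀
      step₀₀ true  false rewrite w₀₀ = lemma (g false false)
        where
        lemma : ∀ g → 1 * 1 * (2 * g) + 0 ≡ 2 * (0 + 1 * 1 * g)
        lemma = solve-∀
      step₀₀ true  true  rewrite w₁₀ | w₀₁ = lemma (g true false) (g false true)
        where
        lemma : ∀ g h → 1 * 1 * (g + h) + 1 * 1 * (g + h) ≡ 2 * (1 * 1 * g + 1 * 1 * h)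
        lemma = solve-∀

      step₁₀ : ∀ a b → next-wide true false a b ≡ next-narrow true false a b + next-narrow false true a b
      step₁₀ false false rewrite w₀₀ = lemma (g false false)
        where
        lemma : ∀ g → 1 * 1 * (2 * g) + 0 ≡ (0 + 1 * 1 * g) + (1 * 1 * g + 0)
        lemma = solve-∀
      step₁₀ false true  rewrite w₀₁ = lemma (g true false) (g false true)
        where
        lemma : ∀ g h → 1 * 1 * (g + h) + 0 ≡ (1 * 1 * g + 1 * 1 * h) + 0
        lemma = solve-∀
      step₁₀ true  false rewrite w₁₀ = lemma (g true false) (g false true)
        where
        lemma : ∀ g h → 1 * 1 * (g + h) + 0 ≡ 0 + (1 * 1 * g + 1 * 1 * h)
        lemma = solve-∀
      step₁₀ true  true  rewrite w₁₁ = refl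

      step₀₁ : ∀ a b → next-wide false true a b ≡ next-narrow true false a b + next-narrow false true a b
      step₀₁ false false rewrite w₀₀ = lemma (g false false)
        where
        lemma : ∀ g → 1 * 1 * (2 * g) ≡ (0 + 1 * 1 * g) + (1 * 1 * g + 0)
        lemma = solve-∀
      step₀₁ false true  rewrite w₀₁ = lemma (g true false) (g false true)
        where
        lemma : ∀ g h → 1 * 1 * (g + h) ≡ (1 * 1 * g + 1 * 1 * h) + 0
        lemma = solve-∀
      step₀₁ true  false rewrite w₁₀ = lemma (g true false) (g false true)
        where
        lemma : ∀ g h → 1 * 1 * (g + h) ≡ 0 + (1 * 1 * g + 1 * 1 * h)
        lemma = solve-∀
      step₀₁ true  true  rewrite w₁₁ = refl

  mutual

    -- Reading one cell can lead from the empty state to a single carry and back, so the identities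
    -- for these states are proved together; a carry on both sides contributes 0. With a single
    -- carry, on either side, `wide` equals the sum of `narrow` over both sides. The induction
    -- starts at one cell, where the shorter diagonal is empty.
    wide-false-false : (x y : Vec Bool (suc n)) → wide false false x y ≡ 2 * narrow false false x y
    wide-false-false (false ∷ []) (false ∷ []) = refl
    wide-false-false (false ∷ []) (true ∷ [])  = refl
    wide-false-false (true ∷ [])  (false ∷ []) = refl
    wide-false-false (true ∷ [])  (true ∷ [])  = refl
    wide-false-false (a ∷ x@(_ ∷ _)) (b ∷ y@(_ ∷ _)) = trans (wide-∷ false false a b x y)
      (trans (Step.step₀₀ (λ p q → wide p q x y) (λ p q → narrow p q x y)
               (wide-false-false x y) (wide-true-false x y) (wide-false-true x y) (wide-true-true x y) a b)
             (cong (2 *_) (sym (narrow-∷ false false a b x y))))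

    wide-true-false : (x y : Vec Bool (suc n)) →
      wide true false x y ≡ narrow true false x y + narrow false true x y
    wide-true-false (false ∷ []) (false ∷ []) = refl
    wide-true-false (false ∷ []) (true ∷ [])  = refl
    wide-true-false (true ∷ [])  (false ∷ []) = refl
    wide-true-false (true ∷ [])  (true ∷ [])  = refl
    wide-true-false (a ∷ x@(_ ∷ _)) (b ∷ y@(_ ∷ _)) = trans (wide-∷ true false a b x y)
      (trans (Step.step₁₀ (λ p q → wide p q x y) (λ p q → narrow p q x y)
               (wide-false-false x y) (wide-true-false x y) (wide-false-true x y) (wide-true-true x y) a b)
             (cong₂ _+_ (sym (narrow-∷ true false a b x y)) (sym (narrow-∷ false true a b x y))))

    wide-false-true : (x y : Vec Bool (suc n)) →
      wide false true x y ≡ narrow true false x y + narrow false true x y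
    wide-false-true (false ∷ []) (false ∷ []) = refl
    wide-false-true (false ∷ []) (true ∷ [])  = refl
    wide-false-true (true ∷ [])  (false ∷ []) = refl
    wide-false-true (true ∷ [])  (true ∷ [])  = refl
    wide-false-true (a ∷ x@(_ ∷ _)) (b ∷ y@(_ ∷ _)) = trans (wide-∷ false true a b x y)
      (trans (Step.step₀₁ (λ p q → wide p q x y) (λ p q → narrow p q x y)
               (wide-false-false x y) (wide-true-false x y) (wide-false-true x y) (wide-true-true x y) a b)
             (cong₂ _+_ (sym (narrow-∷ true false a b x y)) (sym (narrow-∷ false true a b x y))))

  -- `x` selects the black squares to be matched to the next of the `k` remaining white diagonals.
  -- The length `n` and the number `k` are kept apart, as in an Aztec rectangle, so that an
  -- induction on `k` leaves the length alone.
  count : ℕ → Vec Bool n → ℕ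
  count zero    x = ⟦ none x ⟧
  count (suc k) x = ∑ λ y → wide false false x y * count k (map not y)

  private

    halved : ℕ → Vec Bool (suc n) → ℕ
    halved zero    x = ⟦ none x ⟧
    halved (suc k) x = ∑ λ y → narrow false false x y * halved k (map not y)

    count-halved : ∀ k (x : Vec Bool (suc n)) → count k x ≡ 2 ^ k * halved k x
    count-halved zero    x = sym (+-identityʳ ⟦ none x ⟧)
    count-halved (suc k) x = begin
      ∑ (λ y → wide false false x y * count k (map not y))
        ≡⟨ ∑-cong (λ y → trans (cong₂ _*_ (wide-false-false x y) (count-halved k (map not y)))
                               (lemma (narrow false false x y) (2 ^ k) (halved k (map not y)))) ⟩
      ∑ (λ y → 2 ^ suc k * (narrow false false x y * halved k (map not y)))
        ≡⟨ ∑-*ˡ (2 ^ suc k) (λ y → narrow false false x y * halved k (map not y)) ⟩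
      2 ^ suc k * halved (suc k) x ∎
      where
      lemma : ∀ a b c → 2 * a * (b * c) ≡ 2 * b * (a * c)
      lemma = solve-∀

    -- The shortened region entered at a short diagonal instead of a black one; `d` selects the
    -- squares of that diagonal that are matched forwards.
    merged : ℕ → Vec Bool n → ℕ
    merged k d = ∑ λ y → ⟦ zig false d y ⟧ * halved k y

    regroup : ∀ k (x : Vec Bool (suc n)) →
      halved (suc k) x ≡ ∑ (λ c → ⟦ zig false c (map not x) ⟧ * merged k (map not c))
    regroup k x = begin
      ∑ (λ y → ∑ (λ c → s c * t c y) * halved k (map not y))
        ≡⟨ ∑-cong (λ y → trans (sym (∑-*ʳ (halved k (map not y)) (λ c → s c * t c y)))
             (∑-cong λ c → *-assoc (s c) (t c y) _)) ⟩
      ∑ (λ y → ∑ (λ c → s c * (t c y * halved k (map not y))))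
        ≡⟨ ∑-comm (λ y c → s c * (t c y * halved k (map not y))) ⟩
      ∑ (λ c → ∑ (λ y → s c * (t c y * halved k (map not y))))
        ≡⟨ ∑-cong (λ c → trans (∑-*ˡ (s c) (λ y → t c y * halved k (map not y)))
             (cong (s c *_) (∑-not λ y → ⟦ zig false (map not c) y ⟧ * halved k y))) ⟩
      ∑ (λ c → s c * merged k (map not c)) ∎
      where
      s : Vec Bool _ → ℕ
      s c = ⟦ zig false c (map not x) ⟧
      t : Vec Bool _ → Vec Bool _ → ℕ
      t c y = ⟦ zig false (map not c) (map not y) ⟧

    -- Between consecutive short diagonals `d` and `c` lies a black diagonal `y` with one square
    -- more, covered from both sides: it takes the place of the long diagonal in `wide`, and the
    -- colours are exchanged. At the end `none y` forces the last black diagonal to receive nothing.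
    merged≡count : ∀ k (d : Vec Bool n) → merged k d ≡ count k d
    merged≡count zero    d = begin
      ∑ (λ y → ⟦ zig false d y ⟧ * ⟦ none y ⟧) ≡⟨ ∑-cong (λ y → *-comm ⟦ zig false d y ⟧ ⟦ none y ⟧) ⟩
      ∑ (λ y → ⟦ none y ⟧ * ⟦ zig false d y ⟧) ≡⟨ ∑-none (λ y → ⟦ zig false d y ⟧) ⟩
      ⟦ zig false d (replicate _ false) ⟧       ≡⟨ cong ⟦_⟧ (zig-none d) ⟩
      ⟦ none d ⟧                                ∎
    merged≡count (suc k) d = begin
      ∑ (λ y → ⟦ zig false d y ⟧ * halved (suc k) y)
        ≡⟨ ∑-cong (λ y → trans (cong (⟦ zig false d y ⟧ *_) (regroup k y))
             (sym (∑-*ˡ ⟦ zig false d y ⟧ (λ c → ⟦ zig false c (map not y) ⟧ * merged k (map not c))))) ⟩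
      ∑ (λ y → ∑ (λ c → ⟦ zig false d y ⟧ * (⟦ zig false c (map not y) ⟧ * merged k (map not c))))
        ≡⟨ ∑-comm (λ y c → ⟦ zig false d y ⟧ * (⟦ zig false c (map not y) ⟧ * merged k (map not c))) ⟩
      ∑ (λ c → ∑ (λ y → ⟦ zig false d y ⟧ * (⟦ zig false c (map not y) ⟧ * merged k (map not c))))
        ≡⟨ ∑-cong (λ c → trans
             (∑-cong λ y → sym (*-assoc ⟦ zig false d y ⟧ ⟦ zig false c (map not y) ⟧ (merged k (map not c))))
             (trans (∑-*ʳ (merged k (map not c)) (λ y → ⟦ zig false d y ⟧ * ⟦ zig false c (map not y) ⟧))
                    (cong (wide false false d c *_) (merged≡count k (map not c))))) ⟩
      ∑ (λ c → wide false false d c * count k (map not c)) ∎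

  -- A first black diagonal with all squares selected leaves nothing over for the first short
  -- diagonal, so `none c` holds there and that diagonal is matched entirely forwards.
  count-full : ∀ n k → count (suc k) (replicate (suc n) true) ≡ 2 ^ suc k * count k (replicate n true)
  count-full n k = begin
    count (suc k) (replicate (suc n) true)
      ≡⟨ count-halved (suc k) (replicate (suc n) true) ⟩
    2 ^ suc k * halved (suc k) (replicate (suc n) true)
      ≡⟨ cong (2 ^ suc k *_) (begin
        halved (suc k) (replicate (suc n) true)
          ≡⟨ regroup k (replicate (suc n) true) ⟩
        ∑ (λ c → ⟦ zig false c (map not (replicate (suc n) true)) ⟧ * merged k (map not c))
          ≡⟨ ∑-cong (λ c → cong₂ (λ b e → ⟦ b ⟧ * e)
               (trans (cong (zig false c) (map-not-replicate (suc n) true)) (zig-none c))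
               (merged≡count k (map not c))) ⟩
        ∑ {n} (λ c → ⟦ none c ⟧ * count k (map not c))
          ≡⟨ ∑-none {n} (λ c → count k (map not c)) ⟩
        count k (map not (replicate n false))
          ≡⟨ cong (count k) (map-not-replicate n false) ⟩
        count k (replicate n true) ∎) ⟩
    2 ^ suc k * count k (replicate n true) ∎

  count-power : ∀ n → count n (replicate n true) ≡ power n
  count-power zero    = refl
  count-power (suc n) = trans (count-full n n) (cong (2 ^ suc n *_) (count-power n))

-- Chains of matched rows, and their description by arms.

module RowCodes where

  open import Data.Bool.Base using (Bool; true; false; not; _∧_; _∨_; if_then_else_; T)
  open import Data.Bool.Properties using (T-irrelevant)
  open import Data.Empty using (⊥; ⊥-elim)
  open import Data.Fin.Base using (Fin; zero; suc)
  open import Data.Fin.Properties using (+↔⊎; *↔×)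
  open import Data.Nat.Base using (ℕ; zero; suc; _*_; _≤_; _<_; z≤n; s≤s)
  open import Data.Nat.Properties using (≤-refl)
  open import Data.Product.Base using (Σ; _×_; _,_; proj₁; proj₂)
  open import Data.Product.Function.NonDependent.Propositional using (_×-cong_)
  open import Data.Sum.Base using (_⊎_; inj₁; inj₂)
  open import Data.Sum.Function.Propositional using (_⊎-cong_)
  open import Data.Unit.Base using (tt)
  open import Data.Vec.Base using (Vec; []; _∷_; map; replicate)
  open import Data.Vec.Properties using (∷-injective)
  open import Function.Base using (_∘_)
  open import Function.Bundles using (_↔_; mk↔ₛ′)
  open import Function.Properties.Inverse using (↔-sym; ↔-trans)
  open import Relation.Binary.PropositionalEquality
  open HamburgerDeterminant using (power)
  open ZigzagCount

  private
    variable
      n : ℕ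

  T↔Fin : ∀ b → T b ↔ Fin ⟦ b ⟧
  T↔Fin true  = mk↔ₛ′ (λ _ → zero) (λ _ → tt) (λ { zero → refl }) (λ _ → refl)
  T↔Fin false = mk↔ₛ′ (λ ()) (λ ()) (λ ()) (λ ())

  Σ-Vec : {A : Vec Bool n → Set} {f : Vec Bool n → ℕ} →
    (∀ x → A x ↔ Fin (f x)) → Σ (Vec Bool n) A ↔ Fin (∑ f)
  Σ-Vec {zero}  {A} A↔ = ↔-trans
    (mk↔ₛ′ (λ { ([] , a) → a }) ([] ,_) (λ _ → refl) (λ { ([] , a) → refl })) (A↔ [])
  Σ-Vec {suc n} {A} A↔ = ↔-trans split
    (↔-trans (Σ-Vec (λ x → A↔ (true ∷ x)) ⊎-cong Σ-Vec (λ x → A↔ (false ∷ x))) (↔-sym +↔⊎))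
    where
    split : Σ (Vec Bool (suc n)) A ↔
            (Σ (Vec Bool n) (λ x → A (true ∷ x)) ⊎ Σ (Vec Bool n) (λ x → A (false ∷ x)))
    split = mk↔ₛ′
      (λ { (true ∷ x , a) → inj₁ (x , a) ; (false ∷ x , a) → inj₂ (x , a) })
      (λ { (inj₁ (x , a)) → true ∷ x , a ; (inj₂ (x , a)) → false ∷ x , a })
      (λ { (inj₁ _) → refl ; (inj₂ _) → refl })
      (λ { (true ∷ x , a) → refl ; (false ∷ x , a) → refl })

  _×-Fin_ : {A B : Set} {a b : ℕ} → A ↔ Fin a → B ↔ Fin b → (A × B) ↔ Fin (a * b)
  p ×-Fin q = ↔-trans (p ×-cong q) (↔-sym *↔×)

  -- Row by row: x selects the black squares of a row that are matched upwards,
  -- U the white squares of the next row that are matched downwards.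
  Chain : ℕ → Vec Bool n → Set
  Chain     zero    x = T (none x)
  Chain {n} (suc k) x = Σ (Vec Bool n) λ y →
    Σ (Vec Bool (suc n)) (λ U → T (zig false x U) × T (zig false y (map not U))) × Chain k (map not y)

  Chain↔Fin : ∀ k (x : Vec Bool n) → Chain k x ↔ Fin (count k x)
  Chain↔Fin zero    x = T↔Fin (none x)
  Chain↔Fin (suc k) x = Σ-Vec λ y →
    Σ-Vec (λ U → T↔Fin (zig false x U) ×-Fin T↔Fin (zig false y (map not U))) ×-Fin Chain↔Fin k (map not y)

  Code : ℕ → Set
  Code n = Chain n (replicate n true)

  Code↔Fin : ∀ n → Code n ↔ Fin (power n)
  Code↔Fin n = subst (λ k → Code n ↔ Fin k) (count-power n) (Chain↔Fin n (replicate n true))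

  -- How a black square is matched to one of the adjacent white rows.
  data Arm : Set where
    idle left right : Arm

  used isLeft isRight : Arm → Bool
  used idle  = false
  used left  = true
  used right = true
  isLeft left  = true
  isLeft _     = false
  isRight right = true
  isRight _     = false

  Arm-ext : ∀ {a b} → isLeft a ≡ isLeft b → isRight a ≡ isRight b → a ≡ b
  Arm-ext {idle}  {idle}  _ _ = refl
  Arm-ext {idle}  {left}  () _
  Arm-ext {idle}  {right} _ ()
  Arm-ext {left}  {idle}  () _
  Arm-ext {left}  {left}  _ _ = refl
  Arm-ext {left}  {right} () _
  Arm-ext {right} {idle}  _ ()
  Arm-ext {right} {left}  _ ()
  Arm-ext {right} {right} _ _ = refl

  -- The matching of a zigzag path is forced from left to right: a covered white square not yet
  -- taken from its left must be taken by the next black square; in all other cases a used black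
  -- square turns right.
  pick : Bool → Bool → Bool → Arm
  pick p b u = if b then (if u ∧ not p then left else right) else idle

  arm : Bool → Vec Bool n → Vec Bool (suc n) → ℕ → Arm
  arm p []      _       j       = idle
  arm p (b ∷ x) (u ∷ U) zero    = pick p b u
  arm p (b ∷ x) (u ∷ U) (suc j) = arm (carry p b u) x U j

  fromLeft : Bool → (ℕ → Arm) → ℕ → Bool
  fromLeft p a zero    = p
  fromLeft p a (suc j) = isRight (a j)

  usedVec : ∀ n → (ℕ → Arm) → Vec Bool n
  usedVec zero    a = []
  usedVec (suc n) a = used (a 0) ∷ usedVec n (a ∘ suc)

  coveredVec : ∀ n → Bool → (ℕ → Arm) → Vec Bool (suc n)
  coveredVec zero    p a = (p ∨ isLeft (a 0)) ∷ []
  coveredVec (suc n) p a = (p ∨ isLeft (a 0)) ∷ coveredVec n (isRight (a 0)) (a ∘ suc)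

  usedVec-cong : ∀ n {a a′ : ℕ → Arm} → (∀ j → a j ≡ a′ j) → usedVec n a ≡ usedVec n a′
  usedVec-cong zero    eq = refl
  usedVec-cong (suc n) eq = cong₂ _∷_ (cong used (eq 0)) (usedVec-cong n (eq ∘ suc))

  coveredVec-cong : ∀ n p {a a′ : ℕ → Arm} → (∀ j → a j ≡ a′ j) → coveredVec n p a ≡ coveredVec n p a′
  coveredVec-cong zero    p eq = cong (λ b → (p ∨ isLeft b) ∷ []) (eq 0)
  coveredVec-cong (suc n) p {a} {a′} eq = cong₂ (λ b V → (p ∨ isLeft b) ∷ V) (eq 0)
    (trans (cong (λ b → coveredVec n (isRight b) (a ∘ suc)) (eq 0)) (coveredVec-cong n _ (eq ∘ suc)))

  isRight-pick : ∀ p b u → isRight (pick p b u) ≡ carry p b u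
  isRight-pick p     false u     = refl
  isRight-pick false true  false = refl
  isRight-pick false true  true  = refl
  isRight-pick true  true  false = refl
  isRight-pick true  true  true  = refl

  T-∧ˡ : ∀ {a b} → T (a ∧ b) → T a
  T-∧ˡ {true} _ = tt

  T-∧ʳ : ∀ {a b} → T (a ∧ b) → T b
  T-∧ʳ {true} t = t

  T-∧ : ∀ {a b} → T a → T b → T (a ∧ b)
  T-∧ {true} _ t = t

  usedVec-arm : ∀ p (x : Vec Bool n) U → usedVec n (arm p x U) ≡ x
  usedVec-arm p []      U       = refl
  usedVec-arm p (b ∷ x) (u ∷ U) = cong₂ _∷_ (used-pick b (u ∧ not p)) (usedVec-arm (carry p b u) x U)
    where
    used-pick : ∀ b c → used (if b then (if c then left else right) else idle) ≡ b
    used-pick false c     = refl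
    used-pick true  false = refl
    used-pick true  true  = refl

  coveredVec-arm : ∀ p (x : Vec Bool n) U → T (zig p x U) → coveredVec n p (arm p x U) ≡ U
  coveredVec-arm true  []      (true ∷ [])  _ = refl
  coveredVec-arm false []      (false ∷ []) _ = refl
  coveredVec-arm {suc n} p (b ∷ x) (u ∷ U) z = cong₂ _∷_ (covered p b u (T-∧ˡ z))
    (trans (cong (λ q → coveredVec n q (arm (carry p b u) x U)) (isRight-pick p b u))
           (coveredVec-arm (carry p b u) x U (T-∧ʳ {ok p b u} z)))
    where
    covered : ∀ p b u → T (ok p b u) → p ∨ isLeft (pick p b u) ≡ u
    covered true  b     true  _ = refl
    covered false false false _ = refl
    covered false true  false _ = refl
    covered false true  true  _ = refl

  Clash : Bool → (ℕ → Arm) → ℕ → Set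
  Clash p a j = T (fromLeft p a j ∧ isLeft (a j))

  arm-clash : ∀ p (x : Vec Bool n) U j → Clash p (arm p x U) j → ⊥
  arm-clash false []     U       zero    ()
  arm-clash true  []     U       zero    ()
  arm-clash p     []     U       (suc j) ()
  arm-clash true  (false ∷ x) (u ∷ U)     zero    ()
  arm-clash true  (true ∷ x)  (true ∷ U)  zero    ()
  arm-clash true  (true ∷ x)  (false ∷ U) zero    ()
  arm-clash false (b ∷ x) (u ∷ U) zero    ()
  arm-clash p     (b ∷ x) (u ∷ U) (suc zero)    c =
    arm-clash (carry p b u) x U zero (subst (λ q → T (q ∧ isLeft (arm (carry p b u) x U 0))) (isRight-pick p b u) c)
  arm-clash p     (b ∷ x) (u ∷ U) (suc (suc j)) c = arm-clash (carry p b u) x U (suc j) c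

  arm-outside : ∀ p (x : Vec Bool n) U {j} → n ≤ j → arm p x U j ≡ idle
  arm-outside p []      U       _         = refl
  arm-outside p (b ∷ x) (u ∷ U) (s≤s n≤j) = arm-outside (carry p b u) x U n≤j

  private
    ¬clash-suc : ∀ {p a} → (∀ j → Clash p a j → ⊥) → ∀ j → Clash (isRight (a 0)) (a ∘ suc) j → ⊥
    ¬clash-suc h zero    = h 1
    ¬clash-suc h (suc j) = h (suc (suc j))

    carry-used : ∀ p a → (T (p ∧ isLeft a) → ⊥) → carry p (used a) (p ∨ isLeft a) ≡ isRight a
    carry-used false idle  _ = refl
    carry-used false left  _ = refl
    carry-used false right _ = refl
    carry-used true  idle  _ = refl
    carry-used true  left  h = ⊥-elim (h tt)
    carry-used true  right _ = refl

  -- `a n` lies beyond the last black square, but `coveredVec` reads it for the last white square,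
  -- so it has to be idle.
  zig-vec : ∀ n p a → (∀ j → Clash p a j → ⊥) → a n ≡ idle → T (zig p (usedVec n a) (coveredVec n p a))
  zig-vec zero    true  a _ _   = tt
  zig-vec zero    false a _ eq rewrite eq = tt
  zig-vec (suc n) p a ¬clash eq = T-∧ (ok-used p (a 0))
    (subst (λ q → T (zig q (usedVec n (a ∘ suc)) (coveredVec n (isRight (a 0)) (a ∘ suc))))
      (sym (carry-used p (a 0) (¬clash 0))) (zig-vec n (isRight (a 0)) (a ∘ suc) (¬clash-suc {p} {a} ¬clash) eq))
    where
    ok-used : ∀ p a → T (ok p (used a) (p ∨ isLeft a))
    ok-used true  a     = tt
    ok-used false idle  = tt
    ok-used false left  = tt
    ok-used false right = tt

  arm-vec : ∀ n p a → (∀ j → Clash p a j → ⊥) → (∀ j → n ≤ j → a j ≡ idle) →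
    ∀ j → arm p (usedVec n a) (coveredVec n p a) j ≡ a j
  arm-vec zero    p a ¬clash outside j       = sym (outside j z≤n)
  arm-vec (suc n) p a ¬clash outside zero    = pick-used p (a 0) (¬clash 0)
    where
    pick-used : ∀ p a → (T (p ∧ isLeft a) → ⊥) → pick p (used a) (p ∨ isLeft a) ≡ a
    pick-used p     idle  _ = refl
    pick-used false left  _ = refl
    pick-used true  left  h = ⊥-elim (h tt)
    pick-used false right _ = refl
    pick-used true  right _ = refl
  arm-vec (suc n) p a ¬clash outside (suc j) = trans
    (cong (λ q → arm q (usedVec n (a ∘ suc)) (coveredVec n (isRight (a 0)) (a ∘ suc)) j)
      (carry-used p (a 0) (¬clash 0)))
    (arm-vec n (isRight (a 0)) (a ∘ suc) (¬clash-suc {p} {a} ¬clash) (λ j n≤j → outside (suc j) (s≤s n≤j)) j)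

  usedVec-not : ∀ n (a b : ℕ → Arm) → (∀ j → j < n → used (a j) ≡ not (used (b j))) →
    usedVec n a ≡ map not (usedVec n b)
  usedVec-not zero    a b h = refl
  usedVec-not (suc n) a b h = cong₂ _∷_ (h 0 (s≤s z≤n)) (usedVec-not n (a ∘ suc) (b ∘ suc) λ j j<n → h (suc j) (s≤s j<n))

  usedVec-not⁻¹ : ∀ n (a b : ℕ → Arm) → usedVec n a ≡ map not (usedVec n b) →
    ∀ j → j < n → used (a j) ≡ not (used (b j))
  usedVec-not⁻¹ (suc n) a b eq zero    _         = proj₁ (∷-injective eq)
  usedVec-not⁻¹ (suc n) a b eq (suc j) (s≤s j<n) = usedVec-not⁻¹ n (a ∘ suc) (b ∘ suc) (proj₂ (∷-injective eq)) j j<n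

  usedVec-replicate : ∀ n c (a : ℕ → Arm) → (∀ j → j < n → used (a j) ≡ c) → usedVec n a ≡ replicate n c
  usedVec-replicate zero    c a h = refl
  usedVec-replicate (suc n) c a h =
    cong₂ _∷_ (h 0 (s≤s z≤n)) (usedVec-replicate n c (a ∘ suc) λ j j<n → h (suc j) (s≤s j<n))

  usedVec-replicate⁻¹ : ∀ n c (a : ℕ → Arm) → usedVec n a ≡ replicate n c → ∀ j → j < n → used (a j) ≡ c
  usedVec-replicate⁻¹ (suc n) c a eq zero    _         = proj₁ (∷-injective eq)
  usedVec-replicate⁻¹ (suc n) c a eq (suc j) (s≤s j<n) =
    usedVec-replicate⁻¹ n c (a ∘ suc) (proj₂ (∷-injective eq)) j j<n

  covered : Bool → (ℕ → Arm) → ℕ → Bool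
  covered p a j = fromLeft p a j ∨ isLeft (a j)

  coveredVec-not : ∀ n p q (a b : ℕ → Arm) → (∀ j → j ≤ n → covered p a j ≡ not (covered q b j)) →
    coveredVec n p a ≡ map not (coveredVec n q b)
  coveredVec-not zero    p q a b h = cong (_∷ []) (h 0 z≤n)
  coveredVec-not (suc n) p q a b h = cong₂ _∷_ (h 0 z≤n)
    (coveredVec-not n (isRight (a 0)) (isRight (b 0)) (a ∘ suc) (b ∘ suc)
      λ { zero j≤n → h 1 (s≤s j≤n) ; (suc j) j≤n → h (suc (suc j)) (s≤s j≤n) })

  coveredVec-not⁻¹ : ∀ n p q (a b : ℕ → Arm) → coveredVec n p a ≡ map not (coveredVec n q b) →
    ∀ j → j ≤ n → covered p a j ≡ not (covered q b j)
  coveredVec-not⁻¹ zero    p q a b eq zero    _         = proj₁ (∷-injective eq)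
  coveredVec-not⁻¹ (suc n) p q a b eq zero    _         = proj₁ (∷-injective eq)
  coveredVec-not⁻¹ (suc n) p q a b eq (suc zero)    (s≤s j≤n) =
    coveredVec-not⁻¹ n (isRight (a 0)) (isRight (b 0)) (a ∘ suc) (b ∘ suc) (proj₂ (∷-injective eq)) zero j≤n
  coveredVec-not⁻¹ (suc n) p q a b eq (suc (suc j)) (s≤s j≤n) =
    coveredVec-not⁻¹ n (isRight (a 0)) (isRight (b 0)) (a ∘ suc) (b ∘ suc) (proj₂ (∷-injective eq)) (suc j) j≤n

  lower upper : ∀ k {x : Vec Bool n} → Chain k x → ℕ → ℕ → Arm
  lower zero    c                       r       = λ _ → idle
  lower (suc k) {x} (y , (U , _) , c)   zero    = arm false x U
  lower (suc k) (y , (U , _) , c)       (suc r) = lower k c r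
  upper zero    c                       r       = λ _ → idle
  upper (suc k) (y , (U , _) , c)       zero    = arm false y (map not U)
  upper (suc k) (y , (U , _) , c)       (suc r) = upper k c r

  -- A chain stripped of its dependent types: families of arms under local conditions. As the arms
  -- are functions on all of ℕ, they are required to be idle outside the region; `l-end` concerns
  -- the last black row, which has no white row above it.
  record Compatible (n k : ℕ) (l u : ℕ → ℕ → Arm) : Set where
    field
      l-¬clash  : ∀ r j → r < k → Clash false (l r) j → ⊥
      u-¬clash  : ∀ r j → r < k → Clash false (u r) j → ⊥
      l-outside : ∀ r j → r < k → n ≤ j → l r j ≡ idle
      u-outside : ∀ r j → r < k → n ≤ j → u r j ≡ idle
      l-end     : ∀ j → l k j ≡ idle
      white     : ∀ r → r < k → coveredVec n false (u r) ≡ map not (coveredVec n false (l r))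
      black     : ∀ r → r < k → usedVec n (l (suc r)) ≡ map not (usedVec n (u r))

  open Compatible

  lower-used : ∀ k {x : Vec Bool n} (c : Chain k x) → usedVec n (lower k c 0) ≡ x
  lower-used {n} zero    {x} c = sym (none⇒ n x c)
    where
    none⇒ : ∀ n (x : Vec Bool n) → T (none x) → x ≡ usedVec n (λ _ → idle)
    none⇒ zero    []          _ = refl
    none⇒ (suc n) (false ∷ x) t = cong (false ∷_) (none⇒ n x t)
  lower-used (suc k) {x} (y , (U , _) , c) = usedVec-arm false x U

  compatible : ∀ k {x : Vec Bool n} (c : Chain k x) → Compatible n k (lower k c) (upper k c)
  compatible zero c = record
    { l-¬clash = λ r j () ; u-¬clash = λ r j () ; l-outside = λ r j () ; u-outside = λ r j ()
    ; l-end = λ j → refl ; white = λ r () ; black = λ r () }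
  compatible {n} (suc k) {x} (y , (U , z , z′) , c) = record
    { l-¬clash  = λ { zero j _ → arm-clash false x U j ; (suc r) j (s≤s r<k) → l-¬clash C r j r<k }
    ; u-¬clash  = λ { zero j _ → arm-clash false y (map not U) j ; (suc r) j (s≤s r<k) → u-¬clash C r j r<k }
    ; l-outside = λ { zero j _ n≤j → arm-outside false x U n≤j ; (suc r) j (s≤s r<k) → l-outside C r j r<k }
    ; u-outside = λ { zero j _ n≤j → arm-outside false y (map not U) n≤j
                    ; (suc r) j (s≤s r<k) → u-outside C r j r<k }
    ; l-end     = l-end C
    ; white     = λ { zero _ → trans (coveredVec-arm false y (map not U) z′)
                                     (cong (map not) (sym (coveredVec-arm false x U z)))
                    ; (suc r) (s≤s r<k) → white C r r<k }
    ; black     = λ { zero _ → trans (lower-used k c) (cong (map not) (sym (usedVec-arm false y (map not U))))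
                    ; (suc r) (s≤s r<k) → black C r r<k }
    }
    where
    C = compatible k c

  chain : ∀ k {x : Vec Bool n} l u → Compatible n k l u → usedVec n (l 0) ≡ x → Chain k x
  chain {n} zero    l u C refl = idle⇒none n (l 0) (l-end C)
    where
    idle⇒none : ∀ n a → (∀ j → a j ≡ idle) → T (none (usedVec n a))
    idle⇒none zero    a h = tt
    idle⇒none (suc n) a h rewrite h 0 = idle⇒none n (a ∘ suc) (h ∘ suc)
  chain {n} (suc k) l u C refl =
    usedVec n (u 0) ,
    (coveredVec n false (l 0) ,
      zig-vec n false (l 0) (λ j → l-¬clash C 0 j (s≤s z≤n)) (l-outside C 0 n (s≤s z≤n) ≤-refl) ,
      subst (λ V → T (zig false (usedVec n (u 0)) V)) (white C 0 (s≤s z≤n))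
        (zig-vec n false (u 0) (λ j → u-¬clash C 0 j (s≤s z≤n)) (u-outside C 0 n (s≤s z≤n) ≤-refl))) ,
    chain k (l ∘ suc) (u ∘ suc) (record
      { l-¬clash  = λ r j r<k → l-¬clash C (suc r) j (s≤s r<k)
      ; u-¬clash  = λ r j r<k → u-¬clash C (suc r) j (s≤s r<k)
      ; l-outside = λ r j r<k → l-outside C (suc r) j (s≤s r<k)
      ; u-outside = λ r j r<k → u-outside C (suc r) j (s≤s r<k)
      ; l-end     = l-end C
      ; white     = λ r r<k → white C (suc r) (s≤s r<k)
      ; black     = λ r r<k → black C (suc r) (s≤s r<k)
      }) (black C 0 (s≤s z≤n))

  lower-chain : ∀ k {x : Vec Bool n} l u C (eq : usedVec n (l 0) ≡ x) →
    ∀ r j → r < k → lower k (chain k l u C eq) r j ≡ l r j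
  lower-chain {n} (suc k) l u C refl zero    j _         =
    arm-vec n false (l 0) (λ j → l-¬clash C 0 j (s≤s z≤n)) (λ j → l-outside C 0 j (s≤s z≤n)) j
  lower-chain (suc k) l u C refl (suc r) j (s≤s r<k) = lower-chain k (l ∘ suc) (u ∘ suc) _ _ r j r<k

  upper-chain : ∀ k {x : Vec Bool n} l u C (eq : usedVec n (l 0) ≡ x) →
    ∀ r j → r < k → upper k (chain k l u C eq) r j ≡ u r j
  upper-chain {n} (suc k) l u C refl zero    j _         =
    trans (cong (λ V → arm false (usedVec n (u 0)) V j) (sym (white C 0 (s≤s z≤n))))
      (arm-vec n false (u 0) (λ j → u-¬clash C 0 j (s≤s z≤n)) (λ j → u-outside C 0 j (s≤s z≤n)) j)
  upper-chain (suc k) l u C refl (suc r) j (s≤s r<k) = upper-chain k (l ∘ suc) (u ∘ suc) _ _ r j r<k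

  -- The arms give back `U` as the covered squares and `y` as the used ones; the other components
  -- are a shorter chain and proofs of Boolean statements.
  chain-injective : ∀ k {x : Vec Bool n} (c d : Chain k x) →
    (∀ r j → lower k c r j ≡ lower k d r j) → (∀ r j → upper k c r j ≡ upper k d r j) → c ≡ d
  chain-injective zero c d _ _ = T-irrelevant c d
  chain-injective {n} (suc k) {x} (y , (U , z , z′) , c) (v , (V , w , w′) , d) l≗ u≗
    with refl ← trans (sym (coveredVec-arm false x U z))
                  (trans (coveredVec-cong n false (l≗ 0)) (coveredVec-arm false x V w))
    with refl ← trans (sym (usedVec-arm false y (map not U)))
                  (trans (usedVec-cong n (u≗ 0)) (usedVec-arm false v (map not U)))
    rewrite T-irrelevant z w | T-irrelevant z′ w′ | chain-injective k c d (l≗ ∘ suc) (u≗ ∘ suc) = refl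

-- Perfect matchings as bits on the edges of a square array of cells.

module Configurations where

  open import Data.Bool.Base using (Bool; true; false; not; _∧_; _∨_; T)
  open import Data.Bool.Properties using (¬-not)
  open import Data.Empty using (⊥; ⊥-elim)
  open import Data.Maybe.Base using (Maybe; just; nothing; maybe)
  open import Data.Nat.Base using (ℕ; zero; suc; _+_; _≤_; _<_; z≤n; s≤s)
  open import Data.Nat.Properties using (<⇒≤; <-irrefl; <⇒≱; ≮⇒≥; _<?_)
  open import Data.Product.Base using (_×_; _,_; proj₁; ∃-syntax; uncurry)
  open import Data.Unit.Base using (tt)
  open import Data.Vec.Base using (replicate)
  open import Function.Base using (_∘_)
  open import Relation.Binary.PropositionalEquality
  open import Relation.Nullary.Decidable using (Dec; yes; no)
  open import Relation.Nullary.Negation using (¬_)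
  open ZigzagCount using (⟦_⟧)
  open RowCodes

  -- The four edges of the cell in row r and column j, joining its lower black
  -- square black r j or its upper black square black (suc r) j to its left
  -- white square white r j or its right white square white r (suc j).
  data Kind : Set where
    lowerLeft lowerRight upperLeft upperRight : Kind

  data Site : Set where
    black white : ℕ → ℕ → Site

  -- A square has at most one edge of each kind, so the kind alone names an edge there. `nothing`
  -- stands for a cell with a negative index; cells beyond the other two sides are ruled out by
  -- `outside` in `IsConfig`.
  at : Site → Kind → Maybe (ℕ × ℕ)
  at (black r       j)       lowerLeft  = just (r , j)
  at (black r       j)       lowerRight = just (r , j)
  at (black zero    j)       upperLeft  = nothing
  at (black (suc r) j)       upperLeft  = just (r , j)
  at (black zero    j)       upperRight = nothing
  at (black (suc r) j)       upperRight = just (r , j)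
  at (white r       j)       lowerLeft  = just (r , j)
  at (white r       zero)    lowerRight = nothing
  at (white r       (suc j)) lowerRight = just (r , j)
  at (white r       j)       upperLeft  = just (r , j)
  at (white r       zero)    upperRight = nothing
  at (white r       (suc j)) upperRight = just (r , j)

  Valid : ℕ → Site → Set
  Valid n (black r j) = r ≤ n × j < n
  Valid n (white r j) = r < n × j ≤ n

  Bits : Set
  Bits = Kind → ℕ → ℕ → Bool

  bitAt : Bits → Site → Kind → Bool
  bitAt b q κ = maybe (uncurry (b κ)) false (at q κ)

  One : (Kind → Bool) → Set
  One f = ⟦ f lowerLeft ⟧ + ⟦ f lowerRight ⟧ + ⟦ f upperLeft ⟧ + ⟦ f upperRight ⟧ ≡ 1

  record IsConfig (n : ℕ) (b : Bits) : Set where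
    field
      outside : ∀ κ r j → b κ r j ≡ true → r < n × j < n
      one     : ∀ q → Valid n q → One (bitAt b q)

  open IsConfig

  One-unique : ∀ {f} → One f → ∀ κ κ′ → f κ ≡ true → f κ′ ≡ true → κ ≡ κ′
  One-unique {f} o = unique (f lowerLeft) (f lowerRight) (f upperLeft) (f upperRight) refl refl refl refl o
    where
    unique : ∀ a b c d → f lowerLeft ≡ a → f lowerRight ≡ b → f upperLeft ≡ c → f upperRight ≡ d →
      ⟦ a ⟧ + ⟦ b ⟧ + ⟦ c ⟧ + ⟦ d ⟧ ≡ 1 → ∀ κ κ′ → f κ ≡ true → f κ′ ≡ true → κ ≡ κ′
    only : ∀ κ₀ → (∀ κ → κ ≢ κ₀ → f κ ≡ false) → ∀ κ κ′ → f κ ≡ true → f κ′ ≡ true → κ ≡ κ′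
    unique true  false false false _ p q r _ = only lowerLeft λ
      { lowerLeft ne → ⊥-elim (ne refl) ; lowerRight _ → p ; upperLeft _ → q ; upperRight _ → r }
    unique false true  false false p _ q r _ = only lowerRight λ
      { lowerLeft _ → p ; lowerRight ne → ⊥-elim (ne refl) ; upperLeft _ → q ; upperRight _ → r }
    unique false false true  false p q _ r _ = only upperLeft λ
      { lowerLeft _ → p ; lowerRight _ → q ; upperLeft ne → ⊥-elim (ne refl) ; upperRight _ → r }
    unique false false false true  p q r _ _ = only upperRight λ
      { lowerLeft _ → p ; lowerRight _ → q ; upperLeft _ → r ; upperRight ne → ⊥-elim (ne refl) }
    unique false false false false _ _ _ _ ()
    unique true  true  c     d     _ _ _ _ ()
    unique true  false true  d     _ _ _ _ ()
    unique true  false false true  _ _ _ _ ()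
    unique false true  true  d     _ _ _ _ ()
    unique false true  false true  _ _ _ _ ()
    unique false false true  true  _ _ _ _ ()
    _≟κ_ : ∀ (κ κ′ : Kind) → Dec (κ ≡ κ′)
    lowerLeft  ≟κ lowerLeft  = yes refl
    lowerLeft  ≟κ lowerRight = no λ ()
    lowerLeft  ≟κ upperLeft  = no λ ()
    lowerLeft  ≟κ upperRight = no λ ()
    lowerRight ≟κ lowerLeft  = no λ ()
    lowerRight ≟κ lowerRight = yes refl
    lowerRight ≟κ upperLeft  = no λ ()
    lowerRight ≟κ upperRight = no λ ()
    upperLeft  ≟κ lowerLeft  = no λ ()
    upperLeft  ≟κ lowerRight = no λ ()
    upperLeft  ≟κ upperLeft  = yes refl
    upperLeft  ≟κ upperRight = no λ ()
    upperRight ≟κ lowerLeft  = no λ ()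
    upperRight ≟κ lowerRight = no λ ()
    upperRight ≟κ upperLeft  = no λ ()
    upperRight ≟κ upperRight = yes refl
    only κ₀ others κ κ′ p q with κ ≟κ κ₀ | κ′ ≟κ κ₀
    ... | yes refl | yes refl = refl
    ... | no ne    | _ with () ← trans (sym p) (others κ ne)
    ... | yes _    | no ne with () ← trans (sym q) (others κ′ ne)

  One-total : ∀ {f} → One f → ∃[ κ ] f κ ≡ true
  One-total {f} o = total (f lowerLeft) (f lowerRight) (f upperLeft) (f upperRight) refl refl refl refl o
    where
    total : ∀ a b c d → f lowerLeft ≡ a → f lowerRight ≡ b → f upperLeft ≡ c → f upperRight ≡ d →
      ⟦ a ⟧ + ⟦ b ⟧ + ⟦ c ⟧ + ⟦ d ⟧ ≡ 1 → ∃[ κ ] f κ ≡ true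
    total true  b     c     d    p q r s _ = lowerLeft , p
    total false true  c     d    p q r s _ = lowerRight , q
    total false false true  d    p q r s _ = upperLeft , r
    total false false false true p q r s _ = upperRight , s
    total false false false false p q r s ()

  One-intro : ∀ f → ∃[ κ ] f κ ≡ true → (∀ κ κ′ → f κ ≡ true → f κ′ ≡ true → κ ≡ κ′) → One f
  One-intro f (κ₀ , p) unique = go κ₀ p
    where
    others : ∀ {κ₀ κ} → f κ₀ ≡ true → κ ≢ κ₀ → f κ ≡ false
    others p ne = ¬-not λ q → ne (unique _ _ q p)
    go : ∀ κ → f κ ≡ true → One f
    go lowerLeft  p rewrite p | others {κ = lowerRight} p (λ ()) | others {κ = upperLeft} p (λ ())
                            | others {κ = upperRight} p (λ ()) = refl
    go lowerRight p rewrite p | others {κ = lowerLeft} p (λ ()) | others {κ = upperLeft} p (λ ())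
                            | others {κ = upperRight} p (λ ()) = refl
    go upperLeft  p rewrite p | others {κ = lowerLeft} p (λ ()) | others {κ = lowerRight} p (λ ())
                            | others {κ = upperRight} p (λ ()) = refl
    go upperRight p rewrite p | others {κ = lowerLeft} p (λ ()) | others {κ = lowerRight} p (λ ())
                            | others {κ = upperLeft} p (λ ()) = refl

  bits : ∀ n → Code n → Bits
  bits n c lowerLeft  r j = isLeft  (lower n c r j)
  bits n c lowerRight r j = isRight (lower n c r j)
  bits n c upperLeft  r j = isLeft  (upper n c r j)
  bits n c upperRight r j = isRight (upper n c r j)

  bits-injective : ∀ {n} (c d : Code n) → (∀ κ r j → bits n c κ r j ≡ bits n d κ r j) → c ≡ d
  bits-injective {n} c d eq = chain-injective n c d
    (λ r j → Arm-ext (eq lowerLeft r j) (eq lowerRight r j))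
    (λ r j → Arm-ext (eq upperLeft r j) (eq upperRight r j))

  lower-beyond : ∀ {n} k {x} (c : Chain {n} k x) {r} j → k ≤ r → lower k c r j ≡ idle
  lower-beyond zero    c                 j _         = refl
  lower-beyond (suc k) (_ , (_ , _) , c) j (s≤s k≤r) = lower-beyond k c j k≤r

  upper-beyond : ∀ {n} k {x} (c : Chain {n} k x) {r} j → k ≤ r → upper k c r j ≡ idle
  upper-beyond zero    c                 j _         = refl
  upper-beyond (suc k) (_ , (_ , _) , c) j (s≤s k≤r) = upper-beyond k c j k≤r

  private

    not-idle : ∀ {n a} r j → (n ≤ r → a ≡ idle) → (r < n → n ≤ j → a ≡ idle) → a ≢ idle → r < n × j < n
    not-idle {n} r j h h′ a≢idle with r <? n | j <? n
    ... | yes r<n | yes j<n = r<n , j<n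
    ... | no r≮n  | _       = ⊥-elim (a≢idle (h (≮⇒≥ r≮n)))
    ... | yes r<n | no j≮n  = ⊥-elim (a≢idle (h′ r<n (≮⇒≥ j≮n)))

    left≢idle : ∀ {a} → isLeft a ≡ true → a ≢ idle
    left≢idle () refl

    right≢idle : ∀ {a} → isRight a ≡ true → a ≢ idle
    right≢idle () refl

    black-sum : ∀ a b → used a ≡ not (used b) →
      ⟦ isLeft a ⟧ + ⟦ isRight a ⟧ + ⟦ isLeft b ⟧ + ⟦ isRight b ⟧ ≡ 1
    black-sum idle  left  _ = refl
    black-sum idle  right _ = refl
    black-sum left  idle  _ = refl
    black-sum right idle  _ = refl
    black-sum idle  idle  ()
    black-sum left  left  ()
    black-sum left  right ()
    black-sum right left  ()
    black-sum right right ()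

    -- Two covers from the same row are a clash, and one from each row, or none at all, contradicts
    -- complementarity.
    white-sum : ∀ a p b q → ¬ T (p ∧ a) → ¬ T (q ∧ b) → q ∨ b ≡ not (p ∨ a) →
      ⟦ a ⟧ + ⟦ p ⟧ + ⟦ b ⟧ + ⟦ q ⟧ ≡ 1
    white-sum true  true  b     q     h _ _ = ⊥-elim (h tt)
    white-sum a     p     true  true  _ h _ = ⊥-elim (h tt)
    white-sum true  false false false _ _ _ = refl
    white-sum false true  false false _ _ _ = refl
    white-sum false false true  false _ _ _ = refl
    white-sum false false false true  _ _ _ = refl
    white-sum true  false true  false _ _ ()
    white-sum true  false false true  _ _ ()
    white-sum false true  true  false _ _ ()
    white-sum false true  false true  _ _ ()
    white-sum false false false false _ _ ()

    sum-not : ∀ a b c d → ⟦ a ⟧ + ⟦ b ⟧ + ⟦ c ⟧ + ⟦ d ⟧ ≡ 1 → a ∨ b ≡ not (c ∨ d)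
    sum-not true  false false false _ = refl
    sum-not false true  false false _ = refl
    sum-not false false true  d     _ = refl
    sum-not false false false true  _ = refl
    sum-not true  true  c     d     ()
    sum-not true  false true  d     ()
    sum-not true  false false true  ()
    sum-not false true  true  d     ()
    sum-not false true  false true  ()

    sum-not′ : ∀ a b c d → ⟦ a ⟧ + ⟦ b ⟧ + ⟦ c ⟧ + ⟦ d ⟧ ≡ 1 → d ∨ c ≡ not (b ∨ a)
    sum-not′ true  false false false _ = refl
    sum-not′ false true  false false _ = refl
    sum-not′ false false true  false _ = refl
    sum-not′ false false false true  _ = refl
    sum-not′ true  true  c     d     ()
    sum-not′ true  false true  d     ()
    sum-not′ true  false false true  ()
    sum-not′ false true  true  d     ()
    sum-not′ false true  false true  ()

  bits-config : ∀ {n} (c : Code n) → IsConfig n (bits n c)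
  bits-config {n} c = record { outside = out ; one = ones }
    where
    open Compatible (compatible n c)
    out : ∀ κ r j → bits n c κ r j ≡ true → r < n × j < n
    out lowerLeft  r j eq = not-idle r j (lower-beyond n c j) (l-outside r j) (left≢idle eq)
    out lowerRight r j eq = not-idle r j (lower-beyond n c j) (l-outside r j) (right≢idle eq)
    out upperLeft  r j eq = not-idle r j (upper-beyond n c j) (u-outside r j) (left≢idle eq)
    out upperRight r j eq = not-idle r j (upper-beyond n c j) (u-outside r j) (right≢idle eq)
    ones : ∀ q → Valid n q → One (bitAt (bits n c) q)
    -- No cell lies below the first black row; an idle arm replaces the missing one.
    ones (black zero    j) (_ , j<n)   = black-sum (lower n c 0 j) idle
      (usedVec-replicate⁻¹ n true (lower n c 0) (lower-used n c) j j<n)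
    ones (black (suc r) j) (r<n , j<n) = black-sum (lower n c (suc r) j) (upper n c r j)
      (usedVec-not⁻¹ n (lower n c (suc r)) (upper n c r) (Compatible.black (compatible n c) r r<n) j j<n)
    ones (white r zero)    (r<n , j≤n) = white-sum (isLeft (lower n c r 0)) false (isLeft (upper n c r 0)) false
      (l-¬clash r 0 r<n) (u-¬clash r 0 r<n)
      (coveredVec-not⁻¹ n false false (upper n c r) (lower n c r) (Compatible.white (compatible n c) r r<n) 0 j≤n)
    ones (white r (suc j)) (r<n , j≤n) =
      white-sum (isLeft (lower n c r (suc j))) (isRight (lower n c r j))
                (isLeft (upper n c r (suc j))) (isRight (upper n c r j))
        (l-¬clash r (suc j) r<n) (u-¬clash r (suc j) r<n)
        (coveredVec-not⁻¹ n false false (upper n c r) (lower n c r) (Compatible.white (compatible n c) r r<n) (suc j) j≤n)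

  -- Two set bits never occur together in a configuration; the value `left` for them is arbitrary.
  toArm : Bool → Bool → Arm
  toArm true  _     = left
  toArm false true  = right
  toArm false false = idle

  isLeft-toArm : ∀ a b → isLeft (toArm a b) ≡ a
  isLeft-toArm true  _     = refl
  isLeft-toArm false true  = refl
  isLeft-toArm false false = refl

  isRight-toArm : ∀ a b → (a ≡ true → b ≡ true → ⊥) → isRight (toArm a b) ≡ b
  isRight-toArm true  true  h = ⊥-elim (h refl refl)
  isRight-toArm true  false _ = refl
  isRight-toArm false true  _ = refl
  isRight-toArm false false _ = refl

  used-toArm : ∀ a b → used (toArm a b) ≡ a ∨ b
  used-toArm true  _     = refl
  used-toArm false true  = refl
  used-toArm false false = refl

  module _ {n : ℕ} (b : Bits) (config : IsConfig n b) where

    private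

      false-outside : ∀ κ r j → ¬ (r < n × j < n) → b κ r j ≡ false
      false-outside κ r j h = ¬-not (h ∘ outside config κ r j)

      l u : ℕ → ℕ → Arm
      l r j = toArm (b lowerLeft r j) (b lowerRight r j)
      u r j = toArm (b upperLeft r j) (b upperRight r j)

      l-exclusive : ∀ r j → b lowerLeft r j ≡ true → b lowerRight r j ≡ true → ⊥
      l-exclusive r j p q with r<n , j<n ← outside config lowerLeft r j p
        with () ← One-unique {bitAt b (black r j)} (one config (black r j) (<⇒≤ r<n , j<n))
                    lowerLeft lowerRight p q

      u-exclusive : ∀ r j → b upperLeft r j ≡ true → b upperRight r j ≡ true → ⊥
      u-exclusive r j p q with r<n , j<n ← outside config upperLeft r j p
        with () ← One-unique {bitAt b (black (suc r) j)} (one config (black (suc r) j) (r<n , j<n))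
                    upperLeft upperRight p q

      isRight-l : ∀ r j → isRight (l r j) ≡ b lowerRight r j
      isRight-l r j = isRight-toArm _ _ (l-exclusive r j)

      isRight-u : ∀ r j → isRight (u r j) ≡ b upperRight r j
      isRight-u r j = isRight-toArm _ _ (u-exclusive r j)

      isLeft-l : ∀ r j → isLeft (l r j) ≡ b lowerLeft r j
      isLeft-l r j = isLeft-toArm _ (b lowerRight r j)

      isLeft-u : ∀ r j → isLeft (u r j) ≡ b upperLeft r j
      isLeft-u r j = isLeft-toArm _ (b upperRight r j)

      ∧-true : ∀ {x y} → T (x ∧ y) → x ≡ true × y ≡ true
      ∧-true {true} {true} _ = refl , refl

      l-no-clash : ∀ r j → ¬ Clash false (l r) j
      l-no-clash r zero ()
      l-no-clash r (suc j) t with p , q ← ∧-true (subst₂ (λ x y → T (x ∧ y)) (isRight-l r j) (isLeft-l r (suc j)) t)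
        with r<n , j<n ← outside config lowerRight r j p
        with () ← One-unique {bitAt b (white r (suc j))} (one config (white r (suc j)) (r<n , j<n))
                    lowerRight lowerLeft p q

      u-no-clash : ∀ r j → ¬ Clash false (u r) j
      u-no-clash r zero ()
      u-no-clash r (suc j) t with p , q ← ∧-true (subst₂ (λ x y → T (x ∧ y)) (isRight-u r j) (isLeft-u r (suc j)) t)
        with r<n , j<n ← outside config upperRight r j p
        with () ← One-unique {bitAt b (white r (suc j))} (one config (white r (suc j)) (r<n , j<n))
                    upperRight upperLeft p q

      l-idle : ∀ r j → ¬ (r < n × j < n) → l r j ≡ idle
      l-idle r j h rewrite false-outside lowerLeft r j h | false-outside lowerRight r j h = refl

      u-idle : ∀ r j → ¬ (r < n × j < n) → u r j ≡ idle
      u-idle r j h rewrite false-outside upperLeft r j h | false-outside upperRight r j h = refl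

      whites : ∀ r → r < n → ∀ j → j ≤ n → covered false (u r) j ≡ not (covered false (l r) j)
      whites r r<n zero    j≤n rewrite isLeft-u r 0 | isLeft-l r 0 =
        sum-not′ (b lowerLeft r 0) false (b upperLeft r 0) false (one config (white r 0) (r<n , j≤n))
      whites r r<n (suc j) j≤n rewrite isLeft-u r (suc j) | isLeft-l r (suc j) | isRight-u r j | isRight-l r j =
        sum-not′ (b lowerLeft r (suc j)) (b lowerRight r j) (b upperLeft r (suc j)) (b upperRight r j)
          (one config (white r (suc j)) (r<n , j≤n))

      blacks : ∀ r → r < n → ∀ j → j < n → used (l (suc r) j) ≡ not (used (u r j))
      blacks r r<n j j<n = trans (used-toArm (b lowerLeft (suc r) j) (b lowerRight (suc r) j))
        (trans (sum-not (b lowerLeft (suc r) j) (b lowerRight (suc r) j) (b upperLeft r j) (b upperRight r j)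
                 (one config (black (suc r) j) (r<n , j<n)))
               (cong not (sym (used-toArm (b upperLeft r j) (b upperRight r j)))))

      first : ∀ j → j < n → used (l 0 j) ≡ true
      first j j<n = trans (used-toArm (b lowerLeft 0 j) (b lowerRight 0 j))
        (sum-not (b lowerLeft 0 j) (b lowerRight 0 j) false false (one config (black 0 j) (z≤n , j<n)))

      arms-compatible : Compatible n n l u
      arms-compatible = record
        { l-¬clash  = λ r j _ → l-no-clash r j
        ; u-¬clash  = λ r j _ → u-no-clash r j
        ; l-outside = λ r j _ n≤j → l-idle r j λ { (_ , j<n) → <⇒≱ j<n n≤j }
        ; u-outside = λ r j _ n≤j → u-idle r j λ { (_ , j<n) → <⇒≱ j<n n≤j }
        ; l-end     = λ j → l-idle n j λ { (n<n , _) → <-irrefl refl n<n }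
        ; white     = λ r r<n → coveredVec-not n false false (u r) (l r) (whites r r<n)
        ; black     = λ r r<n → usedVec-not n (l (suc r)) (u r) (blacks r r<n)
        }

      start : usedVec n (l 0) ≡ replicate n true
      start = usedVec-replicate n true (l 0) first

    code : Code n
    code = chain n l u arms-compatible start

    private
      lower-code : ∀ r j → lower n code r j ≡ l r j
      lower-code r j with r <? n
      ... | yes r<n = lower-chain n l u arms-compatible start r j r<n
      ... | no  r≮n = trans (lower-beyond n code j (≮⇒≥ r≮n)) (sym (l-idle r j (r≮n ∘ proj₁)))

      upper-code : ∀ r j → upper n code r j ≡ u r j
      upper-code r j with r <? n
      ... | yes r<n = upper-chain n l u arms-compatible start r j r<n
      ... | no  r≮n = trans (upper-beyond n code j (≮⇒≥ r≮n)) (sym (u-idle r j (r≮n ∘ proj₁)))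

    bits-code : ∀ κ r j → bits n code κ r j ≡ b κ r j
    bits-code lowerLeft  r j = trans (cong isLeft  (lower-code r j)) (isLeft-l r j)
    bits-code lowerRight r j = trans (cong isRight (lower-code r j)) (isRight-l r j)
    bits-code upperLeft  r j = trans (cong isLeft  (upper-code r j)) (isLeft-u r j)
    bits-code upperRight r j = trans (cong isRight (upper-code r j)) (isRight-u r j)

-- Squares in diagonal coordinates, and tilings as configurations.

module AztecTilings where

  open import Data.Bool.Base using (Bool; true; false)
  open import Data.Bool.Properties using (¬-not)
  open import Data.Empty using (⊥-elim)
  open import Data.Integer.Base using (ℤ; +_; -[1+_]; ∣_∣; _+_; _-_; _*_; -_; 0ℤ; 1ℤ)
  import Data.Integer.Properties as ℤ
  open import Data.Integer.Tactic.RingSolver using (solve-∀)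
  open import Data.List.Base using (List; []; _∷_)
  open import Data.List.Membership.Propositional using (_∈_)
  open import Data.List.Relation.Unary.All as All using (All; []; _∷_)
  open import Data.List.Relation.Unary.Any using (here; there)
  open import Data.Maybe.Base using (Maybe; just; nothing)
  open import Data.Nat.Base as ℕ using (ℕ; zero; suc; s≤s; z≤n; _≤_; _<_)
  import Data.Nat.Properties as ℕ
  open import Data.Product.Base using (_×_; _,_; proj₁; proj₂; ∃-syntax)
  open import Data.Sum.Base using (_⊎_; inj₁; inj₂)
  open import Defs
  open import Function.Bundles using (Inverse)
  open import Relation.Binary.PropositionalEquality
  open import Relation.Nullary.Decidable using (Dec; yes; no)
  open import Relation.Nullary.Negation using (¬_)
  open import Algebra.Properties.AbelianGroup ℤ.+-0-abelianGroup using () renaming (∙-cancelʳ to +-cancelʳ)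
  open HamburgerDeterminant using (power)
  open RowCodes using (Code; Code↔Fin)
  open Configurations

  ∣z∣≤N⇒ : ∀ z N → ∣ z ∣ ≤ N → ∃[ S ] (z + + N ≡ + S × S ≤ N ℕ.+ N)
  ∣z∣≤N⇒ (+ k)    N le = k ℕ.+ N , refl , ℕ.+-monoˡ-≤ N le
  ∣z∣≤N⇒ -[1+ k ] N le = N ℕ.∸ suc k , ℤ.⊖-≥ le , ℕ.≤-trans (ℕ.m∸n≤m N (suc k)) (ℕ.m≤m+n N N)

  -- The left-hand side is the largest of the four values of `±x ± y`. For `x ≥ 0` an upper bound on
  -- the sum or difference suffices; for `x < 0` a lower bound is needed, and it is contained in the
  -- shifted value being a natural number.
  ∣x∣+∣y∣≤N : ∀ x y N {S D} → x + y + + N ≡ + S → x - y + + N ≡ + D → S ≤ N ℕ.+ N → D ≤ N ℕ.+ N →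
    ∣ x ∣ ℕ.+ ∣ y ∣ ≤ N
  ∣x∣+∣y∣≤N (+ p)    (+ q)    N eq _ S≤ _ = ℕ.+-cancelʳ-≤ N _ _ (subst (_≤ N ℕ.+ N) (sym (ℤ.+-injective eq)) S≤)
  ∣x∣+∣y∣≤N (+ p)    -[1+ q ] N _ eq _ D≤ = ℕ.+-cancelʳ-≤ N _ _ (subst (_≤ N ℕ.+ N) (sym (ℤ.+-injective eq)) D≤)
  ∣x∣+∣y∣≤N -[1+ p ] (+ q)    N {D = D} _ eq _ _ = subst (suc p ℕ.+ q ≤_)
    (ℤ.+-injective (trans (cong (λ z → + suc p + + q + z) (sym eq)) (lemma (+ suc p) (+ q) (+ N)))) (ℕ.m≤m+n _ D)
    where
    lemma : ∀ x y N → x + y + (- x - y + N) ≡ N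
    lemma = solve-∀
  ∣x∣+∣y∣≤N -[1+ p ] -[1+ q ] N {S} eq _ _ _ = subst (suc p ℕ.+ suc q ≤_)
    (ℤ.+-injective (trans (cong (λ z → + suc p + + suc q + z) (sym eq)) (lemma (+ suc p) (+ suc q) (+ N)))) (ℕ.m≤m+n _ S)
    where
    lemma : ∀ x y N → x + y + (- x + - y + N) ≡ N
    lemma = solve-∀

  2z≢1 : ∀ z → + 2 * z ≢ 1ℤ
  2z≢1 z eq = ℕ.even≢odd ∣ z ∣ 0 (trans (sym (ℤ.abs-* (+ 2) z)) (cong ∣_∣ eq))

  parity : ∀ m → ∃[ k ] (m ≡ 2 ℕ.* k ⊎ m ≡ suc (2 ℕ.* k))
  parity zero    = 0 , inj₁ refl
  parity (suc m) with parity m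
  ... | k , inj₁ eq = k , inj₂ (cong suc eq)
  ... | k , inj₂ eq = suc k , inj₁ (trans (cong suc eq) (sym (ℕ.*-suc 2 k)))

  module _ (n : ℕ) where

    -- The diagonal coordinates of a square, shifted so that AD n becomes the
    -- set of squares with both coordinates between 0 and 2n.
    record Diagonal (z : Square) (s d : ℕ) : Set where
      constructor diagonal
      field
        sum  : proj₁ z + proj₂ z + + suc n ≡ + s
        diff : proj₁ z - proj₂ z + + n ≡ + d

    2+2n : 2 ℕ.+ (n ℕ.+ n) ≡ suc n ℕ.+ suc n
    2+2n = cong suc (sym (ℕ.+-suc n n))

    -- Each bound comes from the corner that is extreme in its direction: the lower ones from the
    -- south-west and north-west corners, the upper ones from the north-east and south-east corners.
    AD⇒Diagonal : ∀ {z} → AD n z → ∃[ s ] ∃[ d ] (Diagonal z s d × s ≤ n ℕ.+ n × d ≤ n ℕ.+ n)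
    AD⇒Diagonal {a , b} (c₀₀ ∷ c₁₀ ∷ c₀₁ ∷ c₁₁ ∷ [])
      with s , s-eq , _   ← ∣z∣≤N⇒ (a + b) (suc n) (ℕ.≤-trans (ℤ.∣i+j∣≤∣i∣+∣j∣ a b) c₀₀)
         | d , d-eq , _   ← ∣z∣≤N⇒ (a - (b + 1ℤ)) (suc n) (ℕ.≤-trans (ℤ.∣i-j∣≤∣i∣+∣j∣ a (b + 1ℤ)) c₀₁)
         | S , S-eq , S≤  ← ∣z∣≤N⇒ (a + 1ℤ + (b + 1ℤ)) (suc n) (ℕ.≤-trans (ℤ.∣i+j∣≤∣i∣+∣j∣ (a + 1ℤ) (b + 1ℤ)) c₁₁)
         | D , D-eq , D≤  ← ∣z∣≤N⇒ (a + 1ℤ - b) (suc n) (ℕ.≤-trans (ℤ.∣i-j∣≤∣i∣+∣j∣ (a + 1ℤ) b) c₁₀) =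
      s , d , diagonal s-eq (trans (lemma a b (+ n)) d-eq) ,
      ℕ.+-cancelˡ-≤ 2 _ _ (subst₂ _≤_ (ℤ.+-injective S≡) (sym 2+2n) S≤) ,
      ℕ.+-cancelˡ-≤ 2 _ _ (subst₂ _≤_ (ℤ.+-injective D≡) (sym 2+2n) D≤)
      where
      lemma : ∀ a b n → a - b + n ≡ a - (b + 1ℤ) + (1ℤ + n)
      lemma = solve-∀
      S-lemma : ∀ a b n → a + 1ℤ + (b + 1ℤ) + n ≡ + 2 + (a + b + n)
      S-lemma = solve-∀
      D-lemma : ∀ a b n → a + 1ℤ - b + n ≡ + 2 + (a - (b + 1ℤ) + n)
      D-lemma = solve-∀
      S≡ : + S ≡ + (2 ℕ.+ s)
      S≡ = trans (sym S-eq) (trans (S-lemma a b (+ suc n)) (cong (λ z → + 2 + z) s-eq))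
      D≡ : + D ≡ + (2 ℕ.+ d)
      D≡ = trans (sym D-eq) (trans (D-lemma a b (+ suc n)) (cong (λ z → + 2 + z) d-eq))

    Diagonal⇒AD : ∀ {z s d} → Diagonal z s d → s ≤ n ℕ.+ n → d ≤ n ℕ.+ n → AD n z
    Diagonal⇒AD {a , b} {s} {d} (diagonal s-eq d-eq) s≤ d≤ =
      corner a b 0 1 (lemma₀₀ a b (+ n)) (lemma₀₀′ a b (+ n)) z≤n (s≤s z≤n) ∷
      corner (a + 1ℤ) b 1 2 (lemma₁₀ a b (+ n)) (lemma₁₀′ a b (+ n)) (s≤s z≤n) (s≤s (s≤s z≤n)) ∷
      corner a (b + 1ℤ) 1 0 (lemma₀₁ a b (+ n)) (lemma₀₁′ a b (+ n)) (s≤s z≤n) z≤n ∷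
      corner (a + 1ℤ) (b + 1ℤ) 2 1 (lemma₁₁ a b (+ n)) (lemma₁₁′ a b (+ n)) (s≤s (s≤s z≤n)) (s≤s z≤n) ∷ []
      where
      corner : ∀ x y e f → x + y + + suc n ≡ + e + (a + b + + suc n) → x - y + + suc n ≡ + f + (a - b + + n) →
        e ≤ 2 → f ≤ 2 → ∣ x ∣ ℕ.+ ∣ y ∣ ≤ suc n
      corner x y e f eq eq′ e≤2 f≤2 = ∣x∣+∣y∣≤N x y (suc n)
        (trans eq (cong (λ z → + e + z) s-eq)) (trans eq′ (cong (λ z → + f + z) d-eq))
        (ℕ.≤-trans (ℕ.+-mono-≤ e≤2 s≤) (ℕ.≤-reflexive 2+2n))
        (ℕ.≤-trans (ℕ.+-mono-≤ f≤2 d≤) (ℕ.≤-reflexive 2+2n))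
      lemma₀₀ : ∀ a b n → a + b + (1ℤ + n) ≡ 0ℤ + (a + b + (1ℤ + n))
      lemma₀₀ = solve-∀
      lemma₀₀′ : ∀ a b n → a - b + (1ℤ + n) ≡ 1ℤ + (a - b + n)
      lemma₀₀′ = solve-∀
      lemma₁₀ : ∀ a b n → a + 1ℤ + b + (1ℤ + n) ≡ 1ℤ + (a + b + (1ℤ + n))
      lemma₁₀ = solve-∀
      lemma₁₀′ : ∀ a b n → a + 1ℤ - b + (1ℤ + n) ≡ + 2 + (a - b + n)
      lemma₁₀′ = solve-∀
      lemma₀₁ : ∀ a b n → a + (b + 1ℤ) + (1ℤ + n) ≡ 1ℤ + (a + b + (1ℤ + n))
      lemma₀₁ = solve-∀
      lemma₀₁′ : ∀ a b n → a - (b + 1ℤ) + (1ℤ + n) ≡ 0ℤ + (a - b + n)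
      lemma₀₁′ = solve-∀
      lemma₁₁ : ∀ a b n → a + 1ℤ + (b + 1ℤ) + (1ℤ + n) ≡ + 2 + (a + b + (1ℤ + n))
      lemma₁₁ = solve-∀
      lemma₁₁′ : ∀ a b n → a + 1ℤ - (b + 1ℤ) + (1ℤ + n) ≡ 1ℤ + (a - b + n)
      lemma₁₁′ = solve-∀

    Diagonal-injective : ∀ {z z′ s d} → Diagonal z s d → Diagonal z′ s d → z ≡ z′
    Diagonal-injective {a , b} {a′ , b′} {s} {d} (diagonal p q) (diagonal p′ q′) = cong₂ _,_ a≡ b≡
      where
      lemma : ∀ a b n → a + b + (1ℤ + n) + (a - b + n) ≡ + 2 * a + (1ℤ + n + n)
      lemma = solve-∀
      2a : ∀ a b → a + b + + suc n ≡ + s → a - b + + n ≡ + d → + s + + d ≡ + 2 * a + (1ℤ + + n + + n)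
      2a a b p q = trans (sym (cong₂ _+_ p q)) (lemma a b (+ n))
      a≡ : a ≡ a′
      a≡ = ℤ.*-cancelˡ-≡ (+ 2) a a′ (+-cancelʳ (1ℤ + + n + + n) _ _ (trans (sym (2a a b p q)) (2a a′ b′ p′ q′)))
      lemma′ : ∀ a b n → a + b + n - (a + n) ≡ b
      lemma′ = solve-∀
      b≡ : b ≡ b′
      b≡ = trans (sym (lemma′ a b (+ suc n))) (trans
        (cong₂ (λ x y → x - (y + + suc n)) (trans p (sym p′)) a≡) (lemma′ a′ b′ (+ suc n)))

    position : Site → Square
    position (black r j) = + (r ℕ.+ j) - + n , + r - + j - 1ℤ
    position (white r j) = + (r ℕ.+ j) - + n , + r - + j

    sumKey diffKey : Site → ℕ
    sumKey  (black r j) = 2 ℕ.* r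
    sumKey  (white r j) = suc (2 ℕ.* r)
    diffKey (black r j) = suc (2 ℕ.* j)
    diffKey (white r j) = 2 ℕ.* j

    position-diagonal : ∀ q → Diagonal (position q) (sumKey q) (diffKey q)
    position-diagonal (black r j) = diagonal (lemma (+ r) (+ j) (+ n)) (lemma′ (+ r) (+ j) (+ n))
      where
      lemma : ∀ r j n → r + j - n + (r - j - 1ℤ) + (1ℤ + n) ≡ r + (r + 0ℤ)
      lemma = solve-∀
      lemma′ : ∀ r j n → r + j - n - (r - j - 1ℤ) + n ≡ 1ℤ + (j + (j + 0ℤ))
      lemma′ = solve-∀
    position-diagonal (white r j) = diagonal (lemma (+ r) (+ j) (+ n)) (lemma′ (+ r) (+ j) (+ n))
      where
      lemma : ∀ r j n → r + j - n + (r - j) + (1ℤ + n) ≡ 1ℤ + (r + (r + 0ℤ))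
      lemma = solve-∀
      lemma′ : ∀ r j n → r + j - n - (r - j) + n ≡ j + (j + 0ℤ)
      lemma′ = solve-∀

    keys-injective : ∀ q q′ → sumKey q ≡ sumKey q′ → diffKey q ≡ diffKey q′ → q ≡ q′
    keys-injective (black r j) (black r′ j′) p q =
      cong₂ black (ℕ.*-cancelˡ-≡ r r′ 2 p) (ℕ.*-cancelˡ-≡ j j′ 2 (ℕ.suc-injective q))
    keys-injective (black r j) (white r′ j′) p q = ⊥-elim (ℕ.even≢odd r r′ p)
    keys-injective (white r j) (black r′ j′) p q = ⊥-elim (ℕ.even≢odd r′ r (sym p))
    keys-injective (white r j) (white r′ j′) p q =
      cong₂ white (ℕ.*-cancelˡ-≡ r r′ 2 (ℕ.suc-injective p)) (ℕ.*-cancelˡ-≡ j j′ 2 q)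

    position-injective : ∀ {q q′} → position q ≡ position q′ → q ≡ q′
    position-injective {q} {q′} eq = keys-injective q q′
      (ℤ.+-injective (trans (sym (sum (position-diagonal q)))
        (trans (cong (λ z → proj₁ z + proj₂ z + + suc n) eq) (sum (position-diagonal q′)))))
      (ℤ.+-injective (trans (sym (diff (position-diagonal q)))
        (trans (cong (λ z → proj₁ z - proj₂ z + + n) eq) (diff (position-diagonal q′)))))
      where open Diagonal

    2n : n ℕ.+ n ≡ 2 ℕ.* n
    2n = cong (n ℕ.+_) (sym (ℕ.+-identityʳ n))

    private
      even≤ : ∀ {m} → m ≤ n → 2 ℕ.* m ≤ n ℕ.+ n
      even≤ {m} m≤n = subst (2 ℕ.* m ≤_) (sym 2n) (ℕ.*-monoʳ-≤ 2 m≤n)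

      odd≤ : ∀ {m} → m < n → suc (2 ℕ.* m) ≤ n ℕ.+ n
      odd≤ {m} m<n = ℕ.≤-trans (ℕ.n≤1+n _) (subst (_≤ n ℕ.+ n) (ℕ.*-suc 2 m) (even≤ m<n))

      even≤⁻¹ : ∀ {m} → 2 ℕ.* m ≤ n ℕ.+ n → m ≤ n
      even≤⁻¹ {m} le = ℕ.*-cancelˡ-≤ 2 (subst (2 ℕ.* m ≤_) 2n le)

      odd≤⁻¹ : ∀ {m} → suc (2 ℕ.* m) ≤ n ℕ.+ n → m < n
      odd≤⁻¹ {m} le = ℕ.*-cancelˡ-< 2 m n (subst (2 ℕ.* m <_) 2n le)

    position-AD : ∀ q → Valid n q → AD n (position q)
    position-AD (black r j) (r≤n , j<n) = Diagonal⇒AD (position-diagonal (black r j)) (even≤ r≤n) (odd≤ j<n)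
    position-AD (white r j) (r<n , j≤n) = Diagonal⇒AD (position-diagonal (white r j)) (odd≤ r<n) (even≤ j≤n)

    -- The diagonal coordinates differ by `2 b + 1`, so their parities are opposite, and the colour
    -- says which of them is even.
    locate : ∀ {z} → AD n z → ∃[ q ] (Valid n q × position q ≡ z)
    locate {a , b} ad with AD⇒Diagonal ad
    ... | s , d , D@(diagonal p q) , s≤ , d≤ with parity s | parity d
    ... | r , inj₁ refl | j , inj₂ refl = black r j , (even≤⁻¹ s≤ , odd≤⁻¹ d≤) ,
      Diagonal-injective (position-diagonal (black r j)) D
    ... | r , inj₂ refl | j , inj₁ refl = white r j , (odd≤⁻¹ s≤ , even≤⁻¹ d≤) ,
      Diagonal-injective (position-diagonal (white r j)) D
    ... | r , inj₁ refl | j , inj₁ refl = ⊥-elim (2z≢1 (+ r - + j - b) (trans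
      (trans (sym (lemma (+ r) (+ j) b)) (cong₂ (λ x y → x - y - + 2 * b) (sym p) (sym q))) (lemma′ a b (+ n))))
      where
      lemma : ∀ r j b → r + (r + 0ℤ) - (j + (j + 0ℤ)) - + 2 * b ≡ + 2 * (r - j - b)
      lemma = solve-∀
      lemma′ : ∀ a b n → a + b + (1ℤ + n) - (a - b + n) - + 2 * b ≡ 1ℤ
      lemma′ = solve-∀
    ... | r , inj₂ refl | j , inj₂ refl = ⊥-elim (2z≢1 (+ r - + j - b) (trans
      (trans (sym (lemma (+ r) (+ j) b)) (cong₂ (λ x y → x - y - + 2 * b) (sym p) (sym q))) (lemma′ a b (+ n))))
      where
      lemma : ∀ r j b → 1ℤ + (r + (r + 0ℤ)) - (1ℤ + (j + (j + 0ℤ))) - + 2 * b ≡ + 2 * (r - j - b)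
      lemma = solve-∀
      lemma′ : ∀ a b n → a + b + (1ℤ + n) - (a - b + n) - + 2 * b ≡ 1ℤ
      lemma′ = solve-∀

    AD-position : ∀ q → AD n (position q) → Valid n q
    AD-position q ad with q′ , valid , eq ← locate ad = subst (Valid n) (position-injective eq) valid

    edge : Kind → ℕ → ℕ → Domino
    edge lowerLeft  r j = vertical   (position (black r j))
    edge lowerRight r j = horizontal (position (black r j))
    edge upperLeft  r j = horizontal (position (white r j))
    edge upperRight r j = vertical   (position (white r (suc j)))

    first second : Kind → ℕ → ℕ → Site
    first lowerLeft   r j = black r j
    first lowerRight  r j = black r j
    first upperLeft   r j = white r j
    first upperRight  r j = white r (suc j)
    second lowerLeft  r j = white r j
    second lowerRight r j = white r (suc j)
    second upperLeft  r j = black (suc r) j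
    second upperRight r j = black (suc r) j

    squares-edge : ∀ κ r j → squares (edge κ r j) ≡ position (first κ r j) ∷ position (second κ r j) ∷ []
    squares-edge lowerLeft  r j =
      cong (λ y → position (black r j) ∷ (+ (r ℕ.+ j) - + n , y) ∷ []) (lemma (+ r) (+ j))
      where
      lemma : ∀ r j → r - j - 1ℤ + 1ℤ ≡ r - j
      lemma = solve-∀
    squares-edge lowerRight r j =
      cong₂ (λ x y → position (black r j) ∷ (x , y) ∷ []) (lemma (+ r) (+ j) (+ n)) (lemma′ (+ r) (+ j))
      where
      lemma : ∀ r j n → r + j - n + 1ℤ ≡ r + (1ℤ + j) - n
      lemma = solve-∀
      lemma′ : ∀ r j → r - j - 1ℤ ≡ r - (1ℤ + j)
      lemma′ = solve-∀
    squares-edge upperLeft  r j =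
      cong₂ (λ x y → position (white r j) ∷ (x , y) ∷ []) (lemma (+ r) (+ j) (+ n)) (lemma′ (+ r) (+ j))
      where
      lemma : ∀ r j n → r + j - n + 1ℤ ≡ 1ℤ + r + j - n
      lemma = solve-∀
      lemma′ : ∀ r j → r - j ≡ 1ℤ + r - j - 1ℤ
      lemma′ = solve-∀
    squares-edge upperRight r j =
      cong₂ (λ x y → position (white r (suc j)) ∷ (x , y) ∷ []) (lemma (+ r) (+ j) (+ n)) (lemma′ (+ r) (+ j))
      where
      lemma : ∀ r j n → r + (1ℤ + j) - n ≡ 1ℤ + r + j - n
      lemma = solve-∀
      lemma′ : ∀ r j → r - (1ℤ + j) + 1ℤ ≡ 1ℤ + r - j - 1ℤ
      lemma′ = solve-∀

    at-first : ∀ κ r j → at (first κ r j) κ ≡ just (r , j)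
    at-first lowerLeft  r j = refl
    at-first lowerRight r j = refl
    at-first upperLeft  r j = refl
    at-first upperRight r j = refl

    at-second : ∀ κ r j → at (second κ r j) κ ≡ just (r , j)
    at-second lowerLeft  r j = refl
    at-second lowerRight r j = refl
    at-second upperLeft  r j = refl
    at-second upperRight r j = refl

    at⇒end : ∀ q κ {r j} → at q κ ≡ just (r , j) → q ≡ first κ r j ⊎ q ≡ second κ r j
    at⇒end (black r       j)       lowerLeft  refl = inj₁ refl
    at⇒end (black r       j)       lowerRight refl = inj₁ refl
    at⇒end (black (suc r) j)       upperLeft  refl = inj₂ refl
    at⇒end (black (suc r) j)       upperRight refl = inj₂ refl
    at⇒end (white r       j)       lowerLeft  refl = inj₂ refl
    at⇒end (white r       (suc j)) lowerRight refl = inj₂ refl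
    at⇒end (white r       j)       upperLeft  refl = inj₁ refl
    at⇒end (white r       (suc j)) upperRight refl = inj₁ refl

    ∈-edge : ∀ q κ {r j} → at q κ ≡ just (r , j) → position q ∈ squares (edge κ r j)
    ∈-edge q κ {r} {j} eq with at⇒end q κ eq
    ... | inj₁ refl = subst (position q ∈_) (sym (squares-edge κ r j)) (here refl)
    ... | inj₂ refl = subst (position q ∈_) (sym (squares-edge κ r j)) (there (here refl))

    ∈-edge⁻¹ : ∀ q κ {r j} → position q ∈ squares (edge κ r j) → at q κ ≡ just (r , j)
    ∈-edge⁻¹ q κ {r} {j} q∈ with subst (position q ∈_) (squares-edge κ r j) q∈
    ... | here eq         rewrite position-injective {q} {first κ r j} eq  = at-first κ r j
    ... | there (here eq) rewrite position-injective {q} {second κ r j} eq = at-second κ r j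

    horizontal-injective : ∀ {z z′} → horizontal z ≡ horizontal z′ → z ≡ z′
    horizontal-injective refl = refl

    vertical-injective : ∀ {z z′} → vertical z ≡ vertical z′ → z ≡ z′
    vertical-injective refl = refl

    edge-injective : ∀ κ κ′ {r j r′ j′} → edge κ r j ≡ edge κ′ r′ j′ → κ ≡ κ′ × r ≡ r′ × j ≡ j′
    edge-injective lowerLeft  lowerLeft  {r} {j} {r′} {j′} eq
      with refl ← position-injective {black r j} {black r′ j′} (vertical-injective eq) = refl , refl , refl
    edge-injective lowerLeft  upperRight {r} {j} {r′} {j′} eq
      with () ← position-injective {black r j} {white r′ (suc j′)} (vertical-injective eq)
    edge-injective lowerRight lowerRight {r} {j} {r′} {j′} eq
      with refl ← position-injective {black r j} {black r′ j′} (horizontal-injective eq) = refl , refl , refl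
    edge-injective lowerRight upperLeft  {r} {j} {r′} {j′} eq
      with () ← position-injective {black r j} {white r′ j′} (horizontal-injective eq)
    edge-injective upperLeft  upperLeft  {r} {j} {r′} {j′} eq
      with refl ← position-injective {white r j} {white r′ j′} (horizontal-injective eq) = refl , refl , refl
    edge-injective upperLeft  lowerRight {r} {j} {r′} {j′} eq
      with () ← position-injective {white r j} {black r′ j′} (horizontal-injective eq)
    edge-injective upperRight upperRight {r} {j} {r′} {j′} eq
      with refl ← position-injective {white r (suc j)} {white r′ (suc j′)} (vertical-injective eq) = refl , refl , refl
    edge-injective upperRight lowerLeft  {r} {j} {r′} {j′} eq
      with () ← position-injective {white r (suc j)} {black r′ j′} (vertical-injective eq)
    edge-injective lowerLeft  lowerRight ()
    edge-injective lowerLeft  upperLeft  ()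
    edge-injective lowerRight lowerLeft  ()
    edge-injective lowerRight upperRight ()
    edge-injective upperLeft  lowerLeft  ()
    edge-injective upperLeft  upperRight ()
    edge-injective upperRight lowerRight ()
    edge-injective upperRight upperLeft  ()

    IsEdge : Domino → Set
    IsEdge d = ∃[ κ ] ∃[ r ] ∃[ j ] (d ≡ edge κ r j × r < n × j < n)

    edge-inside : ∀ κ r j → r < n → j < n → All (AD n) (squares (edge κ r j))
    edge-inside κ r j r<n j<n = subst (All (AD n)) (sym (squares-edge κ r j))
      (position-AD (first κ r j) (valid₁ κ) ∷ position-AD (second κ r j) (valid₂ κ) ∷ [])
      where
      valid₁ : ∀ κ → Valid n (first κ r j)
      valid₁ lowerLeft  = ℕ.<⇒≤ r<n , j<n
      valid₁ lowerRight = ℕ.<⇒≤ r<n , j<n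
      valid₁ upperLeft  = r<n , ℕ.<⇒≤ j<n
      valid₁ upperRight = r<n , j<n
      valid₂ : ∀ κ → Valid n (second κ r j)
      valid₂ lowerLeft  = r<n , ℕ.<⇒≤ j<n
      valid₂ lowerRight = r<n , j<n
      valid₂ upperLeft  = r<n , j<n
      valid₂ upperRight = r<n , j<n

    private
      second-valid : ∀ κ r j → All (AD n) (squares (edge κ r j)) → Valid n (second κ r j)
      second-valid κ r j ads with _ ∷ ad ∷ [] ← subst (All (AD n)) (squares-edge κ r j) ads =
        AD-position (second κ r j) ad

    -- The orientation and the colour of the western or southern square determine the kind of edge.
    inside⇒edge : ∀ d → All (AD n) (squares d) → IsEdge d
    inside⇒edge (horizontal z) ads@(ad ∷ _) with locate ad
    ... | black r j , (_ , j<n) , refl = lowerRight , r , j , refl , proj₁ (second-valid lowerRight r j ads) , j<n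
    ... | white r j , (r<n , _) , refl = upperLeft , r , j , refl , r<n , proj₂ (second-valid upperLeft r j ads)
    inside⇒edge (vertical z) ads@(ad ∷ ad′ ∷ []) with locate ad
    ... | black r j       , (_ , j<n) , refl = lowerLeft , r , j , refl , proj₁ (second-valid lowerLeft r j ads) , j<n
    ... | white r (suc j) , (r<n , j<n) , refl = upperRight , r , j , refl , r<n , j<n
    -- The northern square of such a domino would have second diagonal coordinate -1.
    ... | white r zero    , _         , refl
      with _ , _ , diagonal _ q , _ ← AD⇒Diagonal ad′ = ⊥-elim (absurd (trans (sym (lemma (+ r) (+ n))) q))
      where
      lemma : ∀ r n → r + 0ℤ - n - (r - 0ℤ + 1ℤ) + n ≡ - 1ℤ
      lemma = solve-∀
      absurd : ∀ {d} → ¬ - 1ℤ ≡ + d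
      absurd ()

    module _ (t : Tiling n) where

      tilingBits : Bits
      tilingBits κ r j = member t (edge κ r j)

      private
        bitAt⇒ : ∀ q κ → bitAt tilingBits q κ ≡ true →
          ∃[ r ] ∃[ j ] (at q κ ≡ just (r , j) × member t (edge κ r j) ≡ true)
        bitAt⇒ q κ eq with at q κ
        ... | just (r , j) = r , j , refl , eq

        bitAt⇐ : ∀ q κ {r j} → at q κ ≡ just (r , j) → member t (edge κ r j) ≡ true → bitAt tilingBits q κ ≡ true
        bitAt⇐ q κ eq m rewrite eq = m

      tiling-config : IsConfig n tilingBits
      tiling-config = record { outside = out ; one = ones }
        where
        out : ∀ κ r j → tilingBits κ r j ≡ true → r < n × j < n
        out κ r j m with κ′ , r′ , j′ , eq , r<n , j<n ← inside⇒edge (edge κ r j) (inside t _ m)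
          with refl , refl , refl ← edge-injective κ κ′ eq = r<n , j<n
        ones : ∀ q → Valid n q → One (bitAt tilingBits q)
        ones q valid with d , (m , q∈) , unique ← covers t (position q) (position-AD q valid) =
          One-intro (bitAt tilingBits q) exists λ κ κ′ p p′ → same κ κ′ (bitAt⇒ q κ p) (bitAt⇒ q κ′ p′)
          where
          exists : ∃[ κ ] bitAt tilingBits q κ ≡ true
          exists with κ , r , j , refl , _ ← inside⇒edge d (inside t d m) =
            κ , bitAt⇐ q κ (∈-edge⁻¹ q κ q∈) m
          same : ∀ κ κ′ → ∃[ r ] ∃[ j ] (at q κ ≡ just (r , j) × member t (edge κ r j) ≡ true) →
            ∃[ r ] ∃[ j ] (at q κ′ ≡ just (r , j) × member t (edge κ′ r j) ≡ true) → κ ≡ κ′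
          same κ κ′ (r , j , eq , m) (r′ , j′ , eq′ , m′) = proj₁ (edge-injective κ κ′
            (trans (sym (unique (m , ∈-edge q κ eq))) (unique (m′ , ∈-edge q κ′ eq′))))

    module _ (b : Bits) (config : IsConfig n b) where

      open IsConfig config

      private
        AD? : ∀ z → Dec (AD n z)
        AD? z = All.all? (λ (x , y) → ∣ x ∣ ℕ.+ ∣ y ∣ ℕ.≤? suc n) (corners z)

        bit : ∀ d → Dec (All (AD n) (squares d)) → Bool
        bit d (yes ads) with κ , r , j , _ ← inside⇒edge d ads = b κ r j
        bit d (no _)    = false

        bit-edge : ∀ κ r j dec → bit (edge κ r j) dec ≡ b κ r j
        bit-edge κ r j (yes ads) with κ′ , r′ , j′ , eq , _ ← inside⇒edge (edge κ r j) ads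
          with refl , refl , refl ← edge-injective κ κ′ eq = refl
        bit-edge κ r j (no ¬ads) = sym (¬-not λ m →
          ¬ads (edge-inside κ r j (proj₁ (outside κ r j m)) (proj₂ (outside κ r j m))))

        bit-inside : ∀ d dec → bit d dec ≡ true → All (AD n) (squares d)
        bit-inside d (yes ads) _ = ads

        mem : Domino → Bool
        mem d = bit d (All.all? AD? (squares d))

        mem-edge : ∀ κ r j → mem (edge κ r j) ≡ b κ r j
        mem-edge κ r j = bit-edge κ r j (All.all? AD? (squares (edge κ r j)))

        covering : ∀ q → Valid n q →
          ∃[ d ] ((mem d ≡ true × position q ∈ squares d) ×
                  (∀ {d′} → mem d′ ≡ true × position q ∈ squares d′ → d ≡ d′))
        covering q valid with κ , p ← One-total {bitAt b q} (one q valid) = from-at (at q κ) refl p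
          where
          from-at : ∀ m → at q κ ≡ m → bitAt b q κ ≡ true →
            ∃[ d ] ((mem d ≡ true × position q ∈ squares d) ×
                    (∀ {d′} → mem d′ ≡ true × position q ∈ squares d′ → d ≡ d′))
          from-at nothing eq p rewrite eq with () ← p
          from-at (just (r , j)) eq p = edge κ r j , (trans (mem-edge κ r j) (read eq p) , ∈-edge q κ eq) , unique
            where
            read : ∀ {κ r j} → at q κ ≡ just (r , j) → bitAt b q κ ≡ true → b κ r j ≡ true
            read eq p rewrite eq = p
            write : ∀ κ {r j} → at q κ ≡ just (r , j) → b κ r j ≡ true → bitAt b q κ ≡ true
            write κ eq p rewrite eq = p
            unique : ∀ {d′} → mem d′ ≡ true × position q ∈ squares d′ → edge κ r j ≡ d′
            unique {d′} (m , q∈) with κ′ , r′ , j′ , refl , _ ← inside⇒edge d′ (bit-inside d′ (All.all? AD? (squares d′)) m)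
              -- At `q` exactly one kind is set, and `at` then determines the cell.
              with refl ← One-unique {bitAt b q} (one q valid) κ κ′ p
                            (write κ′ (∈-edge⁻¹ q κ′ q∈) (trans (sym (mem-edge κ′ r′ j′)) m))
              with refl ← trans (sym eq) (∈-edge⁻¹ q κ q∈) = refl

      tiling : Tiling n
      tiling = record
        { member = mem
        ; inside = λ d → bit-inside d (All.all? AD? (squares d))
        ; covers = λ z ad → cover z (locate ad)
        }
        where
        cover : ∀ z → ∃[ q ] (Valid n q × position q ≡ z) →
          ∃[ d ] ((mem d ≡ true × z ∈ squares d) × (∀ {d′} → mem d′ ≡ true × z ∈ squares d′ → d ≡ d′))
        cover z (q , valid , refl) = covering q valid

      member-tiling : ∀ κ r j → member tiling (edge κ r j) ≡ b κ r j
      member-tiling = mem-edge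

    -- Dominoes within the region are edges, and by `inside` no tiling contains any other domino.
    tiling-ext : (t u : Tiling n) → (∀ κ r j → member t (edge κ r j) ≡ member u (edge κ r j)) →
      ∀ d → member t d ≡ member u d
    tiling-ext t u eq d with All.all? (λ z → All.all? (λ (x , y) → ∣ x ∣ ℕ.+ ∣ y ∣ ℕ.≤? suc n) (corners z)) (squares d)
    ... | yes ads with κ , r , j , refl , _ ← inside⇒edge d ads = eq κ r j
    ... | no ¬ads = trans (¬-not λ m → ¬ads (inside t d m)) (sym (¬-not λ m → ¬ads (inside u d m)))

    toCode : Tiling n → Code n
    toCode t = code (tilingBits t) (tiling-config t)

    fromCode : Code n → Tiling n
    fromCode c = tiling (bits n c) (bits-config c)

    bits-toCode : ∀ t κ r j → bits n (toCode t) κ r j ≡ member t (edge κ r j)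
    bits-toCode t = bits-code (tilingBits t) (tiling-config t)

    member-fromCode : ∀ c κ r j → member (fromCode c) (edge κ r j) ≡ bits n c κ r j
    member-fromCode c = member-tiling (bits n c) (bits-config c)

    tilings-cardinality : HasCardinality (tilings n) (power n)
    tilings-cardinality = record
      { to        = λ t → Inverse.to (Code↔Fin n) (toCode t)
      ; from      = λ i → fromCode (Inverse.from (Code↔Fin n) i)
      ; to-cong   = λ {t} {u} t≈u → cong (Inverse.to (Code↔Fin n)) (toCode-cong t u t≈u)
      ; from-cong = λ { refl d → refl }
      ; inverse   =
          (λ {i} {t} t≈ → trans (cong (Inverse.to (Code↔Fin n)) (toCode-from (Inverse.from (Code↔Fin n) i) t t≈))
                                (Inverse.strictlyInverseˡ (Code↔Fin n) i)) ,
          (λ { {t} refl d → trans (cong (λ c → member (fromCode c) d) (Inverse.strictlyInverseʳ (Code↔Fin n) (toCode t)))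
                 (tiling-ext (fromCode (toCode t)) t
                   (λ κ r j → trans (member-fromCode (toCode t) κ r j) (bits-toCode t κ r j)) d) })
      }
      where
      toCode-from : ∀ c t → (∀ d → member t d ≡ member (fromCode c) d) → toCode t ≡ c
      toCode-from c t t≈ = bits-injective (toCode t) c λ κ r j →
        trans (bits-toCode t κ r j) (trans (t≈ (edge κ r j)) (member-fromCode c κ r j))
      toCode-cong : ∀ t u → (∀ d → member t d ≡ member u d) → toCode t ≡ toCode u
      toCode-cong t u t≈u = bits-injective (toCode t) (toCode u) λ κ r j →
        trans (bits-toCode t κ r j) (trans (t≈u (edge κ r j)) (sym (bits-toCode u κ r j)))

-- The two evaluations compared.

open import Defs
open import Data.Integer.Base using (ℤ; +_)
open import Data.Nat.Base using (ℕ; _+_; _≥_)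
open import Data.Product.Base using (_×_; _,_; ∃-syntax)
open import Relation.Binary.PropositionalEquality using (_≡_; refl; sym)

open HamburgerDeterminant using (power; A; B; hamburger; det-hamburger)
open AztecPaths using (A-counts; B-counts)
open AztecTilings using (tilings-cardinality)

corollary5p2 : (n : ℕ) → n ≥ 1 →
    ∃[ t ] ∃[ M ] HasCardinality (tilings n) t × IsHamburgerMatrix n M × + t ≡ det M
corollary5p2 n _ =
  power n , hamburger n , tilings-cardinality n ,
  (A n , B n , A-counts n , B-counts n , λ _ _ → refl) , sym (det-hamburger n)
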